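{- Let $q\ge3$, let $g\in\mathbb{F}_q[t]$ be a non-constant square-free polynomial that is not a Carmichael polynomial, and let $\ell$ be a prime factor of $q-1$. Then there exist infinitely many cyclic extensions $K$ of $\mathbb{F}_q(t)$ of degree $\ell$ whose discriminants are relatively prime to $g$ such that $g$ is not Carmichael in $K$.
   Context: $\mathbb{F}_q$ is the finite field with $q$ elements. A finite ring $S$ is a Carmichael ring if $S$ is not a field and $a^{|S|}=a$ for every $a\in S$; an ideal $I$ of a ring $R$ is a Carmichael ideal if $R/I$ is a Carmichael ring. A polynomial $g\in\mathbb{F}_q[t]$ is a Carmichael polynomial if $(g)$ is a Carmichael ideal of $\mathbb{F}_q[t]$. For a finite extension $K$ of $\mathbb{F}_q(t)$, $\mathcal{O}_K$ denotes the integral closure of $\mathbb{F}_q[t]$ in $K$, and an element $\alpha\in\mathcal{O}_K$ is Carmichael in $K$ if $\alpha\mathcal{O}_K$ is a Carmichael ideal of $\mathcal{O}_K$. The discriminant of $K$ is the discriminant ideal of $\mathcal{O}_K$ over $\mathbb{F}_q[t]$; "relatively prime to $g$" means no irreducible factor of $g$ divides it. -}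

module Defs where

open import Algebra.Bundles using (CommutativeRing; Semiring)
open import Algebra.Definitions using (Invertible)
import Algebra.Definitions.RawSemiring as RawSemiringDefinitions
open import Algebra.Morphism.Structures using (module RingMorphisms)
import Algebra.Morphism.Construct.Composition as Composition
import Algebra.Properties.AbelianGroup as AbelianGroupProperties
import Algebra.Properties.CommutativeSemigroup as CommutativeSemigroupProperties
import Algebra.Properties.Ring as RingProperties
import Algebra.Properties.Semiring.Divisibility as Divisibility
import Algebra.Properties.Semiring.Exp as Exponentiation
import Algebra.Properties.Semiring.Sum as Summation
open import Data.Empty using (⊥-elim)
open import Data.Fin.Base using (Fin; zero; suc; toℕ; punchIn)
import Data.Fin.Properties as Fin
open import Data.List.Base as List using (List; []; _∷_; _++_)
open import Data.List.Membership.Propositional.Properties using (∈-lookup)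
open import Data.List.Relation.Unary.All as All using (All; []; _∷_)
open import Data.List.Relation.Unary.All.Properties using (++⁺; map⁺)
open import Data.Nat.Base as ℕ using (ℕ; zero; suc)
open import Data.Nat.GeneralisedArithmetic using (iterate)
import Data.Nat.Properties as ℕ
open import Data.Product.Base using (Σ; ∃; ∃-syntax; _×_; _,_; proj₁; proj₂)
open import Data.Sum.Base using (_⊎_; inj₁; inj₂)
open import Function.Base using (_∘_)
open import Function.Bundles using (Inverse)
open import Level using (Level; _⊔_; 0ℓ) renaming (suc to lsuc)
open import Relation.Binary.PropositionalEquality as ≡ using (_≡_; _≢_)
import Relation.Binary.Reasoning.Setoid as SetoidReasoning
open import Relation.Nullary using (¬_; Dec; yes; no)
open import Relation.Unary using (Pred)
import Algebra.Solver.Ring.NaturalCoefficients.Default as SemiringSolver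

private variable
  c p ℓ : Level

module RingNotions (R : CommutativeRing c ℓ) where
  open CommutativeRing R hiding (zero)
  open Exponentiation semiring using (_^_)
  open Summation semiring using (sum)

  IsField : Set (c ⊔ ℓ)
  IsField = 1# ≉ 0# × (∀ x → x ≉ 0# → Invertible _≈_ 1# _*_ x)

  IsDomain : Set (c ⊔ ℓ)
  IsDomain = 1# ≉ 0# × (∀ x y → x * y ≈ 0# → x ≈ 0# ⊎ y ≈ 0#)

  HasCardinality : ℕ → Set (c ⊔ ℓ)
  HasCardinality n = Inverse setoid (≡.setoid (Fin n))

  IsCarmichaelRing : Set (c ⊔ ℓ)
  IsCarmichaelRing = ¬ IsField × (∃[ n ] HasCardinality n × (∀ x → x ^ n ≈ x))

  -- Laplace expansion along the first row.
  det : ∀ {n} → (Fin n → Fin n → Carrier) → Carrier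
  det {zero}  M = 1#
  det {suc n} M =
    sum (λ j → (- 1#) ^ toℕ j * (M zero j * det (λ i k → M (suc i) (punchIn j k))))

record Ideal (R : CommutativeRing c ℓ) p : Set (c ⊔ ℓ ⊔ lsuc p) where
  open CommutativeRing R hiding (zero)
  field
    Member   : Pred Carrier p
    resp     : ∀ {x y} → x ≈ y → Member x → Member y
    0-member : Member 0#
    +-member : ∀ {x y} → Member x → Member y → Member (x + y)
    *-member : ∀ r {x} → Member x → Member (r * x)

module _ (R : CommutativeRing c ℓ) where
  open CommutativeRing R hiding (zero)

  private
    module S = Divisibility semiring
    open SetoidReasoning setoid

  principal : Carrier → Ideal R (c ⊔ ℓ)
  principal a = record
    { Member   = a S.∣_
    ; resp     = S.∣ʳ-respʳ-≈
    ; 0-member = a S.∣0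
    ; +-member = λ where
        (s S., sa≈x) (t S., ta≈y) → (s + t) S., trans (distribʳ a s t) (+-cong sa≈x ta≈y)
    ; *-member = λ where
        r (s S., sa≈x) → (r * s) S., trans (*-assoc r s a) (*-congˡ sa≈x)
    }

  data Generated (G : Pred Carrier p) : Pred Carrier (c ⊔ ℓ ⊔ p) where
    gen      : ∀ {x} → G x → Generated G x
    gen-resp : ∀ {x y} → x ≈ y → Generated G x → Generated G y
    gen-0    : Generated G 0#
    gen-+    : ∀ {x y} → Generated G x → Generated G y → Generated G (x + y)
    gen-*    : ∀ r {x} → Generated G x → Generated G (r * x)

  generatedIdeal : Pred Carrier p → Ideal R (c ⊔ ℓ ⊔ p)
  generatedIdeal G = record
    { Member   = Generated G
    ; resp     = gen-resp
    ; 0-member = gen-0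
    ; +-member = gen-+
    ; *-member = gen-*
    }

  -- Divisibility of ideals in a Dedekind domain: J divides I iff I ⊆ J.
  _dividesIdeal_ : ∀ {p q} → Ideal R p → Ideal R q → Set (c ⊔ p ⊔ q)
  J dividesIdeal I = ∀ {x} → Ideal.Member I x → Ideal.Member J x

module Quotient (R : CommutativeRing c ℓ) (I : Ideal R p) where
  open CommutativeRing R hiding (zero)
  open Ideal I
  open RingProperties ring
  open AbelianGroupProperties +-abelianGroup using (⁻¹-∙-comm)
  open SetoidReasoning setoid
  open CommutativeSemigroupProperties +-commutativeSemigroup using (interchange)

  record _≡ᴵ_ (x y : Carrier) : Set p where
    constructor congruent
    field difference : Member (x - y)

  open _≡ᴵ_

  private
    neg-member : ∀ {x} → Member x → Member (- x)
    neg-member {x} m = resp (-1*x≈-x x) (*-member (- 1#) m)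

    ≈⇒≡ᴵ : ∀ {x y} → x ≈ y → x ≡ᴵ y
    ≈⇒≡ᴵ {x} {y} x≈y = congruent (resp (sym (trans (+-congʳ x≈y) (-‿inverseʳ y))) 0-member)

    sym′ : ∀ {x y} → x ≡ᴵ y → y ≡ᴵ x
    sym′ {x} {y} (congruent m) = congruent (resp eq (neg-member m))
      where
      eq : - (x - y) ≈ y - x
      eq = begin
        - (x - y)     ≈⟨ ⁻¹-∙-comm x (- y) ⟨
        - x + - - y   ≈⟨ +-congˡ (-‿involutive y) ⟩
        - x + y       ≈⟨ +-comm (- x) y ⟩
        y - x         ∎

    trans′ : ∀ {x y z} → x ≡ᴵ y → y ≡ᴵ z → x ≡ᴵ z
    trans′ {x} {y} {z} (congruent m) (congruent n) = congruent (resp eq (+-member m n))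
      where
      eq : (x - y) + (y - z) ≈ x - z
      eq = begin
        (x - y) + (y - z)     ≈⟨ +-assoc x (- y) (y - z) ⟩
        x + (- y + (y - z))   ≈⟨ +-congˡ (+-assoc (- y) y (- z)) ⟨
        x + ((- y + y) - z)   ≈⟨ +-congˡ (+-congʳ (-‿inverseˡ y)) ⟩
        x + (0# - z)          ≈⟨ +-congˡ (+-identityˡ (- z)) ⟩
        x - z                 ∎

    +-cong′ : ∀ {x y u v} → x ≡ᴵ y → u ≡ᴵ v → (x + u) ≡ᴵ (y + v)
    +-cong′ {x} {y} {u} {v} (congruent m) (congruent n) = congruent (resp eq (+-member m n))
      where
      eq : (x - y) + (u - v) ≈ (x + u) - (y + v)
      eq = trans (interchange x (- y) u (- v)) (+-congˡ (⁻¹-∙-comm y v))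

    neg-cong′ : ∀ {x y} → x ≡ᴵ y → (- x) ≡ᴵ (- y)
    neg-cong′ {x} {y} (congruent m) = congruent (resp (sym (⁻¹-∙-comm x (- y))) (neg-member m))

    *-cong′ : ∀ {x y u v} → x ≡ᴵ y → u ≡ᴵ v → (x * u) ≡ᴵ (y * v)
    *-cong′ {x} {y} {u} {v} (congruent m) (congruent n) = trans′
      (congruent (resp (trans (distribˡ u x (- y)) (+-cong (*-comm u x)
        (trans (*-comm u (- y)) (sym (-‿distribˡ-* y u))))) (*-member u m)))
      (congruent (resp (trans (distribˡ y u (- v)) (+-congˡ (sym (-‿distribʳ-* y v))))
        (*-member y n)))

  quotientRing : CommutativeRing c p
  quotientRing = record
    { Carrier = Carrier
    ; _≈_ = _≡ᴵ_
    ; _+_ = _+_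
    ; _*_ = _*_
    ; -_  = -_
    ; 0#  = 0#
    ; 1#  = 1#
    ; isCommutativeRing = record
      { isRing = record
        { +-isAbelianGroup = record
          { isGroup = record
            { isMonoid = record
              { isSemigroup = record
                { isMagma = record
                  { isEquivalence = record { refl = ≈⇒≡ᴵ refl ; sym = sym′ ; trans = trans′ }
                  ; ∙-cong = +-cong′
                  }
                ; assoc = λ x y z → ≈⇒≡ᴵ (+-assoc x y z)
                }
              ; identity = (λ x → ≈⇒≡ᴵ (+-identityˡ x)) , (λ x → ≈⇒≡ᴵ (+-identityʳ x))
              }
            ; inverse = (λ x → ≈⇒≡ᴵ (-‿inverseˡ x)) , (λ x → ≈⇒≡ᴵ (-‿inverseʳ x))
            ; ⁻¹-cong = neg-cong′
            }
          ; comm = λ x y → ≈⇒≡ᴵ (+-comm x y)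
          }
        ; *-cong = *-cong′
        ; *-assoc = λ x y z → ≈⇒≡ᴵ (*-assoc x y z)
        ; *-identity = (λ x → ≈⇒≡ᴵ (*-identityˡ x)) , (λ x → ≈⇒≡ᴵ (*-identityʳ x))
        ; distrib = (λ x y z → ≈⇒≡ᴵ (distribˡ x y z)) , (λ x y z → ≈⇒≡ᴵ (distribʳ x y z))
        }
      ; *-comm = λ x y → ≈⇒≡ᴵ (*-comm x y)
      }
    }

IsCarmichaelIdeal : (R : CommutativeRing c ℓ) → Ideal R p → Set (c ⊔ p)
IsCarmichaelIdeal R I = RingNotions.IsCarmichaelRing (Quotient.quotientRing R I)

-- A polynomial is the list of its coefficients, constant term first; lists
-- that differ by trailing zeros are identified.
module Polynomial (R : CommutativeRing c ℓ) where
  open CommutativeRing R hiding (zero)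
  open RingProperties ring using (-0#≈0#)
  open AbelianGroupProperties +-abelianGroup using (⁻¹-∙-comm)
  open SemiringSolver commutativeSemiring using (solve; _:=_; _:+_)

  Poly : Set c
  Poly = List Carrier

  coeff : Poly → ℕ → Carrier
  coeff []      n       = 0#
  coeff (x ∷ p) zero    = x
  coeff (x ∷ p) (suc n) = coeff p n

  infix 4 _≈ₚ_
  record _≈ₚ_ (p q : Poly) : Set ℓ where
    constructor coeffwise
    field at : ∀ n → coeff p n ≈ coeff q n

  open _≈ₚ_ public

  infixl 6 _+ₚ_
  infixl 7 _*ₚ_ _·ₚ_

  _+ₚ_ : Poly → Poly → Poly
  []      +ₚ q       = q
  (x ∷ p) +ₚ []      = x ∷ p
  (x ∷ p) +ₚ (y ∷ q) = (x + y) ∷ (p +ₚ q)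

  _·ₚ_ : Carrier → Poly → Poly
  x ·ₚ p = List.map (x *_) p

  -ₚ_ : Poly → Poly
  -ₚ p = List.map -_ p

  -- (x + t p) q = x q + t (p q)
  _*ₚ_ : Poly → Poly → Poly
  []      *ₚ q = []
  (x ∷ p) *ₚ q = (x ·ₚ q) +ₚ (0# ∷ (p *ₚ q))

  constant : Carrier → Poly
  constant x = x ∷ []

  IsConstant : Poly → Set (c ⊔ ℓ)
  IsConstant p = ∃[ x ] p ≈ₚ constant x

  coeff-+ : ∀ p q n → coeff (p +ₚ q) n ≈ coeff p n + coeff q n
  coeff-+ []      q       n       = sym (+-identityˡ _)
  coeff-+ (x ∷ p) []      n       = sym (+-identityʳ _)
  coeff-+ (x ∷ p) (y ∷ q) zero    = refl
  coeff-+ (x ∷ p) (y ∷ q) (suc n) = coeff-+ p q n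

  coeff-· : ∀ x p n → coeff (x ·ₚ p) n ≈ x * coeff p n
  coeff-· x []      n       = sym (zeroʳ x)
  coeff-· x (y ∷ p) zero    = refl
  coeff-· x (y ∷ p) (suc n) = coeff-· x p n

  coeff-neg : ∀ p n → coeff (-ₚ p) n ≈ - coeff p n
  coeff-neg []      n       = sym -0#≈0#
  coeff-neg (x ∷ p) zero    = refl
  coeff-neg (x ∷ p) (suc n) = coeff-neg p n

  reflₚ : ∀ {p} → p ≈ₚ p
  reflₚ = coeffwise λ n → refl

  symₚ : ∀ {p q} → p ≈ₚ q → q ≈ₚ p
  symₚ e = coeffwise λ n → sym (at e n)

  transₚ : ∀ {p q r} → p ≈ₚ q → q ≈ₚ r → p ≈ₚ r
  transₚ e f = coeffwise λ n → trans (at e n) (at f n)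

  ∷-cong : ∀ {x y p q} → x ≈ y → p ≈ₚ q → (x ∷ p) ≈ₚ (y ∷ q)
  ∷-cong {x} {y} {p} {q} x≈y e = coeffwise go
    where
    go : ∀ n → coeff (x ∷ p) n ≈ coeff (y ∷ q) n
    go zero    = x≈y
    go (suc n) = at e n

  ∷-tail : ∀ {x y p q} → (x ∷ p) ≈ₚ (y ∷ q) → p ≈ₚ q
  ∷-tail e = coeffwise (at e ∘ suc)

  ∷-zero : ∀ {x p} → x ≈ 0# → p ≈ₚ [] → (x ∷ p) ≈ₚ []
  ∷-zero {x} {p} x≈0 e = coeffwise go
    where
    go : ∀ n → coeff (x ∷ p) n ≈ 0#
    go zero    = x≈0
    go (suc n) = at e n

  private
    tail-zero : ∀ {x p} → (x ∷ p) ≈ₚ [] → p ≈ₚ []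
    tail-zero e = coeffwise (at e ∘ suc)

    +-congₚ : ∀ {p q r s} → p ≈ₚ q → r ≈ₚ s → (p +ₚ r) ≈ₚ (q +ₚ s)
    +-congₚ {p} {q} {r} {s} e f = coeffwise λ n →
      trans (coeff-+ p r n) (trans (+-cong (at e n) (at f n)) (sym (coeff-+ q s n)))

    ·-congₚ : ∀ {x y p q} → x ≈ y → p ≈ₚ q → (x ·ₚ p) ≈ₚ (y ·ₚ q)
    ·-congₚ {x} {y} {p} {q} e f = coeffwise λ n →
      trans (coeff-· x p n) (trans (*-cong e (at f n)) (sym (coeff-· y q n)))

    neg-congₚ : ∀ {p q} → p ≈ₚ q → (-ₚ p) ≈ₚ (-ₚ q)
    neg-congₚ {p} {q} e = coeffwise λ n →
      trans (coeff-neg p n) (trans (-‿cong (at e n)) (sym (coeff-neg q n)))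

    +-assocₚ : ∀ p q r → ((p +ₚ q) +ₚ r) ≈ₚ (p +ₚ (q +ₚ r))
    +-assocₚ p q r = coeffwise λ n →
      trans (coeff-+ (p +ₚ q) r n) (trans (+-congʳ (coeff-+ p q n)) (trans (+-assoc _ _ _)
        (sym (trans (coeff-+ p (q +ₚ r) n) (+-congˡ (coeff-+ q r n))))))

    +-commₚ : ∀ p q → (p +ₚ q) ≈ₚ (q +ₚ p)
    +-commₚ p q = coeffwise λ n →
      trans (coeff-+ p q n) (trans (+-comm _ _) (sym (coeff-+ q p n)))

    +-identityʳₚ : ∀ p → (p +ₚ []) ≈ₚ p
    +-identityʳₚ p = coeffwise λ n → trans (coeff-+ p [] n) (+-identityʳ _)

    +-inverseˡₚ : ∀ p → ((-ₚ p) +ₚ p) ≈ₚ []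
    +-inverseˡₚ p = coeffwise λ n →
      trans (coeff-+ (-ₚ p) p n) (trans (+-congʳ (coeff-neg p n)) (-‿inverseˡ _))

    +-inverseʳₚ : ∀ p → (p +ₚ (-ₚ p)) ≈ₚ []
    +-inverseʳₚ p = transₚ (+-commₚ p (-ₚ p)) (+-inverseˡₚ p)

    interchange : ∀ p q r s → ((p +ₚ q) +ₚ (r +ₚ s)) ≈ₚ ((p +ₚ r) +ₚ (q +ₚ s))
    interchange p q r s = coeffwise λ n →
      trans (split p q r s n) (trans
        (solve 4 (λ a b c d → ((a :+ b) :+ (c :+ d)) := ((a :+ c) :+ (b :+ d))) refl
          (coeff p n) (coeff q n) (coeff r n) (coeff s n))
        (sym (split p r q s n)))
      where
      split : ∀ p q r s n → coeff ((p +ₚ q) +ₚ (r +ₚ s)) n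
                          ≈ (coeff p n + coeff q n) + (coeff r n + coeff s n)
      split p q r s n = trans (coeff-+ (p +ₚ q) (r +ₚ s) n) (+-cong (coeff-+ p q n) (coeff-+ r s n))

    ·-zeroˡ : ∀ {x} p → x ≈ 0# → (x ·ₚ p) ≈ₚ []
    ·-zeroˡ {x} p e = coeffwise λ n → trans (coeff-· x p n) (trans (*-congʳ e) (zeroˡ _))

    ·-distrib-+ₚ : ∀ x p q → (x ·ₚ (p +ₚ q)) ≈ₚ ((x ·ₚ p) +ₚ (x ·ₚ q))
    ·-distrib-+ₚ x p q = coeffwise λ n →
      trans (coeff-· x (p +ₚ q) n) (trans (*-congˡ (coeff-+ p q n)) (trans (distribˡ _ _ _)
        (sym (trans (coeff-+ (x ·ₚ p) (x ·ₚ q) n) (+-cong (coeff-· x p n) (coeff-· x q n))))))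

    ·-distribʳ : ∀ x y p → ((x + y) ·ₚ p) ≈ₚ ((x ·ₚ p) +ₚ (y ·ₚ p))
    ·-distribʳ x y p = coeffwise λ n →
      trans (coeff-· (x + y) p n) (trans (distribʳ _ _ _)
        (sym (trans (coeff-+ (x ·ₚ p) (y ·ₚ p) n) (+-cong (coeff-· x p n) (coeff-· y p n)))))

    ·-assoc : ∀ x y p → ((x * y) ·ₚ p) ≈ₚ (x ·ₚ (y ·ₚ p))
    ·-assoc x y p = coeffwise λ n →
      trans (coeff-· (x * y) p n) (trans (*-assoc _ _ _)
        (sym (trans (coeff-· x (y ·ₚ p) n) (*-congˡ (coeff-· y p n)))))

    shift-+ : ∀ p q → (0# ∷ (p +ₚ q)) ≈ₚ ((0# ∷ p) +ₚ (0# ∷ q))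
    shift-+ p q = ∷-cong (sym (+-identityˡ 0#)) reflₚ

    *-zeroʳₚ : ∀ p {q} → q ≈ₚ [] → (p *ₚ q) ≈ₚ []
    *-zeroʳₚ []      e = reflₚ
    *-zeroʳₚ (x ∷ p) e = +-congₚ (·-congₚ refl e) (∷-zero refl (*-zeroʳₚ p e))

    *-zeroˡₚ : ∀ p {q} → p ≈ₚ [] → (p *ₚ q) ≈ₚ []
    *-zeroˡₚ []      e = reflₚ
    *-zeroˡₚ (x ∷ p) {q} e =
      +-congₚ (·-zeroˡ q (at e zero)) (∷-zero refl (*-zeroˡₚ p (tail-zero e)))

    *-congʳₚ : ∀ p {q r} → q ≈ₚ r → (p *ₚ q) ≈ₚ (p *ₚ r)
    *-congʳₚ []      e = reflₚ
    *-congʳₚ (x ∷ p) e = +-congₚ (·-congₚ refl e) (∷-cong refl (*-congʳₚ p e))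

    *-congˡₚ : ∀ p q {r} → p ≈ₚ q → (p *ₚ r) ≈ₚ (q *ₚ r)
    *-congˡₚ []      q       e = symₚ (*-zeroˡₚ q (symₚ e))
    *-congˡₚ (x ∷ p) []      e = *-zeroˡₚ (x ∷ p) e
    *-congˡₚ (x ∷ p) (y ∷ q) e =
      +-congₚ (·-congₚ (at e zero) reflₚ) (∷-cong refl (*-congˡₚ p q (∷-tail e)))

    *-congₚ : ∀ {p q r s} → p ≈ₚ q → r ≈ₚ s → (p *ₚ r) ≈ₚ (q *ₚ s)
    *-congₚ {p} {q} e f = transₚ (*-congʳₚ p f) (*-congˡₚ p q e)

    *-distribʳₚ : ∀ r p q → ((p +ₚ q) *ₚ r) ≈ₚ ((p *ₚ r) +ₚ (q *ₚ r))
    *-distribʳₚ r []      q       = reflₚ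
    *-distribʳₚ r (x ∷ p) []      = symₚ (+-identityʳₚ _)
    *-distribʳₚ r (x ∷ p) (y ∷ q) = transₚ
      (+-congₚ (·-distribʳ x y r)
        (transₚ (∷-cong refl (*-distribʳₚ r p q)) (shift-+ (p *ₚ r) (q *ₚ r))))
      (interchange (x ·ₚ r) (y ·ₚ r) (0# ∷ (p *ₚ r)) (0# ∷ (q *ₚ r)))

    *-∷ : ∀ p y q → (p *ₚ (y ∷ q)) ≈ₚ ((y ·ₚ p) +ₚ (0# ∷ (p *ₚ q)))
    *-∷ []      y q = symₚ (∷-zero refl reflₚ)
    *-∷ (x ∷ p) y q = ∷-cong (+-congʳ (*-comm x y))
      (transₚ (+-congₚ reflₚ (*-∷ p y q))
        (transₚ (symₚ (+-assocₚ (x ·ₚ q) (y ·ₚ p) (0# ∷ (p *ₚ q))))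
          (transₚ (+-congₚ (+-commₚ (x ·ₚ q) (y ·ₚ p)) reflₚ)
            (+-assocₚ (y ·ₚ p) (x ·ₚ q) (0# ∷ (p *ₚ q))))))

    *-commₚ : ∀ p q → (p *ₚ q) ≈ₚ (q *ₚ p)
    *-commₚ []      q = symₚ (*-zeroʳₚ q reflₚ)
    *-commₚ (x ∷ p) q =
      transₚ (+-congₚ reflₚ (∷-cong refl (*-commₚ p q))) (symₚ (*-∷ q x p))

    ·-*-assoc : ∀ x p q → ((x ·ₚ p) *ₚ q) ≈ₚ (x ·ₚ (p *ₚ q))
    ·-*-assoc x []      q = reflₚ
    ·-*-assoc x (y ∷ p) q = transₚ
      (+-congₚ (·-assoc x y q) (∷-cong (sym (zeroʳ x)) (·-*-assoc x p q)))
      (symₚ (·-distrib-+ₚ x (y ·ₚ q) (0# ∷ (p *ₚ q))))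

    *-assocₚ : ∀ p q r → ((p *ₚ q) *ₚ r) ≈ₚ (p *ₚ (q *ₚ r))
    *-assocₚ []      q r = reflₚ
    *-assocₚ (x ∷ p) q r = transₚ
      (*-distribʳₚ r (x ·ₚ q) (0# ∷ (p *ₚ q)))
      (+-congₚ (·-*-assoc x q r)
        (transₚ (+-congₚ (·-zeroˡ r refl) reflₚ) (∷-cong refl (*-assocₚ p q r))))

    *-identityˡₚ : ∀ p → (constant 1# *ₚ p) ≈ₚ p
    *-identityˡₚ p = transₚ (+-congₚ (coeffwise λ n → trans (coeff-· 1# p n) (*-identityˡ _))
      (∷-zero refl reflₚ)) (+-identityʳₚ p)

    *-distribˡₚ : ∀ r p q → (r *ₚ (p +ₚ q)) ≈ₚ ((r *ₚ p) +ₚ (r *ₚ q))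
    *-distribˡₚ r p q = transₚ (*-commₚ r (p +ₚ q))
      (transₚ (*-distribʳₚ r p q) (+-congₚ (*-commₚ p r) (*-commₚ q r)))

  polynomialRing : CommutativeRing c ℓ
  polynomialRing = record
    { Carrier = Poly
    ; _≈_ = _≈ₚ_
    ; _+_ = _+ₚ_
    ; _*_ = _*ₚ_
    ; -_  = -ₚ_
    ; 0#  = []
    ; 1#  = constant 1#
    ; isCommutativeRing = record
      { isRing = record
        { +-isAbelianGroup = record
          { isGroup = record
            { isMonoid = record
              { isSemigroup = record
                { isMagma = record
                  { isEquivalence = record { refl = reflₚ ; sym = symₚ ; trans = transₚ }
                  ; ∙-cong = +-congₚ
                  }
                ; assoc = +-assocₚ
                }
              ; identity = (λ p → reflₚ) , +-identityʳₚ
              }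
            ; inverse = +-inverseˡₚ , +-inverseʳₚ
            ; ⁻¹-cong = neg-congₚ
            }
          ; comm = +-commₚ
          }
        ; *-cong = *-congₚ
        ; *-assoc = *-assocₚ
        ; *-identity = *-identityˡₚ , (λ p → transₚ (*-commₚ p (constant 1#)) (*-identityˡₚ p))
        ; distrib = *-distribˡₚ , *-distribʳₚ
        }
      ; *-comm = *-commₚ
      }
    }

  module _ (_≟0 : ∀ x → Dec (x ≈ 0#)) (domain : RingNotions.IsDomain R) where
    -- The lowest nonzero coefficients of the factors multiply to a nonzero one.
    private
      shift : ∀ p q {x} → x ≈ 0# → ((x ∷ p) *ₚ q) ≈ₚ [] → (p *ₚ q) ≈ₚ []
      shift p q x≈0 e = tail-zero
        (transₚ (symₚ (+-congₚ (·-zeroˡ q x≈0) (reflₚ {0# ∷ (p *ₚ q)}))) e)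

      zero-product : ∀ p q → (p *ₚ q) ≈ₚ [] → p ≈ₚ [] ⊎ q ≈ₚ []
      zero-product []      q e = inj₁ reflₚ
      zero-product (x ∷ p) q e = inner q e
        where
        inner : ∀ q → ((x ∷ p) *ₚ q) ≈ₚ [] → (x ∷ p) ≈ₚ [] ⊎ q ≈ₚ []
        inner []      e = inj₂ reflₚ
        inner (y ∷ q) e = cases (x ≟0) (y ≟0)
          where
          cases : Dec (x ≈ 0#) → Dec (y ≈ 0#) → (x ∷ p) ≈ₚ [] ⊎ (y ∷ q) ≈ₚ []
          cases (yes x≈0) _ with zero-product p (y ∷ q) (shift p (y ∷ q) x≈0 e)
          ... | inj₁ p≈0 = inj₁ (∷-zero x≈0 p≈0)
          ... | inj₂ q≈0 = inj₂ q≈0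
          cases (no _) (yes y≈0) with inner q (transₚ (*-commₚ (x ∷ p) q)
            (shift q (x ∷ p) y≈0 (transₚ (*-commₚ (y ∷ q) (x ∷ p)) e)))
          ... | inj₁ p≈0 = inj₁ p≈0
          ... | inj₂ q≈0 = inj₂ (∷-zero y≈0 q≈0)
          cases (no x≉0) (no y≉0)
            with proj₂ domain x y (trans (sym (+-identityʳ (x * y))) (at e zero))
          ... | inj₁ x≈0 = ⊥-elim (x≉0 x≈0)
          ... | inj₂ y≈0 = ⊥-elim (y≉0 y≈0)

    polynomialRing-isDomain : RingNotions.IsDomain polynomialRing
    polynomialRing-isDomain = (λ e → proj₁ domain (at e zero)) , zero-product

module Fractions (R : CommutativeRing c ℓ) (domain : RingNotions.IsDomain R) where
  open CommutativeRing R hiding (zero)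
  open SemiringSolver commutativeSemiring using (solve; _:=_; _:+_; _:*_)
  open RingProperties ring using (-‿distribˡ-*)
  open AbelianGroupProperties +-abelianGroup using (x∙y⁻¹≈ε⇒x≈y; x≈y⇒x∙y⁻¹≈ε)
  open CommutativeSemigroupProperties *-commutativeSemigroup using (xy∙z≈xz∙y) renaming (interchange to *-interchange)
  open SetoidReasoning setoid

  infix 9 _/_[_]
  record Fraction : Set (c ⊔ ℓ) where
    constructor _/_[_]
    field
      num      : Carrier
      den      : Carrier
      den≉0    : den ≉ 0#

  open Fraction public

  infix 4 _≈ᶠ_
  record _≈ᶠ_ (x y : Fraction) : Set ℓ where
    constructor cross
    field crossed : num x * den y ≈ num y * den x

  open _≈ᶠ_ public

  private
    product≉0 : ∀ {x y} → x ≉ 0# → y ≉ 0# → x * y ≉ 0#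
    product≉0 x≉0 y≉0 e with proj₂ domain _ _ e
    ... | inj₁ x≈0 = x≉0 x≈0
    ... | inj₂ y≈0 = y≉0 y≈0

    cancelʳ : ∀ x y z → z ≉ 0# → x * z ≈ y * z → x ≈ y
    cancelʳ x y z z≉0 e with proj₂ domain (x - y) z
      (trans (distribʳ z x (- y)) (trans (+-congˡ (sym (-‿distribˡ-* y z))) (x≈y⇒x∙y⁻¹≈ε e)))
    ... | inj₁ x-y≈0 = x∙y⁻¹≈ε⇒x≈y x y x-y≈0
    ... | inj₂ z≈0   = ⊥-elim (z≉0 z≈0)

  infixl 6 _+ᶠ_
  infixl 7 _*ᶠ_

  _+ᶠ_ _*ᶠ_ : Fraction → Fraction → Fraction
  (a / b [ b≉0 ]) +ᶠ (c / d [ d≉0 ]) = (a * d + c * b) / (b * d) [ product≉0 b≉0 d≉0 ]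
  (a / b [ b≉0 ]) *ᶠ (c / d [ d≉0 ]) = (a * c) / (b * d) [ product≉0 b≉0 d≉0 ]

  -ᶠ_ : Fraction → Fraction
  -ᶠ (a / b [ b≉0 ]) = (- a) / b [ b≉0 ]

  fraction : Carrier → Fraction
  fraction a = a / 1# [ proj₁ domain ]

  private
    transᶠ : ∀ {x y z} → x ≈ᶠ y → y ≈ᶠ z → x ≈ᶠ z
    transᶠ {a / b [ _ ]} {c / d [ d≉0 ]} {e / f [ _ ]} (cross p) (cross q) =
      cross (cancelʳ (a * f) (e * b) d d≉0 (begin
        (a * f) * d  ≈⟨ xy∙z≈xz∙y a f d ⟩
        (a * d) * f  ≈⟨ *-congʳ p ⟩
        (c * b) * f  ≈⟨ xy∙z≈xz∙y c b f ⟩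
        (c * f) * b  ≈⟨ *-congʳ q ⟩
        (e * d) * b  ≈⟨ xy∙z≈xz∙y e d b ⟩
        (e * b) * d  ∎))

    +-congᶠ : ∀ {x y u v} → x ≈ᶠ y → u ≈ᶠ v → (x +ᶠ u) ≈ᶠ (y +ᶠ v)
    +-congᶠ {a / b [ _ ]} {a′ / b′ [ _ ]} {c / d [ _ ]} {c′ / d′ [ _ ]} (cross p) (cross q) =
      cross (begin
        (a * d + c * b) * (b′ * d′)
          ≈⟨ solve 6 (λ a b c d b′ d′ → (((a :* d) :+ (c :* b)) :* (b′ :* d′))
               := (((a :* b′) :* (d :* d′)) :+ ((c :* d′) :* (b :* b′)))) refl a b c d b′ d′ ⟩
        (a * b′) * (d * d′) + (c * d′) * (b * b′)
          ≈⟨ +-cong (*-congʳ p) (*-congʳ q) ⟩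
        (a′ * b) * (d * d′) + (c′ * d) * (b * b′)
          ≈⟨ solve 6 (λ a′ b′ c′ d′ b d → (((a′ :* b) :* (d :* d′)) :+ ((c′ :* d) :* (b :* b′)))
               := (((a′ :* d′) :+ (c′ :* b′)) :* (b :* d))) refl a′ b′ c′ d′ b d ⟩
        (a′ * d′ + c′ * b′) * (b * d) ∎)

    *-congᶠ : ∀ {x y u v} → x ≈ᶠ y → u ≈ᶠ v → (x *ᶠ u) ≈ᶠ (y *ᶠ v)
    *-congᶠ {a / b [ _ ]} {a′ / b′ [ _ ]} {c / d [ _ ]} {c′ / d′ [ _ ]} (cross p) (cross q) =
      cross (begin
        (a * c) * (b′ * d′)
          ≈⟨ *-interchange a c b′ d′ ⟩
        (a * b′) * (c * d′)
          ≈⟨ *-cong p q ⟩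
        (a′ * b) * (c′ * d)
          ≈⟨ *-interchange a′ b c′ d ⟩
        (a′ * c′) * (b * d) ∎)

    neg-congᶠ : ∀ {x y} → x ≈ᶠ y → (-ᶠ x) ≈ᶠ (-ᶠ y)
    neg-congᶠ {a / b [ _ ]} {a′ / b′ [ _ ]} (cross p) = cross
      (trans (sym (-‿distribˡ-* a b′)) (trans (-‿cong p) (-‿distribˡ-* a′ b)))

    +-assocᶠ : ∀ x y z → ((x +ᶠ y) +ᶠ z) ≈ᶠ (x +ᶠ (y +ᶠ z))
    +-assocᶠ (a / b [ _ ]) (c / d [ _ ]) (e / f [ _ ]) = cross
      (solve 6 (λ a b c d e f →
        (((((a :* d) :+ (c :* b)) :* f) :+ (e :* (b :* d))) :* (b :* (d :* f)))
        := (((a :* (d :* f)) :+ (((c :* f) :+ (e :* d)) :* b)) :* ((b :* d) :* f))) refl a b c d e f)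

    +-commᶠ : ∀ x y → (x +ᶠ y) ≈ᶠ (y +ᶠ x)
    +-commᶠ (a / b [ _ ]) (c / d [ _ ]) = cross
      (*-cong (+-comm (a * d) (c * b)) (*-comm d b))

    +-identityˡᶠ : ∀ x → (fraction 0# +ᶠ x) ≈ᶠ x
    +-identityˡᶠ (a / b [ _ ]) = cross
      (*-cong (trans (+-cong (zeroˡ b) (*-identityʳ a)) (+-identityˡ a)) (sym (*-identityˡ b)))

    +-inverseˡᶠ : ∀ x → ((-ᶠ x) +ᶠ x) ≈ᶠ fraction 0#
    +-inverseˡᶠ (a / b [ _ ]) = cross (begin
      ((- a) * b + a * b) * 1#  ≈⟨ *-identityʳ _ ⟩
      (- a) * b + a * b         ≈⟨ distribʳ b (- a) a ⟨
      ((- a) + a) * b           ≈⟨ *-congʳ (-‿inverseˡ a) ⟩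
      0# * b                    ≈⟨ zeroˡ b ⟩
      0#                        ≈⟨ zeroˡ (b * b) ⟨
      0# * (b * b)              ∎)

    *-assocᶠ : ∀ x y z → ((x *ᶠ y) *ᶠ z) ≈ᶠ (x *ᶠ (y *ᶠ z))
    *-assocᶠ (a / b [ _ ]) (c / d [ _ ]) (e / f [ _ ]) = cross
      (*-cong (*-assoc a c e) (sym (*-assoc b d f)))

    *-commᶠ : ∀ x y → (x *ᶠ y) ≈ᶠ (y *ᶠ x)
    *-commᶠ (a / b [ _ ]) (c / d [ _ ]) = cross (*-cong (*-comm a c) (*-comm d b))

    *-identityˡᶠ : ∀ x → (fraction 1# *ᶠ x) ≈ᶠ x
    *-identityˡᶠ (a / b [ _ ]) = cross (*-cong (*-identityˡ a) (sym (*-identityˡ b)))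

    *-distribʳᶠ : ∀ z x y → ((x +ᶠ y) *ᶠ z) ≈ᶠ ((x *ᶠ z) +ᶠ (y *ᶠ z))
    *-distribʳᶠ (e / f [ _ ]) (a / b [ _ ]) (c / d [ _ ]) = cross
      (solve 6 (λ a b c d e f →
        ((((a :* d) :+ (c :* b)) :* e) :* ((b :* f) :* (d :* f)))
        := ((((a :* e) :* (d :* f)) :+ ((c :* e) :* (b :* f))) :* ((b :* d) :* f))) refl a b c d e f)

  fractionField : CommutativeRing (c ⊔ ℓ) ℓ
  fractionField = record
    { Carrier = Fraction
    ; _≈_ = _≈ᶠ_
    ; _+_ = _+ᶠ_
    ; _*_ = _*ᶠ_
    ; -_  = -ᶠ_
    ; 0#  = fraction 0#
    ; 1#  = fraction 1#
    ; isCommutativeRing = record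
      { isRing = record
        { +-isAbelianGroup = record
          { isGroup = record
            { isMonoid = record
              { isSemigroup = record
                { isMagma = record
                  { isEquivalence = record
                    { refl = cross refl
                    ; sym = λ e → cross (sym (crossed e))
                    ; trans = transᶠ
                    }
                  ; ∙-cong = +-congᶠ
                  }
                ; assoc = +-assocᶠ
                }
              ; identity = +-identityˡᶠ , (λ x → transᶠ (+-commᶠ x (fraction 0#)) (+-identityˡᶠ x))
              }
            ; inverse = +-inverseˡᶠ , (λ x → transᶠ (+-commᶠ x (-ᶠ x)) (+-inverseˡᶠ x))
            ; ⁻¹-cong = neg-congᶠ
            }
          ; comm = +-commᶠ
          }
        ; *-cong = *-congᶠ
        ; *-assoc = *-assocᶠ
        ; *-identity = *-identityˡᶠ , (λ x → transᶠ (*-commᶠ x (fraction 1#)) (*-identityˡᶠ x))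
        ; distrib =
            (λ z x y → transᶠ (*-commᶠ z (x +ᶠ y)) (transᶠ (*-distribʳᶠ z x y)
              (+-congᶠ (*-commᶠ x z) (*-commᶠ y z))))
          , *-distribʳᶠ
        }
      ; *-comm = *-commᶠ
      }
    }

  open RingMorphisms rawRing (CommutativeRing.rawRing fractionField) using (IsRingHomomorphism)

  fraction-isRingHomomorphism : IsRingHomomorphism fraction
  fraction-isRingHomomorphism = record
    { isSemiringHomomorphism = record
      { isNearSemiringHomomorphism = record
        { +-isMonoidHomomorphism = record
          { isMagmaHomomorphism = record
            { isRelHomomorphism = record { cong = λ e → cross (*-congʳ e) }
            ; homo = λ x y → cross
                (*-cong (sym (+-cong (*-identityʳ x) (*-identityʳ y))) (*-identityˡ 1#))
            }
          ; ε-homo = cross refl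
          }
        ; *-homo = λ x y → cross (*-congˡ (*-identityˡ 1#))
        }
      ; 1#-homo = cross refl
      }
    ; -‿homo = λ x → cross refl
    }

module IntegralClosure
  (A K : CommutativeRing 0ℓ 0ℓ)
  (φ : CommutativeRing.Carrier A → CommutativeRing.Carrier K)
  (φ-hom : RingMorphisms.IsRingHomomorphism
             (CommutativeRing.rawRing A) (CommutativeRing.rawRing K) φ)
  where

  private module A = CommutativeRing A
  open CommutativeRing K hiding (zero)
  open Exponentiation semiring using (_^_; ^-congˡ)
  open Summation semiring using (sum; sum-cong-≋; ∑-distrib-+; *-distribˡ-sum)
  open RingProperties ring using (-1*x≈-x; -‿distribˡ-*; -‿distribʳ-*; -0#≈0#)
  open CommutativeSemigroupProperties *-commutativeSemigroup using (x∙yz≈y∙xz; xy∙z≈xz∙y)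
  open CommutativeSemigroupProperties +-commutativeSemigroup
    using () renaming (interchange to +-interchange)
  open SemiringSolver commutativeSemiring using (solve; _:=_; _:+_; _:*_)
  open SetoidReasoning setoid
  module φ = RingMorphisms.IsRingHomomorphism φ-hom

  IsIntegral : Carrier → Set
  IsIntegral x =
    ∃[ n ] Σ (Fin n → A.Carrier) λ c → x ^ n + sum (λ i → φ (c i) * x ^ toℕ i) ≈ 0#

  -- Sums and products of integral elements are integral because they act on
  -- a finitely generated A-module containing 1; a monic equation for an
  -- element acting on such a module is found by division-free elimination.
  private
    Σ-cong : ∀ {n} (f g : Fin n → Carrier) → (∀ i → f i ≈ g i) → sum f ≈ sum g
    Σ-cong {n} f g e = sum-cong-≋ {n} {f} {g} e

    Σ-scale : ∀ {n} x (f : Fin n → Carrier) → x * sum f ≈ sum (λ i → x * f i)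
    Σ-scale {n} x f = *-distribˡ-sum {n} x f

    Σ-+ : ∀ {n} (f g : Fin n → Carrier) → sum (λ i → f i + g i) ≈ sum f + sum g
    Σ-+ {n} f g = ∑-distrib-+ {n} f g

    solve-for : ∀ {x y} → x + y ≈ 0# → x ≈ - y
    solve-for {x} {y} e = begin
      x              ≈⟨ +-identityʳ x ⟨
      x + 0#         ≈⟨ +-congˡ (-‿inverseʳ y) ⟨
      x + (y - y)    ≈⟨ +-assoc x y (- y) ⟨
      (x + y) - y    ≈⟨ +-congʳ e ⟩
      0# - y         ≈⟨ +-identityˡ (- y) ⟩
      - y            ∎

    record IsSubmodule (C : Pred Carrier 0ℓ) : Set where
      field
        resp  : ∀ {x y} → x ≈ y → C x → C y
        null  : C 0#
        add   : ∀ {x y} → C x → C y → C (x + y)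
        scale : ∀ r {x} → C x → C (φ r * x)

      neg : ∀ {x} → C x → C (- x)
      neg {x} m = resp
        (trans (*-congʳ (trans (φ.-‿homo A.1#) (-‿cong φ.1#-homo))) (-1*x≈-x x))
        (scale (A.- A.1#) m)

    Scalar : Pred Carrier 0ℓ
    Scalar x = ∃[ r ] φ r ≈ x

    scalar-submodule : IsSubmodule Scalar
    scalar-submodule = record
      { resp  = λ e (r , f) → r , trans f e
      ; null  = A.0# , φ.0#-homo
      ; add   = λ (r , e) (s , f) → r A.+ s , trans (φ.+-homo r s) (+-cong e f)
      ; scale = λ r (s , e) → r A.* s , trans (φ.*-homo r s) (*-congˡ e)
      }

    -- Polynomial expressions in x of degree less than n, coefficients in C.
    data Below (C : Pred Carrier 0ℓ) (x : Carrier) : ℕ → Carrier → Set where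
      nil  : ∀ {y} → y ≈ 0# → Below C x zero y
      cons : ∀ {n y} a {z} → C a → Below C x n z → y ≈ a + x * z → Below C x (suc n) y

    module Belows {C : Pred Carrier 0ℓ} (C-sub : IsSubmodule C) (x : Carrier) where
      open IsSubmodule C-sub

      resp-b : ∀ {n y z} → y ≈ z → Below C x n y → Below C x n z
      resp-b e (nil f)        = nil (trans (sym e) f)
      resp-b e (cons a m b f) = cons a m b (trans (sym e) f)

      null-b : ∀ n → Below C x n 0#
      null-b zero    = nil refl
      null-b (suc n) = cons 0# null (null-b n) (sym (trans (+-identityˡ _) (zeroʳ x)))

      add-b : ∀ {n y z} → Below C x n y → Below C x n z → Below C x n (y + z)
      add-b (nil e) (nil f) = nil (trans (+-cong e f) (+-identityˡ 0#))
      add-b (cons a m b e) (cons a′ m′ b′ f) = cons (a + a′) (add m m′) (add-b b b′)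
        (trans (+-cong e f) (trans (+-interchange _ _ _ _) (+-congˡ (sym (distribˡ x _ _)))))

      shift-b : ∀ {n y} → Below C x n y → Below C x (suc n) (x * y)
      shift-b b = cons 0# null b (sym (+-identityˡ _))

      const-b : ∀ {n a} → C a → Below C x (suc n) a
      const-b {n} m = cons _ m (null-b n) (sym (trans (+-congˡ (zeroʳ x)) (+-identityʳ _)))

      weaken : ∀ {n y} → Below C x n y → Below C x (suc n) y
      weaken (nil e)        = resp-b (sym e) (null-b 1)
      weaken (cons a m b e) = cons a m (weaken b) e

      weakenˡ : ∀ k {n y} → Below C x n y → Below C x (k ℕ.+ n) y
      weakenˡ zero    b = b
      weakenˡ (suc k) b = weaken (weakenˡ k b)

      power-b : ∀ k {n y} → Below C x n y → Below C x (k ℕ.+ n) (x ^ k * y)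
      power-b zero    b = resp-b (sym (*-identityˡ _)) b
      power-b (suc k) b = resp-b (sym (*-assoc x (x ^ k) _)) (shift-b (power-b k b))

      split-top : ∀ {n y} → Below C x (suc n) y →
                  ∃[ h ] ∃[ t ] Below C x n h × C t × y ≈ h + t * x ^ n
      split-top (cons a m (nil e) f) = 0# , a , nil refl , m , (begin
        _            ≈⟨ f ⟩
        a + x * _    ≈⟨ +-congˡ (trans (*-congˡ e) (zeroʳ x)) ⟩
        a + 0#       ≈⟨ +-comm a 0# ⟩
        0# + a       ≈⟨ +-congˡ (*-identityʳ a) ⟨
        0# + a * 1#  ∎)
      split-top {suc n} (cons a m b@(cons _ _ _ _) f) with split-top b
      ... | h , t , hb , tm , g = a + x * h , t , cons a m hb refl , tm , (begin
        _                          ≈⟨ f ⟩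
        a + x * _                  ≈⟨ +-congˡ (*-congˡ g) ⟩
        a + x * (h + t * x ^ n)
          ≈⟨ solve 5 (λ a x h t p → (a :+ x :* (h :+ t :* p)) := ((a :+ x :* h) :+ t :* (x :* p)))
               refl a x h t (x ^ n) ⟩
        (a + x * h) + t * (x * x ^ n) ∎)

    module _ {C D : Pred Carrier 0ℓ} (x w : Carrier) (w-maps : ∀ {y} → C y → D (w * y)) where
      map-b : ∀ {n y} → Below C x n y → Below D x n (w * y)
      map-b (nil e)        = nil (trans (*-congˡ e) (zeroʳ w))
      map-b (cons a m b e) = cons (w * a) (w-maps m) (map-b b)
        (trans (*-congˡ e) (trans (distribˡ w a _) (+-congˡ (x∙yz≈y∙xz w x _))))

    below-submodule : ∀ {C} → IsSubmodule C → ∀ x n → IsSubmodule (Below C x n)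
    below-submodule C-sub x n = record
      { resp  = resp-b
      ; null  = null-b n
      ; add   = add-b
      ; scale = λ r → map-b x (φ r) (IsSubmodule.scale C-sub r)
      }
      where open Belows C-sub x

    sum-below : ∀ x {n} (c : Fin n → A.Carrier) →
                Below Scalar x n (sum (λ i → φ (c i) * x ^ toℕ i))
    sum-below x {zero}  c = nil refl
    sum-below x {suc n} c = cons (φ (c zero)) (c zero , refl) (sum-below x (c ∘ suc))
      (+-cong (*-identityʳ _) (sym (trans
        (Σ-scale x (λ i → φ (c (suc i)) * x ^ toℕ i))
        (Σ-cong _ (λ i → φ (c (suc i)) * x ^ toℕ (suc i))
          (λ i → x∙yz≈y∙xz x (φ (c (suc i))) (x ^ toℕ i))))))

    below-sum : ∀ {x n y} → Below Scalar x n y →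
                Σ (Fin n → A.Carrier) λ c → y ≈ sum (λ i → φ (c i) * x ^ toℕ i)
    below-sum (nil e) = (λ ()) , e
    below-sum {x} {suc n} (cons a (r , e) b f) with below-sum b
    ... | c , g = c′ , trans f (+-cong (trans (sym e) (sym (*-identityʳ _)))
        (trans (*-congˡ g) (trans (Σ-scale x (λ i → φ (c i) * x ^ toℕ i))
          (Σ-cong _ (λ i → φ (c i) * x ^ suc (toℕ i)) (λ i → x∙yz≈y∙xz x (φ (c i)) (x ^ toℕ i))))))
      where
      c′ : Fin (suc n) → A.Carrier
      c′ zero    = r
      c′ (suc i) = c i

    data Span : List Carrier → Carrier → Set where
      nil  : ∀ {y} → y ≈ 0# → Span [] y
      cons : ∀ {m ms y} r {z} → Span ms z → y ≈ φ r * m + z → Span (m ∷ ms) y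

    span-resp : ∀ {ms y z} → y ≈ z → Span ms y → Span ms z
    span-resp e (nil f)      = nil (trans (sym e) f)
    span-resp e (cons r s f) = cons r s (trans (sym e) f)

    span-++ : ∀ {ms ns y z} → Span ms y → Span ns z → Span (ms ++ ns) (y + z)
    span-++ (nil e) t = span-resp (sym (trans (+-congʳ e) (+-identityˡ _))) t
    span-++ (cons r s f) t = cons r (span-++ s t) (trans (+-congʳ f) (+-assoc _ _ _))

    span-map : ∀ w {ms y} → Span ms y → Span (List.map (w *_) ms) (w * y)
    span-map w (nil e)      = nil (trans (*-congˡ e) (zeroʳ w))
    span-map w (cons r s f) = cons r (span-map w s)
      (trans (*-congˡ f) (trans (distribˡ w _ _) (+-congʳ (x∙yz≈y∙xz w (φ r) _))))

    span-sum : ∀ {ms y} → Span ms y →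
               Σ (Fin (List.length ms) → A.Carrier) λ c → y ≈ sum (λ i → φ (c i) * List.lookup ms i)
    span-sum (nil e) = (λ ()) , e
    span-sum {m ∷ ms} (cons r s f) with span-sum s
    ... | c , g = c′ , trans f (+-congˡ g)
      where
      c′ : Fin (suc (List.length ms)) → A.Carrier
      c′ zero    = r
      c′ (suc i) = c i

    record IsFinitelyGenerated (C : Pred Carrier 0ℓ) : Set where
      field
        gens : List Carrier
        spans : ∀ {y} → C y → Span gens y
        gens∈ : All C gens

    scalar-fg : IsFinitelyGenerated Scalar
    scalar-fg = record
      { gens  = 1# ∷ []
      ; spans = λ (r , e) → cons r (nil refl)
          (trans (sym e) (trans (sym (*-identityʳ _)) (sym (+-identityʳ _))))
      ; gens∈ = (A.1# , φ.1#-homo) ∷ []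
      }

    below-fg : ∀ {C} → IsSubmodule C → IsFinitelyGenerated C → ∀ x n →
               IsFinitelyGenerated (Below C x n)
    below-fg C-sub fg x zero = record
      { gens = [] ; spans = λ where (nil e) → nil e
      ; gens∈ = [] }
    below-fg C-sub fg x (suc n) = record
      { gens  = G.gens ++ List.map (x *_) H.gens
      ; spans = λ where
          (cons a m b e) → span-resp (sym e) (span-++ (G.spans m) (span-map x (H.spans b)))
      ; gens∈ = ++⁺ (All.map const-b G.gens∈) (map⁺ (All.map shift-b H.gens∈))
      }
      where
      open Belows C-sub x
      module G = IsFinitelyGenerated fg
      module H = IsFinitelyGenerated (below-fg C-sub fg x n)

    Monic : Carrier → ℕ → Carrier → Set
    Monic z d p = ∃[ u ] Below Scalar z d u × p ≈ z ^ d + u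

    module Elimination (z : Carrier) where
      open Belows scalar-submodule z
      private
        neg-b : ∀ {d y} → Below Scalar z d y → Below Scalar z d (- y)
        neg-b {d} = IsSubmodule.neg (below-submodule scalar-submodule z d)

      *-below : ∀ {d e y w} → Below Scalar z d y → Below Scalar z e w →
                Below Scalar z (d ℕ.+ e) (y * w)
      *-below {e = e} (nil f) c = resp-b (sym (trans (*-congʳ f) (zeroˡ _))) (null-b e)
      *-below {suc d} {e} {y} {w} (cons a {y′} (r , g) b f) c = resp-b
        (begin
          a * w + z * (y′ * w)   ≈⟨ +-congˡ (*-assoc z y′ w) ⟨
          a * w + (z * y′) * w   ≈⟨ distribʳ w a (z * y′) ⟨
          (a + z * y′) * w       ≈⟨ *-congʳ f ⟨
          y * w                  ∎)
        (add-b
          (weakenˡ (suc d) (resp-b (*-congʳ g) (IsSubmodule.scale (below-submodule scalar-submodule z e) r c)))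
          (shift-b (*-below b c)))

      monic-*-below : ∀ {d e p w} → Monic z d p → Below Scalar z e w →
                      Below Scalar z (d ℕ.+ e) (p * w)
      monic-*-below {d} (u , b , f) c = resp-b
        (trans (sym (distribʳ _ (z ^ d) u)) (*-congʳ (sym f)))
        (add-b (power-b d c) (*-below b c))

      monic-resp : ∀ {d p q} → p ≈ q → Monic z d p → Monic z d q
      monic-resp e (u , b , f) = u , b , trans (sym e) f

      monic-+ : ∀ {d p w} → Monic z d p → Below Scalar z d w → Monic z d (p + w)
      monic-+ (u , b , f) c = u + _ , add-b b c , trans (+-congʳ f) (+-assoc _ u _)

      ^-+ : ∀ d e → z ^ (d ℕ.+ e) ≈ z ^ d * z ^ e
      ^-+ zero    e = sym (*-identityˡ _)
      ^-+ (suc d) e = trans (*-congˡ (^-+ d e)) (sym (*-assoc z _ _))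

      *-monic : ∀ {d e p q} → Monic z d p → Monic z e q → Monic z (d ℕ.+ e) (p * q)
      *-monic {d} {e} {p} {q} (u , b , f) (v , c , g) =
        z ^ d * v + (z ^ e * u + u * v)
        , add-b (power-b d c)
            (add-b (≡.subst (λ k → Below Scalar z k (z ^ e * u)) (ℕ.+-comm e d) (power-b e b)) (*-below b c))
        , (begin
          p * q                      ≈⟨ *-cong f g ⟩
          (z ^ d + u) * (z ^ e + v)
            ≈⟨ solve 4 (λ s u t v → ((s :+ u) :* (t :+ v))
                 := (s :* t :+ (s :* v :+ (t :* u :+ u :* v)))) refl (z ^ d) u (z ^ e) v ⟩
          z ^ d * z ^ e + (z ^ d * v + (z ^ e * u + u * v))  ≈⟨ +-congʳ (^-+ d e) ⟨
          z ^ (d ℕ.+ e) + (z ^ d * v + (z ^ e * u + u * v))  ∎)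

      sum-scaled : ∀ {r} q (f : Fin r → Carrier) (m : Fin r → Carrier) →
                   sum (λ j → (q * f j) * m j) ≈ q * sum (λ j → f j * m j)
      sum-scaled q f m = sym (trans (Σ-scale q (λ j → f j * m j))
        (Σ-cong _ (λ j → (q * f j) * m j) (λ j → sym (*-assoc q (f j) (m j)))))

      sum-zero : ∀ {r} (f : Fin r → Carrier) → (∀ j → f j ≈ 0#) → sum f ≈ 0#
      sum-zero {zero}  f e = refl
      sum-zero {suc r} f e = trans (+-cong (e zero) (sum-zero (f ∘ suc) (e ∘ suc))) (+-identityˡ 0#)

      eliminate : ∀ r d (B : Fin r → Fin r → Carrier) (m : Fin r → Carrier) →
                  (∀ i → Monic z d (B i i)) →
                  (∀ i j → i ≢ j → Below Scalar z d (B i j)) →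
                  (∀ i → sum (λ j → B i j * m j) ≈ 0#) →
                  ∃[ e ] ∃[ P ] Monic z e P × (∀ i → P * m i ≈ 0#)
      eliminate zero    d B m diag off eqs = 0 , 1# , (0# , nil refl , sym (+-identityʳ 1#)) , λ ()
      eliminate (suc r) d B m diag off eqs
        with eliminate r (d ℕ.+ d) B′ (m ∘ suc)
          (λ i → monic-+ (*-monic (diag zero) (diag (suc i)))
                   (neg-b (*-below (off (suc i) zero λ ()) (off zero (suc i) λ ()))))
          (λ i j i≢j → add-b
            (monic-*-below (diag zero) (off (suc i) (suc j) (i≢j ∘ Fin.suc-injective)))
            (neg-b (*-below (off (suc i) zero λ ()) (off zero (suc j) λ ()))))
          eqs′
        where
        B′ : Fin r → Fin r → Carrier
        B′ i j = B zero zero * B (suc i) (suc j) - B (suc i) zero * B zero (suc j)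

        S : Fin (suc r) → Carrier
        S i = sum (λ j → B i (suc j) * m (suc j))

        eqs′ : ∀ i → sum (λ j → B′ i j * m (suc j)) ≈ 0#
        eqs′ i = begin
          sum (λ j → B′ i j * m (suc j))
            ≈⟨ Σ-cong (λ j → B′ i j * m (suc j)) _ (λ j → distribʳ (m (suc j)) _ _) ⟩
          sum (λ j → (B₀₀ * B (suc i) (suc j)) * m (suc j)
                   + (- (Bᵢ₀ * B zero (suc j))) * m (suc j))
            ≈⟨ Σ-+ (λ j → (B₀₀ * B (suc i) (suc j)) * m (suc j))
                   (λ j → (- (Bᵢ₀ * B zero (suc j))) * m (suc j)) ⟩
          sum (λ j → (B₀₀ * B (suc i) (suc j)) * m (suc j))
            + sum (λ j → (- (Bᵢ₀ * B zero (suc j))) * m (suc j))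
            ≈⟨ +-cong (sum-scaled B₀₀ (B (suc i) ∘ suc) (m ∘ suc))
                 (trans (Σ-cong (λ j → (- (Bᵢ₀ * B zero (suc j))) * m (suc j)) _
                          (λ j → *-congʳ (-‿distribˡ-* Bᵢ₀ (B zero (suc j)))))
                   (sum-scaled (- Bᵢ₀) (B zero ∘ suc) (m ∘ suc))) ⟩
          B₀₀ * S (suc i) + (- Bᵢ₀) * S zero
            ≈⟨ +-congʳ (*-congˡ (solve-for (trans (+-comm _ _) (eqs (suc i))))) ⟩
          B₀₀ * (- (Bᵢ₀ * m zero)) + (- Bᵢ₀) * S zero
            ≈⟨ +-congˡ (*-congˡ (solve-for (trans (+-comm _ _) (eqs zero)))) ⟩
          B₀₀ * (- (Bᵢ₀ * m zero)) + (- Bᵢ₀) * (- (B₀₀ * m zero))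
            ≈⟨ +-cong (trans (sym (-‿distribʳ-* B₀₀ _)) (-‿cong (x∙yz≈y∙xz B₀₀ Bᵢ₀ (m zero))))
                 (sym (-‿distribˡ-* Bᵢ₀ _)) ⟩
          (- (Bᵢ₀ * (B₀₀ * m zero))) + (- (Bᵢ₀ * (- (B₀₀ * m zero))))
            ≈⟨ +-congˡ (-‿cong (sym (-‿distribʳ-* Bᵢ₀ _))) ⟩
          (- (Bᵢ₀ * (B₀₀ * m zero))) + (- (- (Bᵢ₀ * (B₀₀ * m zero))))
            ≈⟨ -‿inverseʳ _ ⟩
          0# ∎
          where
          B₀₀ Bᵢ₀ : Carrier
          B₀₀ = B zero zero
          Bᵢ₀ = B (suc i) zero
      ... | e , P , P-monic , kills = e ℕ.+ d , P * B zero zero , *-monic P-monic (diag zero) , killed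
        where
        killed : ∀ i → (P * B zero zero) * m i ≈ 0#
        killed zero = begin
          (P * B zero zero) * m zero   ≈⟨ *-assoc P _ _ ⟩
          P * (B zero zero * m zero)   ≈⟨ *-congˡ (solve-for (eqs zero)) ⟩
          P * (- sum (λ j → B zero (suc j) * m (suc j)))
            ≈⟨ -‿distribʳ-* P _ ⟨
          - (P * sum (λ j → B zero (suc j) * m (suc j)))
            ≈⟨ -‿cong (trans (Σ-scale P (λ j → B zero (suc j) * m (suc j))) (sum-zero (λ j → P * (B zero (suc j) * m (suc j))) (λ j →
                 trans (x∙yz≈y∙xz P (B zero (suc j)) (m (suc j)))
                   (trans (*-congˡ (kills j)) (zeroʳ _))))) ⟩
          - 0#  ≈⟨ -0#≈0# ⟩
          0#    ∎
        killed (suc i) = trans (xy∙z≈xz∙y P _ _) (trans (*-congʳ (kills i)) (zeroˡ _))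

      δ : ∀ {r} → Fin r → Fin r → Carrier
      δ zero    zero    = z
      δ zero    (suc j) = 0#
      δ (suc i) zero    = 0#
      δ (suc i) (suc j) = δ i j

      δ-diag : ∀ {r} (i : Fin r) → δ i i ≈ z
      δ-diag zero    = refl
      δ-diag (suc i) = δ-diag i

      δ-off : ∀ {r} (i j : Fin r) → i ≢ j → δ i j ≈ 0#
      δ-off zero    zero    i≢j = ⊥-elim (i≢j ≡.refl)
      δ-off zero    (suc j) i≢j = refl
      δ-off (suc i) zero    i≢j = refl
      δ-off (suc i) (suc j) i≢j = δ-off i j (i≢j ∘ ≡.cong suc)

      δ-sum : ∀ {r} (i : Fin r) (m : Fin r → Carrier) → sum (λ j → δ i j * m j) ≈ z * m i
      δ-sum zero    m = trans (+-congˡ (sum-zero (λ j → δ zero (suc j) * m (suc j)) (λ j → zeroˡ _))) (+-identityʳ _)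
      δ-sum (suc i) m = trans (+-cong (zeroˡ _) (δ-sum i (m ∘ suc))) (+-identityˡ _)

      annihilator : ∀ {r} (m : Fin r → Carrier) (c : Fin r → Fin r → A.Carrier) →
                    (∀ i → z * m i ≈ sum (λ j → φ (c i j) * m j)) →
                    ∃[ e ] ∃[ P ] Monic z e P × (∀ i → P * m i ≈ 0#)
      annihilator {r} m c act = eliminate r 1 (λ i j → δ i j - φ (c i j)) m
        (λ i → - φ (c i i) , neg-b (const-b (c i i , refl))
             , +-congʳ (trans (δ-diag i) (sym (*-identityʳ z))))
        (λ i j i≢j → add-b (resp-b (sym (δ-off i j i≢j)) (null-b 1))
                       (neg-b (const-b (c i j , refl))))
        (λ i → begin
          sum (λ j → (δ i j - φ (c i j)) * m j)
            ≈⟨ Σ-cong (λ j → (δ i j - φ (c i j)) * m j) _ (λ j → trans (distribʳ (m j) _ _)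
                 (+-congˡ (*-congʳ (sym (-1*x≈-x _))))) ⟩
          sum (λ j → δ i j * m j + (- 1# * φ (c i j)) * m j)
            ≈⟨ Σ-+ (λ j → δ i j * m j) (λ j → (- 1# * φ (c i j)) * m j) ⟩
          sum (λ j → δ i j * m j) + sum (λ j → (- 1# * φ (c i j)) * m j)
            ≈⟨ +-cong (δ-sum i m) (trans (sum-scaled (- 1#) (λ j → φ (c i j)) m) (-1*x≈-x _)) ⟩
          z * m i - sum (λ j → φ (c i j) * m j)
            ≈⟨ +-congʳ (act i) ⟩
          sum (λ j → φ (c i j) * m j) - sum (λ j → φ (c i j) * m j)
            ≈⟨ -‿inverseʳ _ ⟩
          0# ∎)

      monic⇒integral : ∀ {e P} → Monic z e P → P ≈ 0# → IsIntegral z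
      monic⇒integral {e} (u , b , f) P≈0 with below-sum b
      ... | c , g = e , c , trans (+-congˡ (sym g)) (trans (sym f) P≈0)

      acts⇒integral : ∀ {M} → IsFinitelyGenerated M → M 1# →
                      (∀ {y} → M y → M (z * y)) → IsIntegral z
      acts⇒integral {M} fg 1∈M act with annihilator (List.lookup gens)
          (λ i → proj₁ (span-sum (zm i))) (λ i → proj₂ (span-sum (zm i)))
        where
        open IsFinitelyGenerated fg
        zm : ∀ i → Span gens (z * List.lookup gens i)
        zm i = spans (act (All.lookup gens∈ (∈-lookup i)))
      ... | e , P , P-monic , kills with span-sum (spans 1∈M)
        where open IsFinitelyGenerated fg
      ...   | c , f = monic⇒integral P-monic (begin
        P             ≈⟨ *-identityʳ P ⟨
        P * 1#        ≈⟨ *-congˡ f ⟩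
        P * sum (λ i → φ (c i) * List.lookup gens i)
          ≈⟨ Σ-scale P (λ i → φ (c i) * List.lookup gens i) ⟩
        sum (λ i → P * (φ (c i) * List.lookup gens i))
          ≈⟨ sum-zero (λ i → P * (φ (c i) * List.lookup gens i)) (λ i → trans (x∙yz≈y∙xz P (φ (c i)) _)
               (trans (*-congˡ (kills i)) (zeroʳ _))) ⟩
        0# ∎)
        where open IsFinitelyGenerated fg

    -- The module spanned by the monomials x^i y^j with i and j below the
    -- degrees of the equations of x and y.
    module Monomials {x y} (x-int : IsIntegral x) (y-int : IsIntegral y) where
      degx degy : ℕ
      degx = proj₁ x-int
      degy = proj₁ y-int

      N M : Pred Carrier 0ℓ
      N = Below Scalar y degy
      M = Below N x degx

      N-sub : IsSubmodule N
      N-sub = below-submodule scalar-submodule y degy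

      M-sub : IsSubmodule M
      M-sub = below-submodule N-sub x degx

      M-fg : IsFinitelyGenerated M
      M-fg = below-fg N-sub (below-fg scalar-submodule scalar-fg y degy) x degx

      closed : ∀ {C} → IsSubmodule C → ∀ {w} (w-int : IsIntegral w) {v} →
               Below C w (proj₁ w-int) v → Below C w (proj₁ w-int) (w * v)
      closed {C} C-sub {w} (n , c , e) b with Belows.split-top C-sub w (Belows.shift-b C-sub w b)
      ... | h , t , hb , tm , f = resp-b (sym f) (add-b hb (resp-b
          (trans (-‿distribʳ-* t _) (*-congˡ (sym (solve-for e))))
          (IsSubmodule.neg (below-submodule C-sub w n)
            (map-b w t (λ (r , g) → IsSubmodule.resp C-sub (trans (*-comm (φ r) t) (*-congˡ g))
              (IsSubmodule.scale C-sub r tm)) (sum-below w c)))))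
        where open Belows C-sub w

      x-closed : ∀ {v} → M v → M (x * v)
      x-closed = closed N-sub x-int

      y-closed : ∀ {v} → M v → M (y * v)
      y-closed = map-b x y (closed scalar-submodule y-int)

      1∈ : ∀ {C} → IsSubmodule C → C 1# → ∀ {w} (w-int : IsIntegral w) → Below C w (proj₁ w-int) 1#
      1∈ C-sub m (zero  , c , e) = nil (trans (sym (+-identityʳ 1#)) e)
      1∈ C-sub m (suc n , c , e) = Belows.const-b C-sub _ m

      1∈M : M 1#
      1∈M = 1∈ N-sub (1∈ scalar-submodule (A.1# , φ.1#-homo) y-int) x-int

  +-integral : ∀ {x y} → IsIntegral x → IsIntegral y → IsIntegral (x + y)
  +-integral {x} {y} x-int y-int = Elimination.acts⇒integral (x + y) M-fg 1∈M
    λ {v} m → IsSubmodule.resp M-sub (sym (distribʳ v x y))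
      (IsSubmodule.add M-sub (x-closed m) (y-closed m))
    where open Monomials x-int y-int

  *-integral : ∀ {x y} → IsIntegral x → IsIntegral y → IsIntegral (x * y)
  *-integral {x} {y} x-int y-int = Elimination.acts⇒integral (x * y) M-fg 1∈M
    λ {v} m → IsSubmodule.resp M-sub (sym (*-assoc x y v)) (x-closed (y-closed m))
    where open Monomials x-int y-int

  φ-integral : ∀ r → IsIntegral (φ r)
  φ-integral r = 1 , (λ _ → A.- r) , (begin
    φ r * 1# + (φ (A.- r) * 1# + 0#)
      ≈⟨ +-cong (*-identityʳ _) (trans (+-identityʳ _) (*-identityʳ _)) ⟩
    φ r + φ (A.- r)   ≈⟨ +-congˡ (φ.-‿homo r) ⟩
    φ r - φ r         ≈⟨ -‿inverseʳ (φ r) ⟩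
    0# ∎)

  integral-resp : ∀ {x y} → x ≈ y → IsIntegral x → IsIntegral y
  integral-resp x≈y (n , c , e) = n , c , trans
    (+-cong (^-congˡ n (sym x≈y)) (Σ-cong (λ i → φ (c i) * _ ^ toℕ i) (λ i → φ (c i) * _ ^ toℕ i) (λ i → *-congˡ (^-congˡ (toℕ i) (sym x≈y))))) e

  neg-integral : ∀ {x} → IsIntegral x → IsIntegral (- x)
  neg-integral {x} x-int = integral-resp
    (trans (*-congʳ (trans (φ.-‿homo A.1#) (-‿cong φ.1#-homo))) (-1*x≈-x x))
    (*-integral (φ-integral (A.- A.1#)) x-int)

  record Integer : Set where
    constructor _∣integral_
    field
      value    : Carrier
      integral : IsIntegral value

  open Integer public

  infix 4 _≈ᵢ_
  record _≈ᵢ_ (x y : Integer) : Set where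
    constructor same
    field same-value : value x ≈ value y

  open _≈ᵢ_ public

  integralClosure : CommutativeRing 0ℓ 0ℓ
  integralClosure = record
    { Carrier = Integer
    ; _≈_ = _≈ᵢ_
    ; _+_ = λ x y → (value x + value y) ∣integral +-integral (integral x) (integral y)
    ; _*_ = λ x y → (value x * value y) ∣integral *-integral (integral x) (integral y)
    ; -_  = λ x → (- value x) ∣integral neg-integral (integral x)
    ; 0#  = 0# ∣integral integral-resp φ.0#-homo (φ-integral A.0#)
    ; 1#  = 1# ∣integral integral-resp φ.1#-homo (φ-integral A.1#)
    ; isCommutativeRing = record
      { isRing = record
        { +-isAbelianGroup = record
          { isGroup = record
            { isMonoid = record
              { isSemigroup = record
                { isMagma = record
                  { isEquivalence = record
                    { refl = same refl
                    ; sym = λ e → same (sym (same-value e))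
                    ; trans = λ e f → same (trans (same-value e) (same-value f))
                    }
                  ; ∙-cong = λ e f → same (+-cong (same-value e) (same-value f))
                  }
                ; assoc = λ x y z → same (+-assoc (value x) (value y) (value z))
                }
              ; identity = (λ x → same (+-identityˡ (value x))) , (λ x → same (+-identityʳ (value x)))
              }
            ; inverse = (λ x → same (-‿inverseˡ (value x))) , (λ x → same (-‿inverseʳ (value x)))
            ; ⁻¹-cong = λ e → same (-‿cong (same-value e))
            }
          ; comm = λ x y → same (+-comm (value x) (value y))
          }
        ; *-cong = λ e f → same (*-cong (same-value e) (same-value f))
        ; *-assoc = λ x y z → same (*-assoc (value x) (value y) (value z))
        ; *-identity = (λ x → same (*-identityˡ (value x))) , (λ x → same (*-identityʳ (value x)))
        ; distrib = (λ x y z → same (distribˡ (value x) (value y) (value z)))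
                  , (λ x y z → same (distribʳ (value x) (value y) (value z)))
        }
      ; *-comm = λ x y → same (*-comm (value x) (value y))
      }
    }

  fromBase : A.Carrier → Integer
  fromBase r = φ r ∣integral φ-integral r

record FiniteExtension (k : CommutativeRing 0ℓ 0ℓ) : Set₁ where
  private module k = CommutativeRing k
  field
    ring : CommutativeRing 0ℓ 0ℓ

  open CommutativeRing ring hiding (zero; ring) public
  open Summation semiring using (sum)

  field
    isField : RingNotions.IsField ring
    ι       : k.Carrier → Carrier
    ι-hom   : RingMorphisms.IsRingHomomorphism k.rawRing rawRing ι

  IsBasis : ∀ {n} → (Fin n → Carrier) → Set
  IsBasis {n} b =
      (∀ x → Σ (Fin n → k.Carrier) λ c → sum (λ i → ι (c i) * b i) ≈ x)
    × (∀ (c : Fin n → k.Carrier) → sum (λ i → ι (c i) * b i) ≈ 0# → ∀ i → c i k.≈ k.0#)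

  field
    degree  : ℕ
    basis   : Fin degree → Carrier
    isBasis : IsBasis basis

  coordinates : Carrier → Fin degree → k.Carrier
  coordinates x = proj₁ (proj₁ isBasis x)

  -- The trace of the k-linear map y ↦ x y, read off its matrix in the chosen
  -- basis; the value does not depend on the basis.
  trace : Carrier → k.Carrier
  trace x = Summation.sum k.semiring (λ i → coordinates (x * basis i) i)

  discriminant : ∀ {n} → (Fin n → Carrier) → k.Carrier
  discriminant b = RingNotions.det k (λ i j → trace (b i * b j))

module _ {k : CommutativeRing 0ℓ 0ℓ} where
  open FiniteExtension using (Carrier; ι; rawRing)

  infix 4 _≅_
  record _≅_ (K L : FiniteExtension k) : Set where
    field
      to     : Carrier K → Carrier L
      to-iso : RingMorphisms.IsRingIsomorphism (rawRing K) (rawRing L) to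
      to-ι   : ∀ c → FiniteExtension._≈_ L (to (ι K c)) (ι L c)

  module _ (K : FiniteExtension k) where
    open FiniteExtension K using (_≈_)
    open _≅_

    -- The fixed field of Aut(K/k) is k.
    IsGalois : Set
    IsGalois = ∀ x → (∀ (σ : K ≅ K) → to σ x ≈ x) → ∃[ c ] ι K c ≈ x

    -- Aut(K/k) is finite, so the powers of a generator with exponents in ℕ
    -- exhaust the group it generates.
    HasCyclicAutomorphismGroup : Set
    HasCyclicAutomorphismGroup =
      Σ (K ≅ K) λ σ → ∀ (τ : K ≅ K) → ∃[ n ] ∀ x → to τ x ≈ iterate (to σ) x n

    IsCyclicExtension : Set
    IsCyclicExtension = IsGalois × HasCyclicAutomorphismGroup

  -- Counting extensions up to isomorphism over k. For Galois extensions this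
  -- agrees with counting subfields of a fixed algebraic closure.
  InfinitelyMany : ∀ {p} → (FiniteExtension k → Set p) → Set (lsuc 0ℓ ⊔ p)
  InfinitelyMany P = Σ (ℕ → FiniteExtension k) λ K →
    (∀ n → P (K n)) × (∀ m n → m ≢ n → ¬ (K m ≅ K n))

record FiniteField : Set₁ where
  field
    ring        : CommutativeRing 0ℓ 0ℓ
    isField     : RingNotions.IsField ring
    order       : ℕ
    cardinality : RingNotions.HasCardinality ring order

  open CommutativeRing ring using (Carrier; _≈_; 0#; trans; sym; *-congʳ; *-congˡ; *-assoc; *-identityˡ; zeroʳ)
  open Inverse cardinality using (to; from-cong; strictlyInverseʳ; to-cong)

  infix 4 _≟_
  _≟_ : ∀ x y → Dec (x ≈ y)
  x ≟ y with to x Fin.≟ to y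
  ... | yes e = yes (trans (sym (strictlyInverseʳ x)) (trans (from-cong e) (strictlyInverseʳ y)))
  ... | no ne = no (ne ∘ to-cong)

  isDomain : RingNotions.IsDomain ring
  isDomain = proj₁ isField , zero-product
    where
    zero-product : ∀ x y → CommutativeRing._*_ ring x y ≈ 0# → x ≈ 0# ⊎ y ≈ 0#
    zero-product x y e with x ≟ 0#
    ... | yes x≈0 = inj₁ x≈0
    ... | no x≉0 with proj₂ isField x x≉0
    ...   | x⁻¹ , x⁻¹x≈1 , _ = inj₂ (trans (sym (*-identityˡ y)) (trans (*-congʳ (sym x⁻¹x≈1))
                                 (trans (*-assoc x⁻¹ x y) (trans (*-congˡ e) (zeroʳ x⁻¹)))))

module FunctionField (F : FiniteField) where
  open FiniteField F using (_≟_; isDomain)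
  open Polynomial (FiniteField.ring F) public using (Poly; IsConstant)

  F[t] : CommutativeRing 0ℓ 0ℓ
  F[t] = Polynomial.polynomialRing (FiniteField.ring F)

  F[t]-isDomain : RingNotions.IsDomain F[t]
  F[t]-isDomain = Polynomial.polynomialRing-isDomain (FiniteField.ring F) (_≟ _) isDomain

  open CommutativeRing F[t] using (_*_; 1#; semiring; rawRing)
  open RawSemiringDefinitions (Semiring.rawSemiring semiring) using (_∣_; Irreducible)
  open Fractions F[t] F[t]-isDomain using (fraction; fraction-isRingHomomorphism)

  F⟨t⟩ : CommutativeRing 0ℓ 0ℓ
  F⟨t⟩ = Fractions.fractionField F[t] F[t]-isDomain

  IsSquareFree : Poly → Set
  IsSquareFree g = ∀ h → h * h ∣ g → h ∣ 1#

  IsCarmichaelPolynomial : Poly → Set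
  IsCarmichaelPolynomial g = IsCarmichaelIdeal F[t] (principal F[t] g)

  module _ (K : FiniteExtension F⟨t⟩) where
    open FiniteExtension K using (ring; ι; ι-hom; degree; IsBasis; discriminant)

    φ : Poly → FiniteExtension.Carrier K
    φ = ι ∘ fraction

    φ-hom : RingMorphisms.IsRingHomomorphism rawRing (FiniteExtension.rawRing K) φ
    φ-hom = Composition.isRingHomomorphism
      (FiniteExtension.trans K) fraction-isRingHomomorphism ι-hom

    open IntegralClosure F[t] ring φ φ-hom using (Integer; value; fromBase; integralClosure)

    𝒪 : CommutativeRing 0ℓ 0ℓ
    𝒪 = integralClosure

    IsCarmichaelElement : Integer → Set
    IsCarmichaelElement α = IsCarmichaelIdeal 𝒪 (principal 𝒪 α)

    IsCarmichaelIn : Poly → Set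
    IsCarmichaelIn g = IsCarmichaelElement (fromBase g)

    -- Generated by the discriminants of the F⟨t⟩-bases of K contained in 𝒪;
    -- each of these lies in F[t], which fraction embeds in F⟨t⟩.
    discriminantIdeal : Ideal F[t] 0ℓ
    discriminantIdeal = generatedIdeal F[t] λ a →
      Σ (Fin degree → Integer) λ b →
        IsBasis (value ∘ b) × CommutativeRing._≈_ F⟨t⟩ (fraction a) (discriminant (value ∘ b))

    DiscriminantPrimeTo : Poly → Set
    DiscriminantPrimeTo g = ∀ h → Irreducible h → h ∣ g →
      ¬ (_dividesIdeal_ F[t] (principal F[t] h) discriminantIdeal)

{-# OPTIONS --safe #-}

-- Let n = ℓ be the prime, let P be an irreducible factor of g such that either g is associated to P
-- or some a satisfies P ∤ a^|F[t]/g| - a; it exists because g is square-free and not Carmichael.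
-- Choose r prime to g that is not an n-th power modulo P. For D ≡ r modulo g the extension
-- K = F(t)(D^(1/n)) is inert at P: on (F[t]/P)[X]/(X^n - D) the Frobenius acts as X ↦ ηX with
-- η = D^((|F[t]/P| - 1)/n) ≠ 1, so norms are powers and every nonzero element is invertible.
-- Reduction modulo P shows that K is a field. If θ^n = D and ζ is a primitive n-th root of unity in F,
-- the operators σ - ζ^j isolate the terms c_i θ^i of an integral element, whence D c_i ∈ F[t]. As D is
-- prime to g, the ring 𝒪/g has |F[t]/g|^n elements, and no irreducible factor of g divides the discriminant ± n^n D^(n-1).
-- If g is associated to P, then 𝒪/g is a field. Otherwise a Carmichael identity in 𝒪/g, applied to θ
-- and to F[t], would force a^|F[t]/g| ≡ a modulo P for all a.
-- The fields are distinguished by Kummer theory: each new D is divisible exactly once by an irreducible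
-- polynomial that does not divide the previous ones.
module Submission where

open import Defs
open import Algebra.Bundles using (CommutativeRing; RawRing; Semiring)
import Algebra.Definitions.RawSemiring as RawSemiringDefinitions
open import Algebra.Morphism.Structures using (module RingMorphisms)
import Algebra.Morphism.Construct.Composition as Composition
import Algebra.Morphism.Construct.Identity as Identity
import Algebra.Properties.AbelianGroup as AbelianGroupProperties
import Algebra.Properties.CommutativeMonoid.Sum as MonoidSummation
import Algebra.Properties.CommutativeSemiring.Binomial as Binomial
import Algebra.Properties.CommutativeSemiring.Exp as CommutativeExponentiation
import Algebra.Properties.Ring as RingProperties
import Algebra.Properties.Semiring.Divisibility as Divisibility
import Algebra.Properties.Semiring.Mult as Multiples
import Algebra.Properties.Semiring.Sum as Summation
import Algebra.Solver.Ring as RingSolver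
open import Algebra.Solver.Ring.AlmostCommutativeRing using (_-Raw-AlmostCommutative⟶_; fromCommutativeRing)
import Algebra.Solver.Ring.NaturalCoefficients.Default as SemiringSolver
open import Data.Empty using (⊥; ⊥-elim)
open import Data.Fin.Base using (Fin; zero; suc; toℕ; fromℕ; fromℕ<; inject₁; punchIn; punchOut; combine; funToFin; finToFun)
open import Data.Fin.Permutation using (Permutation; permutation; _⟨$⟩ʳ_; ↔⇒≡)
import Data.Fin.Properties as Fin
open import Data.List.Base as List using (List; []; _∷_; length)
open import Data.List.Properties using (length-tabulate)
open import Data.Maybe.Base using (Maybe; just; nothing)
open import Data.Nat.Base as ℕ using (ℕ; zero; suc; _≤_; _<_; _∸_; z≤n; s≤s)
open import Data.Nat.Combinatorics using (_C_; nCn≡1)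
open import Data.Nat.Coprimality using (prime⇒coprime; coprime-Bézout)
open import Data.Nat.Divisibility as ℕ∣ using (divides; m%n≡0⇒n∣m)
open import Data.Nat.DivMod using (_/_; _%_; m≡m%n+[m/n]*n; m%n<n)
open import Data.Nat.GCD using (module Bézout)
open import Data.Nat.GeneralisedArithmetic using (iterate)
open import Data.Nat.Primality using (Prime; prime⇒nonZero; prime⇒nonTrivial; ¬prime[0])
import Data.Nat.Properties as ℕ
open import Data.Product.Base using (Σ; ∃; ∃-syntax; _×_; _,_; proj₁; proj₂)
open import Data.Sum.Base using (_⊎_; inj₁; inj₂)
open import Function.Base using (_∘_; id)
open import Function.Bundles using (Inverse)
import Function.Construct.Composition as Compose
open import Level using (Level; _⊔_; 0ℓ)
open import Relation.Binary.Bundles using (Setoid)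
open import Relation.Binary.Definitions using (Tri; tri<; tri≈; tri>)
open import Relation.Binary.PropositionalEquality as ≡ using (_≡_; _≢_)
import Relation.Binary.Reasoning.Setoid as SetoidReasoning
open import Relation.Nullary using (¬_; Dec; yes; no; ¬?)
open import Relation.Nullary.Decidable using (_×-dec_; decidable-stable; map′)

-- The contradiction in the second case arises as follows. Write |F[t]/g| = q^N and |F[t]/P| = q^d.
-- If 𝒪/g, which has q^(N n) elements, satisfied the Carmichael identity, then θ^(q^(N n)) ≡ θ would
-- give D^((q^(N n) - 1)/n) ≡ 1 modulo g, hence modulo P, and the identity on F[t] would make d
-- divide N n, say N n = k d. In the residue field of P that power of D is η^k, where η = D^((q^d -
-- 1)/n) is a nontrivial n-th root of unity. So n divides k, d divides N, and already a^(q^N) ≡ a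
-- modulo P. One choice of D modulo P thus serves three ends: K is a field, 𝒪/g is a field when g is
-- associated to P, and the identity is destroyed otherwise. The obstacle is that D may have
-- repeated factors, so that 𝒪 can be larger than F[t][θ] and no integral basis is at hand.
-- Everything is therefore done modulo g, where D is invertible: D 𝒪 lies in F[t][θ], and D can be
-- cancelled. Likewise the discriminant ideal is never computed; it contains the discriminant of the
-- power basis, and that element is already prime to g.

private variable
  c ℓ c′ ℓ′ ℓ″ : Level

-- Commutative rings

-- A solver for identities with subtraction: the coefficient (m , n) stands for the integer m - n.
module IntegerSolver (R : CommutativeRing c ℓ) where
  open CommutativeRing R hiding (zero)
  open Multiples semiring using (×-homo-+; ×1-homo-*) renaming (_×_ to _ℕ×_)
  open RingProperties ring using (-‿distribˡ-*; -‿distribʳ-*; -‿involutive; -0#≈0#)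
  open AbelianGroupProperties +-abelianGroup using (⁻¹-∙-comm)
  open SemiringSolver commutativeSemiring using (solve; _:=_; _:+_; _:*_)
  open SetoidReasoning setoid

  private
    -- Coefficients are kept in reduced form, since the solver compares them syntactically.
    reduce : ℕ × ℕ → ℕ × ℕ
    reduce (a , b) = a ℕ.∸ b , b ℕ.∸ a

    differences : RawRing 0ℓ 0ℓ
    differences = record
      { Carrier = ℕ × ℕ
      ; _≈_ = _≡_
      ; _+_ = λ (a , b) (x , y) → reduce (a ℕ.+ x , b ℕ.+ y)
      ; _*_ = λ (a , b) (x , y) → reduce (a ℕ.* x ℕ.+ b ℕ.* y , a ℕ.* y ℕ.+ b ℕ.* x)
      ; -_  = λ (a , b) → b , a
      ; 0#  = 0 , 0
      ; 1#  = 1 , 0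
      }

    ⟦_⟧ : ℕ × ℕ → Carrier
    ⟦ a , b ⟧ = a ℕ× 1# - b ℕ× 1#

    equal : ∀ a b x y → a ℕ.+ y ≡ x ℕ.+ b → ⟦ a , b ⟧ ≈ ⟦ x , y ⟧
    equal a b x y e = begin
      a ℕ× 1# - b ℕ× 1#
        ≈⟨ +-congʳ (trans (sym (+-identityʳ _)) (+-congˡ (sym (-‿inverseʳ (y ℕ× 1#))))) ⟩
      (a ℕ× 1# + (y ℕ× 1# - y ℕ× 1#)) - b ℕ× 1#
        ≈⟨ solve 4 (λ a y y′ b′ → ((a :+ (y :+ y′)) :+ b′) := (((a :+ y) :+ y′) :+ b′)) refl _ _ _ _ ⟩
      ((a ℕ× 1# + y ℕ× 1#) - y ℕ× 1#) - b ℕ× 1#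
        ≈⟨ +-congʳ (+-congʳ (trans (sym (×-homo-+ 1# a y)) (trans (reflexive (≡.cong (_ℕ× 1#) e)) (×-homo-+ 1# x b)))) ⟩
      ((x ℕ× 1# + b ℕ× 1#) - y ℕ× 1#) - b ℕ× 1#
        ≈⟨ solve 4 (λ x b y′ b′ → (((x :+ b) :+ y′) :+ b′) := ((x :+ y′) :+ (b :+ b′))) refl _ _ _ _ ⟩
      (x ℕ× 1# - y ℕ× 1#) + (b ℕ× 1# - b ℕ× 1#)
        ≈⟨ trans (+-congˡ (-‿inverseʳ _)) (+-identityʳ _) ⟩
      x ℕ× 1# - y ℕ× 1# ∎

    reduce-≈ : ∀ a b → ⟦ reduce (a , b) ⟧ ≈ ⟦ a , b ⟧
    reduce-≈ a b = equal (a ℕ.∸ b) (b ℕ.∸ a) a b (go a b)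
      where
      go : ∀ a b → (a ℕ.∸ b) ℕ.+ b ≡ a ℕ.+ (b ℕ.∸ a)
      go zero    b       = ≡.trans (≡.cong (ℕ._+ b) (ℕ.0∸n≡0 b)) ≡.refl
      go (suc a) zero    = ≡.refl
      go (suc a) (suc b) = ≡.trans (ℕ.+-suc (a ℕ.∸ b) b) (≡.cong suc (go a b))

    +-homo : ∀ u v → ⟦ RawRing._+_ differences u v ⟧ ≈ ⟦ u ⟧ + ⟦ v ⟧
    +-homo (a , b) (x , y) = begin
      ⟦ reduce (a ℕ.+ x , b ℕ.+ y) ⟧  ≈⟨ reduce-≈ (a ℕ.+ x) (b ℕ.+ y) ⟩
      (a ℕ.+ x) ℕ× 1# - (b ℕ.+ y) ℕ× 1#
        ≈⟨ +-cong (×-homo-+ 1# a x) (-‿cong (×-homo-+ 1# b y)) ⟩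
      (a ℕ× 1# + x ℕ× 1#) - (b ℕ× 1# + y ℕ× 1#)
        ≈⟨ +-congˡ (sym (⁻¹-∙-comm _ _)) ⟩
      (a ℕ× 1# + x ℕ× 1#) + (- (b ℕ× 1#) + - (y ℕ× 1#))
        ≈⟨ solve 4 (λ a x b y → ((a :+ x) :+ (b :+ y)) := ((a :+ b) :+ (x :+ y))) refl
             (a ℕ× 1#) (x ℕ× 1#) (- (b ℕ× 1#)) (- (y ℕ× 1#)) ⟩
      (a ℕ× 1# - b ℕ× 1#) + (x ℕ× 1# - y ℕ× 1#) ∎

    *-homo : ∀ u v → ⟦ RawRing._*_ differences u v ⟧ ≈ ⟦ u ⟧ * ⟦ v ⟧
    *-homo (a , b) (x , y) = begin
      ⟦ reduce (a ℕ.* x ℕ.+ b ℕ.* y , a ℕ.* y ℕ.+ b ℕ.* x) ⟧  ≈⟨ reduce-≈ (a ℕ.* x ℕ.+ b ℕ.* y) (a ℕ.* y ℕ.+ b ℕ.* x) ⟩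
      (a ℕ.* x ℕ.+ b ℕ.* y) ℕ× 1# - (a ℕ.* y ℕ.+ b ℕ.* x) ℕ× 1#
        ≈⟨ +-cong (expand a x b y) (-‿cong (expand a y b x)) ⟩
      (A * X + B * Y) - (A * Y + B * X)
        ≈⟨ +-cong (+-congˡ (trans (sym (-‿involutive _)) (-‿cong (-‿distribˡ-* B Y)))) (sym (⁻¹-∙-comm _ _)) ⟩
      (A * X + - (- B * Y)) + (- (A * Y) + - (B * X))
        ≈⟨ +-cong (+-congˡ (-‿distribʳ-* (- B) Y)) (+-cong (-‿distribʳ-* A Y) (-‿distribˡ-* B X)) ⟩
      (A * X + - B * - Y) + (A * - Y + - B * X)
        ≈⟨ solve 4 (λ a b x y → ((a :* x :+ b :* y) :+ (a :* y :+ b :* x)) := ((a :+ b) :* (x :+ y)))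
             refl A (- B) X (- Y) ⟩
      (A - B) * (X - Y) ∎
      where
      A B X Y : Carrier
      A = a ℕ× 1#
      B = b ℕ× 1#
      X = x ℕ× 1#
      Y = y ℕ× 1#
      expand : ∀ a x b y → (a ℕ.* x ℕ.+ b ℕ.* y) ℕ× 1# ≈ a ℕ× 1# * x ℕ× 1# + b ℕ× 1# * y ℕ× 1#
      expand a x b y = trans (×-homo-+ 1# (a ℕ.* x) (b ℕ.* y)) (+-cong (×1-homo-* a x) (×1-homo-* b y))

    morphism : differences -Raw-AlmostCommutative⟶ fromCommutativeRing R
    morphism = record
      { ⟦_⟧    = ⟦_⟧
      ; +-homo = +-homo
      ; *-homo = *-homo
      ; -‿homo = λ (a , b) → sym (trans (sym (⁻¹-∙-comm _ _))
          (trans (+-comm _ _) (+-congʳ (-‿involutive _))))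
      ; 0-homo = -‿inverseʳ 0#
      ; 1-homo = trans (+-congˡ -0#≈0#) (trans (+-identityʳ _) (+-identityʳ 1#))
      }

    _coeff≟_ : ∀ u v → Maybe (⟦ u ⟧ ≈ ⟦ v ⟧)
    (a , b) coeff≟ (x , y) with a ℕ.+ y ℕ.≟ x ℕ.+ b
    ... | no _  = nothing
    ... | yes e = just (equal a b x y e)

  open RingSolver differences (fromCommutativeRing R) morphism _coeff≟_ public
    using (solve; _:=_; _:+_; _:*_; _:-_; :-_)

module CommutativeRingTheory (R : CommutativeRing c ℓ) where
  open CommutativeRing R public using
    ( Carrier; _≈_; _≉_; _+_; _*_; -_; _-_; 0#; 1#; refl; sym; trans; reflexive; setoid
    ; +-cong; +-congˡ; +-congʳ; +-assoc; +-comm; +-identityˡ; +-identityʳ; -‿cong; -‿inverseˡ; -‿inverseʳ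
    ; *-cong; *-congˡ; *-congʳ; *-assoc; *-comm; *-identityˡ; *-identityʳ; distribˡ; distribʳ; zeroˡ; zeroʳ
    ; rawRing; ring; semiring; commutativeSemiring; *-commutativeMonoid )
  open RawSemiringDefinitions (Semiring.rawSemiring semiring) public using (_∣_; Irreducible; mkIrred)
  open Divisibility semiring public using (_,_; ∣ʳ-refl; ∣ʳ-trans; ∣ʳ-respʳ-≈; ∣ʳ-respˡ-≈; _∣0; 0∣x⇒x≈0)
  open CommutativeExponentiation commutativeSemiring public
    using (_^_; ^-congˡ; ^-congʳ; ^-homo-*; ^-assocʳ; ^-distrib-*)
  open Multiples semiring public using (×-homo-+; ×1-homo-*; ×-assoc-*) renaming (_×_ to _ℕ×_; ×-congʳ to ℕ×-congʳ)
  open Summation semiring public using (sum; sum-cong-≋; ∑-distrib-+; *-distribˡ-sum; *-distribʳ-sum; sum-remove; sum-permute; sum-init-last)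
  open RingProperties ring public using (-1*x≈-x; -‿distribˡ-*; -‿distribʳ-*; -‿involutive; -0#≈0#)
  open IntegerSolver R public
  open RingNotions R public
  open SetoidReasoning setoid

  -- The field property as an outright case distinction, without 1 ≠ 0; inertness of P is stated in
  -- this form for the residue ring.
  ZeroOrInvertible : Set (c ⊔ ℓ)
  ZeroOrInvertible = ∀ x → x ≈ 0# ⊎ ∃[ y ] y * x ≈ 1#

  x-y≈0⇒x≈y : ∀ {x y} → x - y ≈ 0# → x ≈ y
  x-y≈0⇒x≈y {x} {y} e = begin
    x            ≈⟨ solve 2 (λ x y → x := ((x :- y) :+ y)) refl x y ⟩
    (x - y) + y  ≈⟨ +-congʳ e ⟩
    0# + y       ≈⟨ +-identityˡ y ⟩
    y            ∎

  x≈y⇒x-y≈0 : ∀ {x y} → x ≈ y → x - y ≈ 0#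
  x≈y⇒x-y≈0 {x} {y} e = trans (+-congʳ e) (-‿inverseʳ y)

  x+y≈0⇒x≈-y : ∀ {x y} → x + y ≈ 0# → x ≈ - y
  x+y≈0⇒x≈-y {x} {y} e = x-y≈0⇒x≈y (trans (+-congˡ (-‿involutive y)) e)

  1^n≈1 : ∀ n → 1# ^ n ≈ 1#
  1^n≈1 zero    = refl
  1^n≈1 (suc n) = trans (*-identityˡ _) (1^n≈1 n)

  0^n≈0 : ∀ n → 1 ≤ n → 0# ^ n ≈ 0#
  0^n≈0 (suc n) _ = zeroˡ _

  sum-0 : ∀ {n} (f : Fin n → Carrier) → (∀ i → f i ≈ 0#) → sum f ≈ 0#
  sum-0 {zero}  f e = refl
  sum-0 {suc n} f e = trans (+-cong (e zero) (sum-0 (f ∘ suc) (e ∘ suc))) (+-identityˡ 0#)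

  sum-cong : ∀ {n} (f g : Fin n → Carrier) → (∀ i → f i ≈ g i) → sum f ≈ sum g
  sum-cong {n} f g e = sum-cong-≋ {n} {f} {g} e

  sum-single : ∀ {n} (f : Fin n → Carrier) j → (∀ i → i ≢ j → f i ≈ 0#) → sum f ≈ f j
  sum-single {suc n} f j e = trans (sum-remove {n} {j} f)
    (trans (+-congˡ (sum-0 (f ∘ punchIn j) (λ i → e (punchIn j i) (Fin.punchInᵢ≢i j i)))) (+-identityʳ _))

  ∣-+ : ∀ {a x y} → a ∣ x → a ∣ y → a ∣ (x + y)
  ∣-+ {a} (s , e) (t , f) = (s + t) , trans (distribʳ a s t) (+-cong e f)

  ∣-*ˡ : ∀ {a x} y → a ∣ x → a ∣ (y * x)
  ∣-*ˡ {a} y (s , e) = (y * s) , trans (*-assoc y s a) (*-congˡ e)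

  ∣-*ʳ : ∀ {a x} y → a ∣ x → a ∣ (x * y)
  ∣-*ʳ y d = ∣ʳ-respʳ-≈ (*-comm y _) (∣-*ˡ y d)

  ∣-neg : ∀ {a x} → a ∣ x → a ∣ (- x)
  ∣-neg d = ∣ʳ-respʳ-≈ (-1*x≈-x _) (∣-*ˡ (- 1#) d)

  ∣-≈0 : ∀ {a x} → x ≈ 0# → a ∣ x
  ∣-≈0 e = ∣ʳ-respʳ-≈ (sym e) (_ ∣0)

  unit-* : ∀ {a b} → a ∣ 1# → b ∣ 1# → (a * b) ∣ 1#
  unit-* {a} {b} (s , e) (t , f) = (s * t) , trans
    (solve 4 (λ s t a b → ((s :* t) :* (a :* b)) := ((s :* a) :* (t :* b))) refl s t a b)
    (trans (*-cong e f) (*-identityˡ 1#))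

  unit-^ : ∀ {a} n → a ∣ 1# → (a ^ n) ∣ 1#
  unit-^ zero    d = ∣ʳ-refl
  unit-^ (suc n) d = unit-* d (unit-^ n d)

  unit-cancel : ∀ {a x} → a ∣ 1# → a * x ≈ 0# → x ≈ 0#
  unit-cancel {a} {x} (s , e) f = begin
    x            ≈⟨ *-identityˡ x ⟨
    1# * x       ≈⟨ *-congʳ e ⟨
    (s * a) * x  ≈⟨ *-assoc s a x ⟩
    s * (a * x)  ≈⟨ *-congˡ f ⟩
    s * 0#       ≈⟨ zeroʳ s ⟩
    0#           ∎

  coprime-∣ : ∀ {s t x a y} → (s * x) + (t * a) ≈ 1# → x ∣ (a * y) → x ∣ y
  coprime-∣ {s} {t} {x} {a} {y} e (q , f) = (y * s + t * q) , (begin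
    (y * s + t * q) * x
      ≈⟨ solve 5 (λ y s t q x → ((y :* s :+ t :* q) :* x) := (y :* (s :* x) :+ t :* (q :* x))) refl y s t q x ⟩
    y * (s * x) + t * (q * x)  ≈⟨ +-congˡ (*-congˡ f) ⟩
    y * (s * x) + t * (a * y)
      ≈⟨ solve 5 (λ y s x t a → (y :* (s :* x) :+ t :* (a :* y)) := (((s :* x) :+ (t :* a)) :* y)) refl y s x t a ⟩
    ((s * x) + (t * a)) * y    ≈⟨ *-congʳ e ⟩
    1# * y                     ≈⟨ *-identityˡ y ⟩
    y                          ∎)

module Homomorphism {R : CommutativeRing c ℓ} {S : CommutativeRing c′ ℓ′}
  {f : CommutativeRing.Carrier R → CommutativeRing.Carrier S}
  (f-hom : RingMorphisms.IsRingHomomorphism (CommutativeRing.rawRing R) (CommutativeRing.rawRing S) f)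
  where

  private
    module R = CommutativeRingTheory R
    module S = CommutativeRingTheory S
  open RingMorphisms.IsRingHomomorphism f-hom public using (+-homo; *-homo; 0#-homo; 1#-homo; -‿homo)
    renaming (⟦⟧-cong to cong)

  ^-homo : ∀ x n → f (x R.^ n) S.≈ f x S.^ n
  ^-homo x zero    = 1#-homo
  ^-homo x (suc n) = S.trans (*-homo x (x R.^ n)) (S.*-congˡ (^-homo x n))

  sum-homo : ∀ {n} (g : Fin n → R.Carrier) → f (R.sum g) S.≈ S.sum (f ∘ g)
  sum-homo {zero}  g = 0#-homo
  sum-homo {suc n} g = S.trans (+-homo _ _) (S.+-congˡ (sum-homo (g ∘ suc)))

  minus-homo : ∀ x y → f (x R.- y) S.≈ f x S.- f y
  minus-homo x y = S.trans (+-homo x (R.- y)) (S.+-congˡ (-‿homo y))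

  ×-homo : ∀ n x → f (n R.ℕ× x) S.≈ n S.ℕ× f x
  ×-homo zero    x = 0#-homo
  ×-homo (suc n) x = S.trans (+-homo _ _) (S.+-congˡ (×-homo n x))

-- An additive map into a group preserves zero and negatives by itself, so only four conditions have
-- to be checked.
mkHomomorphism : (R : CommutativeRing c ℓ) (S : CommutativeRing c′ ℓ′)
  (let module R = CommutativeRing R) (let module S = CommutativeRing S)
  (f : R.Carrier → S.Carrier) →
  (∀ {x y} → x R.≈ y → f x S.≈ f y) →
  (∀ x y → f (x R.+ y) S.≈ f x S.+ f y) →
  (∀ x y → f (x R.* y) S.≈ f x S.* f y) →
  f R.1# S.≈ S.1# →
  RingMorphisms.IsRingHomomorphism R.rawRing S.rawRing f
mkHomomorphism R S f f-cong f-+ f-* f-1 = record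
  { isSemiringHomomorphism = record
    { isNearSemiringHomomorphism = record
      { +-isMonoidHomomorphism = record
        { isMagmaHomomorphism = record
          { isRelHomomorphism = record { cong = f-cong }
          ; homo = f-+
          }
        ; ε-homo = f-0
        }
      ; *-homo = f-*
      }
    ; 1#-homo = f-1
    }
  ; -‿homo = f-neg
  }
  where
  module R = CommutativeRingTheory R
  module S = CommutativeRingTheory S
  f-0 : f R.0# S.≈ S.0#
  f-0 = begin
    f R.0#                          ≈⟨ S.solve 1 (λ x → x S.:= ((x S.:+ x) S.:- x)) S.refl (f R.0#) ⟩
    (f R.0# S.+ f R.0#) S.- f R.0#  ≈⟨ S.+-congʳ (f-+ R.0# R.0#) ⟨
    f (R.0# R.+ R.0#) S.- f R.0#    ≈⟨ S.+-congʳ (f-cong (R.+-identityˡ R.0#)) ⟩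
    f R.0# S.- f R.0#               ≈⟨ S.-‿inverseʳ (f R.0#) ⟩
    S.0#                            ∎
    where open SetoidReasoning S.setoid
  f-neg : ∀ x → f (R.- x) S.≈ S.- f x
  f-neg x = S.x+y≈0⇒x≈-y (S.trans (S.sym (f-+ (R.- x) x)) (S.trans (f-cong (R.-‿inverseˡ x)) f-0))

-- Polynomials and their roots

module PolynomialTheory (R : CommutativeRing c ℓ) where
  open CommutativeRingTheory R
  open Polynomial R
  open SetoidReasoning setoid
  module P = CommutativeRingTheory polynomialRing

  coeff-*-zero : ∀ x s g → coeff ((x ∷ s) *ₚ g) 0 ≈ x * coeff g 0
  coeff-*-zero x s g = trans (coeff-+ (x ·ₚ g) (0# ∷ (s *ₚ g)) 0) (trans (+-identityʳ _) (coeff-· x g 0))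

  coeff-*-suc : ∀ x s g m → coeff ((x ∷ s) *ₚ g) (suc m) ≈ x * coeff g (suc m) + coeff (s *ₚ g) m
  coeff-*-suc x s g m = trans (coeff-+ (x ·ₚ g) (0# ∷ (s *ₚ g)) (suc m)) (+-congʳ (coeff-· x g (suc m)))

  coeff-minus : ∀ f g m → coeff (f P.- g) m ≈ coeff f m - coeff g m
  coeff-minus f g m = trans (coeff-+ f (-ₚ g) m) (+-congˡ (coeff-neg g m))

  constant-* : ∀ x f → constant x *ₚ f ≈ₚ x ·ₚ f
  constant-* x f = P.trans (P.+-congˡ (∷-zero refl reflₚ)) (P.+-identityʳ (x ·ₚ f))

  DegreeBelow : ℕ → Poly → Set ℓ
  DegreeBelow n f = ∀ m → n ≤ m → coeff f m ≈ 0#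

  below-resp : ∀ {n f g} → f ≈ₚ g → DegreeBelow n f → DegreeBelow n g
  below-resp e b m n≤m = trans (sym (at e m)) (b m n≤m)

  below-minus : ∀ {n f g} → DegreeBelow n f → DegreeBelow n g → DegreeBelow n (f P.- g)
  below-minus {n} {f} {g} b b′ m n≤m = begin
    coeff (f P.- g) m     ≈⟨ coeff-minus f g m ⟩
    coeff f m - coeff g m ≈⟨ +-cong (b m n≤m) (-‿cong (b′ m n≤m)) ⟩
    0# - 0#               ≈⟨ -‿inverseʳ 0# ⟩
    0#                    ∎

  length-below : ∀ f → DegreeBelow (length f) f
  length-below []      m       _         = refl
  length-below (x ∷ f) (suc m) (s≤s n≤m) = length-below f m n≤m

  coeff-tabulate : ∀ {n} (c : Fin n → Carrier) i → coeff (List.tabulate c) (toℕ i) ≈ c i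
  coeff-tabulate c zero    = refl
  coeff-tabulate c (suc i) = coeff-tabulate (c ∘ suc) i

  tabulate-below : ∀ {n} (c : Fin n → Carrier) → DegreeBelow n (List.tabulate c)
  tabulate-below {zero}  c m       _         = refl
  tabulate-below {suc n} c (suc m) (s≤s n≤m) = tabulate-below (c ∘ suc) m n≤m

  tabulate-cong : ∀ {n} {c d : Fin n → Carrier} → (∀ i → c i ≈ d i) → List.tabulate c ≈ₚ List.tabulate d
  tabulate-cong {zero}  e = reflₚ
  tabulate-cong {suc n} e = ∷-cong (e zero) (tabulate-cong (e ∘ suc))

  below⇒tabulate : ∀ {n} f → DegreeBelow n f → f ≈ₚ List.tabulate {n = n} (coeff f ∘ toℕ)
  below⇒tabulate {zero}  f       b = coeffwise λ m → b m z≤n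
  below⇒tabulate {suc n} []      b = P.sym (∷-zero refl (P.sym (below⇒tabulate {n} [] (λ m _ → refl))))
  below⇒tabulate {suc n} (x ∷ f) b = ∷-cong refl (below⇒tabulate {n} f (λ m n≤m → b (suc m) (s≤s n≤m)))

  -- From index n upward, the coefficients of `s *ₚ g` are those of `(x ∷ s) *ₚ g` shifted by one,
  -- so the tail `s` vanishes by recursion; then `x` times the leading coefficient is the
  -- coefficient at n. Only regularity of the leading coefficient enters, so the coefficient ring
  -- may be arbitrary.
  multiple-below⇒≈0 : ∀ {n} g → (∀ y → y * coeff g n ≈ 0# → y ≈ 0#) → DegreeBelow (suc n) g →
                      ∀ s → DegreeBelow n (s *ₚ g) → s ≈ₚ []
  multiple-below⇒≈0 g regular g-below [] b = reflₚ
  multiple-below⇒≈0 {n} g regular g-below (x ∷ s) b = ∷-zero (regular x (x-lead n g-below b)) s≈0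
    where
    s≈0 : s ≈ₚ []
    s≈0 = multiple-below⇒≈0 g regular g-below s λ m n≤m → begin
      coeff (s *ₚ g) m                        ≈⟨ +-identityˡ _ ⟨
      0# + coeff (s *ₚ g) m                   ≈⟨ +-congʳ (trans (*-congˡ (g-below (suc m) (s≤s n≤m))) (zeroʳ x)) ⟨
      x * coeff g (suc m) + coeff (s *ₚ g) m  ≈⟨ coeff-*-suc x s g m ⟨
      coeff ((x ∷ s) *ₚ g) (suc m)            ≈⟨ b (suc m) (ℕ.m≤n⇒m≤1+n n≤m) ⟩
      0#                                      ∎
    x-lead : ∀ n → DegreeBelow (suc n) g → DegreeBelow n ((x ∷ s) *ₚ g) → x * coeff g n ≈ 0#
    x-lead zero    _ b = trans (sym (coeff-*-zero x s g)) (b 0 z≤n)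
    x-lead (suc n) _ b = begin
      x * coeff g (suc n)                     ≈⟨ +-identityʳ _ ⟨
      x * coeff g (suc n) + 0#                ≈⟨ +-congˡ (at (P.trans (P.*-congʳ s≈0) (P.zeroˡ g)) n) ⟨
      x * coeff g (suc n) + coeff (s *ₚ g) n  ≈⟨ coeff-*-suc x s g n ⟨
      coeff ((x ∷ s) *ₚ g) (suc n)            ≈⟨ b (suc n) ℕ.≤-refl ⟩
      0#                                      ∎

  abstract
    -- Recursion from the constant term: if f = s g + r, then x + X f = (q + X s) g + (x + X r - q
    -- g), where q is chosen to cancel the single coefficient of x + X r at index n.
    divide : ∀ {n u} g → u * coeff g n ≈ 1# → DegreeBelow (suc n) g →
             ∀ f → ∃[ s ] ∃[ r ] f ≈ₚ (s *ₚ g) +ₚ r × DegreeBelow n r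
    divide g lead g-below [] = [] , [] , reflₚ , λ m _ → refl
    divide {n} {u} g lead g-below (x ∷ f) with divide {n} {u} g lead g-below f
    ... | s , r , e , r-below = (q ∷ s) , r′ , coeffwise equation , r′-below
      where
      q : Carrier
      q = coeff (x ∷ r) n * u
      r′ : Poly
      r′ = (x ∷ r) P.- (q ·ₚ g)
      coeff-r′ : ∀ m → coeff r′ m ≈ coeff (x ∷ r) m - q * coeff g m
      coeff-r′ m = trans (coeff-minus (x ∷ r) (q ·ₚ g) m) (+-congˡ (-‿cong (coeff-· q g m)))
      equation : ∀ m → coeff (x ∷ f) m ≈ coeff (((q ∷ s) *ₚ g) +ₚ r′) m
      equation zero = sym (begin
        coeff (((q ∷ s) *ₚ g) +ₚ r′) 0          ≈⟨ coeff-+ ((q ∷ s) *ₚ g) r′ 0 ⟩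
        coeff ((q ∷ s) *ₚ g) 0 + coeff r′ 0     ≈⟨ +-cong (coeff-*-zero q s g) (coeff-r′ 0) ⟩
        q * coeff g 0 + (x - q * coeff g 0)
          ≈⟨ solve 2 (λ a x → (a :+ (x :- a)) := x) refl (q * coeff g 0) x ⟩
        x ∎)
      equation (suc m) = sym (begin
        coeff (((q ∷ s) *ₚ g) +ₚ r′) (suc m)    ≈⟨ coeff-+ ((q ∷ s) *ₚ g) r′ (suc m) ⟩
        coeff ((q ∷ s) *ₚ g) (suc m) + coeff r′ (suc m)  ≈⟨ +-cong (coeff-*-suc q s g m) (coeff-r′ (suc m)) ⟩
        (q * coeff g (suc m) + coeff (s *ₚ g) m) + (coeff r m - q * coeff g (suc m))
          ≈⟨ solve 3 (λ a b r → ((a :+ b) :+ (r :- a)) := (b :+ r)) refl _ _ _ ⟩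
        coeff (s *ₚ g) m + coeff r m            ≈⟨ coeff-+ (s *ₚ g) r m ⟨
        coeff ((s *ₚ g) +ₚ r) m                 ≈⟨ at e m ⟨
        coeff f m                               ∎)
      r′-below : DegreeBelow n r′
      r′-below m n≤m with ℕ.m≤n⇒m<n∨m≡n n≤m
      r′-below (suc m) _ | inj₁ (s≤s n≤m) = begin
        coeff r′ (suc m)                 ≈⟨ coeff-r′ (suc m) ⟩
        coeff r m - q * coeff g (suc m)
          ≈⟨ +-cong (r-below m n≤m) (-‿cong (trans (*-congˡ (g-below (suc m) (s≤s n≤m))) (zeroʳ q))) ⟩
        0# - 0#                          ≈⟨ -‿inverseʳ 0# ⟩
        0#                               ∎
      r′-below m _ | inj₂ ≡.refl = begin
        coeff r′ m                       ≈⟨ coeff-r′ m ⟩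
        y - (y * u) * coeff g m          ≈⟨ +-congˡ (-‿cong (*-assoc y u _)) ⟩
        y - y * (u * coeff g m)          ≈⟨ +-congˡ (-‿cong (trans (*-congˡ lead) (*-identityʳ y))) ⟩
        y - y                            ≈⟨ -‿inverseʳ y ⟩
        0#                               ∎
        where
        y : Carrier
        y = coeff (x ∷ r) n

  monomial : ℕ → Poly
  monomial zero    = 1# ∷ []
  monomial (suc n) = 0# ∷ monomial n

  length-monomial : ∀ n → length (monomial n) ≡ suc n
  length-monomial zero    = ≡.refl
  length-monomial (suc n) = ≡.cong suc (length-monomial n)

  coeff-monomial : ∀ n → coeff (monomial n) n ≈ 1#
  coeff-monomial zero    = refl
  coeff-monomial (suc n) = coeff-monomial n

-- The coefficients of the remainder of a division by g are coordinates on R[X]/(g).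
module RemainderCoordinates (R : CommutativeRing c ℓ) (g : Polynomial.Poly R) (n : ℕ)
  (u : CommutativeRing.Carrier R)
  (lead : CommutativeRing._≈_ R (CommutativeRing._*_ R u (Polynomial.coeff R g n)) (CommutativeRing.1# R))
  (g-below : PolynomialTheory.DegreeBelow R (suc n) g)
  where

  open CommutativeRingTheory R
  open Polynomial R
  open PolynomialTheory R
  open Quotient polynomialRing (principal polynomialRing g)
  private module Q = CommutativeRing quotientRing

  lead-regular : ∀ y → y * coeff g n ≈ 0# → y ≈ 0#
  lead-regular y e = unit-cancel (u , lead) (trans (*-comm _ y) e)

  coords : Poly → Fin n → Carrier
  coords f i = coeff (proj₁ (proj₂ (divide {n} {u} g lead g-below f))) (toℕ i)

  coords-sound : ∀ f → f Q.≈ List.tabulate (coords f)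
  coords-sound f with divide {n} {u} g lead g-below f
  ... | s , r , e , r-below = congruent (s P., P.trans
      (P.solve 2 (λ a r → a P.:= ((a P.:+ r) P.:- r)) P.refl (s *ₚ g) r)
      (P.+-cong (P.sym e) (P.-‿cong (below⇒tabulate r r-below))))

  below-≡⇒≈ : ∀ {f h} → DegreeBelow n f → DegreeBelow n h → f Q.≈ h → f ≈ₚ h
  below-≡⇒≈ {f} {h} f-below h-below (congruent (s P., e)) =
    P.x-y≈0⇒x≈y (P.trans (P.sym e) (P.trans (P.*-congʳ s≈0) (P.zeroˡ g)))
    where
    s≈0 : s ≈ₚ []
    s≈0 = multiple-below⇒≈0 g lead-regular g-below s
      (below-resp (P.sym e) (below-minus {n} {f} {h} f-below h-below))

  coords-unique : ∀ {f} (c : Fin n → Carrier) → f Q.≈ List.tabulate c → ∀ i → coords f i ≈ c i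
  coords-unique {f} c e i = trans (sym (coeff-tabulate (coords f) i))
    (trans (at (below-≡⇒≈ (tabulate-below (coords f)) (tabulate-below c)
      (Q.trans (Q.sym (coords-sound f)) e)) (toℕ i)) (coeff-tabulate c i))

  coords-cong : ∀ {f h} → f Q.≈ h → ∀ i → coords f i ≈ coords h i
  coords-cong {f} {h} e = coords-unique (coords h) (Q.trans e (coords-sound h))

  ≈⇒Q≈ : ∀ {f h} → f ≈ₚ h → f Q.≈ h
  ≈⇒Q≈ e = congruent (P.∣-≈0 (P.x≈y⇒x-y≈0 e))

-- Finite setoids

module _ {S : Setoid c ℓ} {T : Setoid c′ ℓ′} where
  private
    module S = Setoid S
    module T = Setoid T

  mkInverse : (to : S.Carrier → T.Carrier) (from : T.Carrier → S.Carrier) →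
              (∀ {x y} → x S.≈ y → to x T.≈ to y) → (∀ {x y} → x T.≈ y → from x S.≈ from y) →
              (∀ x → to (from x) T.≈ x) → (∀ x → from (to x) S.≈ x) → Inverse S T
  mkInverse to from to-cong from-cong to-from from-to = record
    { to = to
    ; from = from
    ; to-cong = to-cong
    ; from-cong = from-cong
    ; inverse = (λ e → T.trans (to-cong e) (to-from _)) , (λ e → S.trans (from-cong e) (from-to _))
    }

module _ {S : Setoid c ℓ} where
  private module S = Setoid S

  functionSetoid : ℕ → Setoid c ℓ
  functionSetoid n = record
    { Carrier = Fin n → S.Carrier
    ; _≈_ = λ f g → ∀ i → f i S.≈ g i
    ; isEquivalence = record
      { refl = λ i → S.refl
      ; sym = λ e i → S.sym (e i)
      ; trans = λ e f i → S.trans (e i) (f i)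
      }
    }

  function-cardinality : ∀ {m} n → Inverse S (≡.setoid (Fin m)) →
                         Inverse (functionSetoid n) (≡.setoid (Fin (m ℕ.^ n)))
  function-cardinality {m} n I = mkInverse
    (λ f → funToFin (I.to ∘ f))
    (λ k → I.from ∘ finToFun {m} {n} k)
    (λ e → funToFin-cong (λ i → I.to-cong (e i)))
    (λ e i → S.reflexive (≡.cong (λ k → I.from (finToFun {m} {n} k i)) e))
    (λ k → ≡.trans (funToFin-cong {n = n} {g = finToFun {m} {n} k} (λ i → I.strictlyInverseˡ _)) (Fin.funToFin-finToFin {n} {m} k))
    (λ f i → S.trans (I.from-cong (Fin.finToFun-funToFin (I.to ∘ f) i)) (I.strictlyInverseʳ (f i)))
    where
    module I = Inverse I
    funToFin-cong : ∀ {m n} {f g : Fin n → Fin m} → (∀ i → f i ≡ g i) → funToFin f ≡ funToFin g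
    funToFin-cong {n = zero}  e = ≡.refl
    funToFin-cong {n = suc n} e = ≡.cong₂ combine (e zero) (funToFin-cong (e ∘ suc))

  -- A Carmichael ring comes with its own enumeration; this identifies its exponent with the size
  -- obtained from another count.
  cardinality-unique : ∀ {m n} → Inverse S (≡.setoid (Fin m)) → Inverse S (≡.setoid (Fin n)) → m ≡ n
  cardinality-unique I J = ↔⇒≡ (permutation (J.to ∘ I.from) (I.to ∘ J.from)
    (λ x → ≡.trans (J.to-cong (I.strictlyInverseʳ _)) (J.strictlyInverseˡ x))
    (λ x → ≡.trans (I.to-cong (J.strictlyInverseʳ _)) (I.strictlyInverseˡ x)))
    where
    module I = Inverse I
    module J = Inverse J

  -- The form in which excluded middle is available over a finite ring: either a witness or a proof
  -- that there is none.
  finite-search : ∀ {n} → Inverse S (≡.setoid (Fin n)) → (Q : S.Carrier → Set ℓ″) →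
                  (∀ {x y} → x S.≈ y → Q x → Q y) → (∀ x → Dec (Q x)) → ∃ Q ⊎ (∀ x → ¬ Q x)
  finite-search I Q resp dec with Fin.any? (dec ∘ Inverse.from I)
  ... | yes (i , q) = inj₁ (Inverse.from I i , q)
  ... | no none     = inj₂ λ x q → none (Inverse.to I x , resp (S.sym (Inverse.strictlyInverseʳ I x)) q)

module Evaluation {R : CommutativeRing c ℓ} {S : CommutativeRing c′ ℓ′}
  {f : CommutativeRing.Carrier R → CommutativeRing.Carrier S}
  (f-hom : RingMorphisms.IsRingHomomorphism (CommutativeRing.rawRing R) (CommutativeRing.rawRing S) f)
  (b : CommutativeRing.Carrier S)
  where

  private module R = CommutativeRing R
  open CommutativeRingTheory S
  open Homomorphism {R = R} {S = S} f-hom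
  open Polynomial R
  open PolynomialTheory R using (monomial)
  open SetoidReasoning setoid

  eval : Poly → Carrier
  eval []      = 0#
  eval (x ∷ p) = f x + b * eval p

  eval-≈0 : ∀ p → p ≈ₚ [] → eval p ≈ 0#
  eval-≈0 []      e = refl
  eval-≈0 (x ∷ p) e = begin
    f x + b * eval p  ≈⟨ +-cong (trans (cong (at e 0)) 0#-homo) (*-congˡ (eval-≈0 p (coeffwise (at e ∘ suc)))) ⟩
    0# + b * 0#       ≈⟨ trans (+-identityˡ _) (zeroʳ b) ⟩
    0#                ∎

  eval-cong : ∀ {p q} → p ≈ₚ q → eval p ≈ eval q
  eval-cong {[]}    {q}     e = sym (eval-≈0 q (symₚ e))
  eval-cong {x ∷ p} {[]}    e = eval-≈0 (x ∷ p) e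
  eval-cong {x ∷ p} {y ∷ q} e = +-cong (cong (at e 0)) (*-congˡ (eval-cong {p} {q} (∷-tail e)))

  eval-+ : ∀ p q → eval (p +ₚ q) ≈ eval p + eval q
  eval-+ []      q       = sym (+-identityˡ _)
  eval-+ (x ∷ p) []      = sym (+-identityʳ _)
  eval-+ (x ∷ p) (y ∷ q) = begin
    f (x R.+ y) + b * eval (p +ₚ q)        ≈⟨ +-cong (+-homo x y) (*-congˡ (eval-+ p q)) ⟩
    (f x + f y) + b * (eval p + eval q)
      ≈⟨ solve 5 (λ x y b p q → ((x :+ y) :+ b :* (p :+ q)) := ((x :+ b :* p) :+ (y :+ b :* q))) refl
           (f x) (f y) b (eval p) (eval q) ⟩
    (f x + b * eval p) + (f y + b * eval q) ∎

  eval-· : ∀ x p → eval (x ·ₚ p) ≈ f x * eval p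
  eval-· x []      = sym (zeroʳ (f x))
  eval-· x (y ∷ p) = begin
    f (x R.* y) + b * eval (x ·ₚ p)   ≈⟨ +-cong (*-homo x y) (*-congˡ (eval-· x p)) ⟩
    f x * f y + b * (f x * eval p)
      ≈⟨ solve 4 (λ x y b p → (x :* y :+ b :* (x :* p)) := (x :* (y :+ b :* p))) refl (f x) (f y) b (eval p) ⟩
    f x * (f y + b * eval p)          ∎

  eval-* : ∀ p q → eval (p *ₚ q) ≈ eval p * eval q
  eval-* []      q = sym (zeroˡ _)
  eval-* (x ∷ p) q = begin
    eval ((x ·ₚ q) +ₚ (R.0# ∷ (p *ₚ q)))          ≈⟨ eval-+ (x ·ₚ q) (R.0# ∷ (p *ₚ q)) ⟩
    eval (x ·ₚ q) + (f R.0# + b * eval (p *ₚ q))  ≈⟨ +-cong (eval-· x q) (+-cong 0#-homo (*-congˡ (eval-* p q))) ⟩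
    f x * eval q + (0# + b * (eval p * eval q))
      ≈⟨ +-congˡ (+-identityˡ _) ⟩
    f x * eval q + b * (eval p * eval q)
      ≈⟨ solve 4 (λ x b p q → (x :* q :+ b :* (p :* q)) := ((x :+ b :* p) :* q)) refl (f x) b (eval p) (eval q) ⟩
    (f x + b * eval p) * eval q                   ∎

  eval-constant : ∀ x → eval (constant x) ≈ f x
  eval-constant x = trans (+-congˡ (zeroʳ b)) (+-identityʳ _)

  eval-hom : RingMorphisms.IsRingHomomorphism (CommutativeRing.rawRing polynomialRing) (CommutativeRing.rawRing S) eval
  eval-hom = mkHomomorphism polynomialRing S eval (λ {p} {q} → eval-cong {p} {q}) eval-+ eval-*
    (trans (eval-constant R.1#) 1#-homo)

  eval-monomial : ∀ n → eval (monomial n) ≈ b ^ n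
  eval-monomial zero    = trans (eval-constant R.1#) 1#-homo
  eval-monomial (suc n) = trans (+-cong 0#-homo (*-congˡ (eval-monomial n))) (+-identityˡ _)

  eval-tabulate : ∀ {n} (c : Fin n → R.Carrier) → eval (List.tabulate c) ≈ sum (λ i → f (c i) * b ^ toℕ i)
  eval-tabulate {zero}  c = refl
  eval-tabulate {suc n} c = +-cong (sym (*-identityʳ _)) (begin
    b * eval (List.tabulate (c ∘ suc))                 ≈⟨ *-congˡ (eval-tabulate (c ∘ suc)) ⟩
    b * sum (λ i → f (c (suc i)) * b ^ toℕ i)
      ≈⟨ *-distribˡ-sum b (λ i → f (c (suc i)) * b ^ toℕ i) ⟩
    sum (λ i → b * (f (c (suc i)) * b ^ toℕ i))
      ≈⟨ sum-cong _ _ (λ i → solve 3 (λ b c p → (b :* (c :* p)) := (c :* (b :* p))) refl b (f (c (suc i))) (b ^ toℕ i)) ⟩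
    sum (λ i → f (c (suc i)) * b ^ suc (toℕ i))        ∎)

module Roots (R : CommutativeRing c ℓ) (domain : RingNotions.IsDomain R) where
  open CommutativeRingTheory R
  open Polynomial R
  open PolynomialTheory R
  open SetoidReasoning setoid
  private
    module E b = Evaluation {R = R} {S = R} (Identity.isRingHomomorphism rawRing refl) b
  open E public using (eval; eval-monomial; eval-tabulate)

  *-≉0 : ∀ {x y} → x ≉ 0# → y ≉ 0# → x * y ≉ 0#
  *-≉0 x≉0 y≉0 e with proj₂ domain _ _ e
  ... | inj₁ x≈0 = x≉0 x≈0
  ... | inj₂ y≈0 = y≉0 y≈0

  ^-≉0 : ∀ {x} n → x ≉ 0# → x ^ n ≉ 0#
  ^-≉0 zero    x≉0 = proj₁ domain
  ^-≉0 (suc n) x≉0 = *-≉0 x≉0 (^-≉0 n x≉0)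

  cancel : ∀ {x y} → x ≉ 0# → x * y ≈ 0# → y ≈ 0#
  cancel x≉0 e with proj₂ domain _ _ e
  ... | inj₁ x≈0 = ⊥-elim (x≉0 x≈0)
  ... | inj₂ y≈0 = y≈0

  cancel-≈ : ∀ {x y z} → x ≉ 0# → x * y ≈ x * z → y ≈ z
  cancel-≈ {x} {y} {z} x≉0 e = x-y≈0⇒x≈y (cancel x≉0
    (trans (solve 3 (λ x y z → (x :* (y :- z)) := (x :* y :- x :* z)) refl x y z) (x≈y⇒x-y≈0 e)))

  -- (f(X) - f(a)) / (X - a) for f = y ∷ p
  private
    slope : Carrier → Poly → Poly
    slope a []      = []
    slope a (y ∷ p) = eval a (y ∷ p) ∷ slope a p

    slope-length : ∀ a p → length (slope a p) ≡ length p
    slope-length a []      = ≡.refl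
    slope-length a (y ∷ p) = ≡.cong suc (slope-length a p)

    slope-eval : ∀ a x p → x * eval x p - a * eval a p ≈ (x - a) * eval x (slope a p)
    slope-eval a x []      = begin
      x * 0# - a * 0#  ≈⟨ +-cong (zeroʳ x) (-‿cong (zeroʳ a)) ⟩
      0# - 0#          ≈⟨ -‿inverseʳ 0# ⟩
      0#               ≈⟨ zeroʳ (x - a) ⟨
      (x - a) * 0#     ∎
    slope-eval a x (y ∷ p) = begin
      x * (y + x * X) - a * (y + a * A)
        ≈⟨ solve 5 (λ x a y X A → (x :* (y :+ x :* X) :- a :* (y :+ a :* A))
             := ((x :- a) :* (y :+ a :* A) :+ x :* (x :* X :- a :* A))) refl x a y X A ⟩
      (x - a) * (y + a * A) + x * (x * X - a * A)
        ≈⟨ +-congˡ (*-congˡ (slope-eval a x p)) ⟩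
      (x - a) * (y + a * A) + x * ((x - a) * eval x (slope a p))
        ≈⟨ solve 4 (λ d b x s → (d :* b :+ x :* (d :* s)) := (d :* (b :+ x :* s))) refl _ _ _ _ ⟩
      (x - a) * ((y + a * A) + x * eval x (slope a p)) ∎
      where
      X A : Carrier
      X = eval x p
      A = eval a p

    slope-≈0 : ∀ a p → slope a p ≈ₚ [] → p ≈ₚ []
    slope-≈0 a []      e = reflₚ
    slope-≈0 a (y ∷ p) e = ∷-zero (trans (sym (trans (+-congˡ (trans (*-congˡ (E.eval-≈0 a p p≈0)) (zeroʳ a)))
        (+-identityʳ y))) (at e 0)) p≈0
      where
      p≈0 : p ≈ₚ []
      p≈0 = slope-≈0 a p (coeffwise (at e ∘ suc))

  -- Induction on the list length, not on the degree: for f = y ∷ p the quotient (f(X) - f(a)) / (X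
  -- - a) is `slope a p`, one entry shorter, and it vanishes at the remaining points because x - a
  -- can be cancelled there. If it is zero then so is p, and y is the value at a.
  too-many-roots⇒≈0 : ∀ n p → length p ≤ n → (x : Fin n → Carrier) → (∀ i j → i ≢ j → x i ≉ x j) →
                      (∀ i → eval (x i) p ≈ 0#) → p ≈ₚ []
  too-many-roots⇒≈0 n       []      _       x distinct roots = reflₚ
  too-many-roots⇒≈0 (suc n) (y ∷ p) (s≤s l) x distinct roots = ∷-zero
    (trans (sym (trans (+-congˡ (trans (*-congˡ (E.eval-≈0 a p p≈0)) (zeroʳ a))) (+-identityʳ y))) (roots zero)) p≈0
    where
    a : Carrier
    a = x zero
    p≈0 : p ≈ₚ []
    p≈0 = slope-≈0 a p (too-many-roots⇒≈0 n (slope a p) (≡.subst (_≤ n) (≡.sym (slope-length a p)) l) (x ∘ suc)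
      (λ i j i≢j → distinct (suc i) (suc j) (i≢j ∘ Fin.suc-injective))
      λ i → cancel (λ e → distinct (suc i) zero (λ ()) (x-y≈0⇒x≈y e)) (begin
        (x (suc i) - a) * eval (x (suc i)) (slope a p)        ≈⟨ slope-eval a (x (suc i)) p ⟨
        x (suc i) * eval (x (suc i)) p - a * eval a p
          ≈⟨ solve 3 (λ y u v → (u :- v) := ((y :+ u) :- (y :+ v))) refl y _ _ ⟩
        eval (x (suc i)) (y ∷ p) - eval a (y ∷ p)              ≈⟨ +-cong (roots (suc i)) (-‿cong (roots zero)) ⟩
        0# - 0#                                                ≈⟨ -‿inverseʳ 0# ⟩
        0#                                                     ∎))

  power-roots : ∀ n → 1 ≤ n → ∀ a (x : Fin (suc n) → Carrier) → (∀ i j → i ≢ j → x i ≉ x j) →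
                ¬ (∀ i → x i ^ n ≈ a)
  power-roots (suc n) _ a x distinct roots = proj₁ domain (trans (sym (coeff-monomial n)) (at p≈0 (suc n)))
    where
    p≈0 : ((0# - a) ∷ monomial n) ≈ₚ []
    p≈0 = too-many-roots⇒≈0 (suc (suc n)) _ (ℕ.≤-reflexive (≡.cong suc (length-monomial n))) x distinct λ i → begin
      (0# - a) + x i * eval (x i) (monomial n)  ≈⟨ +-congˡ (*-congˡ (eval-monomial (x i) n)) ⟩
      (0# - a) + x i ^ suc n                    ≈⟨ +-cong (+-identityˡ _) (roots i) ⟩
      - a + a                                   ≈⟨ -‿inverseˡ a ⟩
      0#                                        ∎

-- Finite fields

module Powers (R : CommutativeRing c ℓ) where
  open CommutativeRingTheory R
  open SetoidReasoning setoid

  ^-*-≈1 : ∀ {x} a k → x ^ a ≈ 1# → x ^ (k ℕ.* a) ≈ 1#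
  ^-*-≈1 {x} a k e = begin
    x ^ (k ℕ.* a)  ≈⟨ ^-congʳ x (ℕ.*-comm k a) ⟩
    x ^ (a ℕ.* k)  ≈⟨ ^-assocʳ x a k ⟨
    (x ^ a) ^ k    ≈⟨ ^-congˡ k e ⟩
    1# ^ k         ≈⟨ 1^n≈1 k ⟩
    1#             ∎

  private
    bézout-power : ∀ {x} a b k m → x ^ a ≈ 1# → x ^ b ≈ 1# → 1 ℕ.+ k ℕ.* a ≡ m ℕ.* b → x ≈ 1#
    bézout-power {x} a b k m ea eb eq = begin
      x                   ≈⟨ *-identityʳ x ⟨
      x * 1#              ≈⟨ *-congˡ (^-*-≈1 a k ea) ⟨
      x * x ^ (k ℕ.* a)   ≈⟨ ^-congʳ x eq ⟩
      x ^ (m ℕ.* b)       ≈⟨ ^-*-≈1 b m eb ⟩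
      1#                  ∎

    ^-% : ∀ {x} n i .{{_ : ℕ.NonZero n}} → x ^ n ≈ 1# → x ^ i ≈ x ^ (i % n)
    ^-% {x} n i e = begin
      x ^ i                                ≈⟨ ^-congʳ x (m≡m%n+[m/n]*n i n) ⟩
      x ^ (i % n ℕ.+ i / n ℕ.* n)          ≈⟨ ^-homo-* x (i % n) (i / n ℕ.* n) ⟩
      x ^ (i % n) * x ^ (i / n ℕ.* n)      ≈⟨ *-congˡ (^-*-≈1 n (i / n) e) ⟩
      x ^ (i % n) * 1#                     ≈⟨ *-identityʳ _ ⟩
      x ^ (i % n)                          ∎

  -- If n does not divide i, then n and i mod n are coprime, and a Bezout combination of these two
  -- exponents, both of which send x to 1, leaves x itself. The two orientations of the Bezout
  -- identity avoid negative exponents, so x need not be known to be invertible.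
  prime-order : ∀ {x n} i → Prime n → x ^ n ≈ 1# → x ^ i ≈ 1# → n ℕ∣.∣ i ⊎ x ≈ 1#
  prime-order {x} {n} i n-prime en ei = cases (i % n) ≡.refl
    where
    instance _ = prime⇒nonZero n-prime
    cases : ∀ r → i % n ≡ r → n ℕ∣.∣ i ⊎ x ≈ 1#
    cases zero    e = inj₁ (m%n≡0⇒n∣m i n e)
    cases (suc r) e with coprime-Bézout (prime⇒coprime n-prime {{ℕ.nonZero {r}}} (≡.subst (_< n) e (m%n<n i n)))
    ... | Bézout.+- k m eq = inj₂ (bézout-power (suc r) n m k er en eq)
      where
      er : x ^ suc r ≈ 1#
      er = trans (^-congʳ x (≡.sym e)) (trans (sym (^-% n i en)) ei)
    ... | Bézout.-+ k m eq = inj₂ (bézout-power n (suc r) k m en er eq)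
      where
      er : x ^ suc r ≈ 1#
      er = trans (^-congʳ x (≡.sym e)) (trans (sym (^-% n i en)) ei)

  -- The two extreme terms are split off so that the remaining sum contains exactly the terms whose
  -- coefficients vanish when the exponent is the order of a finite field.
  binomial-expansion : ∀ m x y → (x + y) ^ suc m ≈
    y ^ suc m + (sum {m} (λ j → (suc m C suc (toℕ j)) ℕ× (x ^ suc (toℕ j) * y ^ (suc m ℕ.∸ suc (toℕ j)))) + x ^ suc m)
  binomial-expansion m x y = trans (B.theorem (suc m) x y) (+-cong first (trans (sum-init-last {m} (t ∘ suc))
    (+-cong (sum-cong _ _ middle) last)))
    where
    module B = Binomial commutativeSemiring
    t : Fin (suc (suc m)) → Carrier
    t = B.binomialTerm x y (suc m)
    term : ℕ → Carrier
    term k = (suc m C k) ℕ× (x ^ k * y ^ (suc m ℕ.∸ k))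
    first : t zero ≈ y ^ suc m
    first = trans (+-identityʳ _) (*-identityˡ _)
    middle : ∀ j → t (suc (inject₁ j)) ≈ term (suc (toℕ j))
    middle j = reflexive (≡.cong (term ∘ suc) (Fin.toℕ-inject₁ j))
    last : t (suc (fromℕ m)) ≈ x ^ suc m
    last = begin
      term (suc (toℕ (fromℕ m)))          ≈⟨ reflexive (≡.cong (term ∘ suc) (Fin.toℕ-fromℕ m)) ⟩
      (suc m C suc m) ℕ× (x ^ suc m * y ^ (m ℕ.∸ m))
        ≈⟨ reflexive (≡.cong₂ (λ k e → k ℕ× (x ^ suc m * y ^ e)) (nCn≡1 (suc m)) (ℕ.n∸n≡0 m)) ⟩
      1 ℕ× (x ^ suc m * 1#)                ≈⟨ trans (+-identityʳ _) (*-identityʳ _) ⟩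
      x ^ suc m                            ∎

-- This is e (1 + q + ... + q^(m-1)), which equals (q^m - 1) / n when q = e n + 1.
geometric : ℕ → ℕ → ℕ → ℕ
geometric q e zero    = 0
geometric q e (suc m) = e ℕ.+ q ℕ.* geometric q e m

geometric-spec : ∀ {q} e n → q ≡ suc (e ℕ.* n) → ∀ m → q ℕ.^ m ≡ suc (geometric q e m ℕ.* n)
geometric-spec e n eq zero    = ≡.refl
geometric-spec {q} e n eq (suc m) = begin
  q ℕ.* q ℕ.^ m                    ≡⟨ ≡.cong (q ℕ.*_) (geometric-spec e n eq m) ⟩
  q ℕ.* suc (g ℕ.* n)              ≡⟨ ℕ.*-suc q (g ℕ.* n) ⟩
  q ℕ.+ q ℕ.* (g ℕ.* n)            ≡⟨ ≡.cong₂ ℕ._+_ eq (≡.sym (ℕ.*-assoc q g n)) ⟩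
  suc (e ℕ.* n ℕ.+ q ℕ.* g ℕ.* n)  ≡⟨ ≡.cong suc (ℕ.*-distribʳ-+ n e (q ℕ.* g)) ⟨
  suc ((e ℕ.+ q ℕ.* g) ℕ.* n)      ∎
  where
  open ≡.≡-Reasoning
  g : ℕ
  g = geometric q e m

module FiniteFieldTheory (F : FiniteField) where
  open FiniteField F
  open CommutativeRingTheory (FiniteField.ring F) hiding (ring)
  open Roots (FiniteField.ring F) isDomain
  open Polynomial (FiniteField.ring F)
  open PolynomialTheory (FiniteField.ring F)
  open Powers (FiniteField.ring F)
  open SetoidReasoning setoid
  open Inverse cardinality using (from; to; to-cong; strictlyInverseˡ; strictlyInverseʳ)

  private
    from-distinct : ∀ i j → i ≢ j → from i ≉ from j
    from-distinct i j i≢j e = i≢j (≡.trans (≡.sym (strictlyInverseˡ i)) (≡.trans (to-cong e) (strictlyInverseˡ j)))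

    small-vanishing⇒≈0 : ∀ p → length p ≤ order → (∀ x → eval x p ≈ 0#) → p ≈ₚ []
    small-vanishing⇒≈0 p l e = too-many-roots⇒≈0 order p l from from-distinct (e ∘ from)

  inverse : ∀ {x} → x ≉ 0# → ∃[ y ] y * x ≈ 1#
  inverse x≉0 with proj₂ isField _ x≉0
  ... | y , e , _ = y , e

  -- Otherwise X^n - X would be a nonzero polynomial vanishing on more than n elements. The bound n
  -- ≥ 2 keeps the two monomials at different indices.
  exponent-bound : ∀ n → 2 ≤ n → (∀ x → x ^ n ≈ x) → order ≤ n
  exponent-bound (suc zero) (s≤s ())
  exponent-bound (suc (suc n)) _ e with order ℕ.≤? suc (suc n)
  ... | yes l = l
  ... | no ¬l = ⊥-elim (proj₁ isDomain (trans (sym (coeff-monomial n)) (at p≈0 (suc (suc n)))))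
    where
    p≈0 : (0# ∷ - 1# ∷ monomial n) ≈ₚ []
    p≈0 = small-vanishing⇒≈0 _ (≡.subst (λ k → suc (suc k) ≤ order) (≡.sym (length-monomial n)) (ℕ.≰⇒> ¬l)) λ x → begin
      0# + x * (- 1# + x * eval x (monomial n))  ≈⟨ +-congˡ (*-congˡ (+-congˡ (*-congˡ (eval-monomial x n)))) ⟩
      0# + x * (- 1# + x * x ^ n)
        ≈⟨ +-congˡ (trans (distribˡ x _ _) (+-congʳ (trans (*-comm x _) (-1*x≈-x x)))) ⟩
      0# + (- x + x ^ suc (suc n))               ≈⟨ trans (+-identityˡ _) (+-congˡ (e x)) ⟩
      - x + x                                    ≈⟨ -‿inverseˡ x ⟩
      0#                                         ∎

  module _ where
    open MonoidSummation *-commutativeMonoid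
      renaming (sum to product; sum-permute to product-permute; sum-remove to product-remove;
                sum-replicate to product-replicate; sum-cong-≋ to product-cong; ∑-distrib-+ to product-distrib-*)
      using ()

    private
      product-≉0 : ∀ {n} (f : Fin n → Carrier) → (∀ i → f i ≉ 0#) → product f ≉ 0#
      product-≉0 {zero}  f f≉0 = proj₁ isDomain
      product-≉0 {suc n} f f≉0 = *-≉0 (f≉0 zero) (product-≉0 (f ∘ suc) (f≉0 ∘ suc))

      -- Lets a product over the nonzero elements run over the whole enumeration, with a neutral
      -- factor at zero.
      if-zero : Carrier → Carrier → Carrier → Carrier
      if-zero y a b with y ≟ 0#
      ... | yes _ = a
      ... | no _  = b

      -- Multiplication by x permutes the nonzero elements, so their product is multiplied by x^n and unchanged.
      fermat-units : ∀ {n} → HasCardinality (suc n) → ∀ {x} → x ≉ 0# → x ^ n ≈ 1#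
      fermat-units {n} I {x} x≉0 = sym (cancel-≈ (product-≉0 h h≉0) (begin
        product h * 1#             ≈⟨ *-identityʳ _ ⟩
        product h                  ≈⟨ product-permute h π ⟩
        product (h ∘ (π ⟨$⟩ʳ_))    ≈⟨ product-cong h-π ⟩
        product (λ i → k i * h i)  ≈⟨ product-distrib-* k h ⟩
        product k * product h      ≈⟨ *-comm _ _ ⟩
        product h * product k      ≈⟨ *-congˡ product-k ⟩
        product h * x ^ n          ∎))
        where
        module I = Inverse I
        x⁻¹ : Carrier
        x⁻¹ = proj₁ (inverse x≉0)
        cancels : ∀ y → x⁻¹ * (x * y) ≈ y
        cancels y = trans (sym (*-assoc _ _ _)) (trans (*-congʳ (proj₂ (inverse x≉0))) (*-identityˡ y))
        cancels′ : ∀ y → x * (x⁻¹ * y) ≈ y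
        cancels′ y = trans (solve 3 (λ x z y → (x :* (z :* y)) := (z :* (x :* y))) refl x x⁻¹ y) (cancels y)
        π : Permutation (suc n) (suc n)
        π = permutation (λ i → I.to (x * I.from i)) (λ i → I.to (x⁻¹ * I.from i))
          (λ i → ≡.trans (I.to-cong (trans (*-congˡ (I.strictlyInverseʳ _)) (cancels′ _))) (I.strictlyInverseˡ i))
          (λ i → ≡.trans (I.to-cong (trans (*-congˡ (I.strictlyInverseʳ _)) (cancels _))) (I.strictlyInverseˡ i))
        h k : Fin (suc n) → Carrier
        h i = if-zero (I.from i) 1# (I.from i)
        k i = if-zero (I.from i) 1# x
        h≉0 : ∀ i → h i ≉ 0#
        h≉0 i with I.from i ≟ 0#
        ... | yes _  = proj₁ isDomain
        ... | no ≉0 = ≉0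
        h-π : ∀ i → h (π ⟨$⟩ʳ i) ≈ k i * h i
        h-π i with I.from (π ⟨$⟩ʳ i) ≟ 0# | I.from i ≟ 0#
        ... | yes _ | yes _ = sym (*-identityˡ 1#)
        ... | yes e | no ≉0 = ⊥-elim (*-≉0 x≉0 ≉0 (trans (sym (I.strictlyInverseʳ _)) e))
        ... | no ≉0 | yes e = ⊥-elim (≉0 (trans (I.strictlyInverseʳ _) (trans (*-congˡ e) (zeroʳ x))))
        ... | no _  | no _  = I.strictlyInverseʳ _
        i₀ : Fin (suc n)
        i₀ = I.to 0#
        k-i₀ : k i₀ ≈ 1#
        k-i₀ with I.from i₀ ≟ 0#
        ... | yes _ = refl
        ... | no ≉0 = ⊥-elim (≉0 (I.strictlyInverseʳ 0#))
        k-other : ∀ j → k (punchIn i₀ j) ≈ x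
        k-other j with I.from (punchIn i₀ j) ≟ 0#
        ... | no _  = refl
        ... | yes e = ⊥-elim (Fin.punchInᵢ≢i i₀ j (≡.trans (≡.sym (I.strictlyInverseˡ _)) (I.to-cong e)))
        product-k : product k ≈ x ^ n
        product-k = begin
          product k                            ≈⟨ product-remove {n} {i₀} k ⟩
          k i₀ * product (k ∘ punchIn i₀)      ≈⟨ *-cong k-i₀ (product-cong k-other) ⟩
          1# * product {n} (λ _ → x)           ≈⟨ *-identityˡ _ ⟩
          product {n} (λ _ → x)                ≈⟨ product-replicate n ⟩
          x ^ n                                ∎

      fermat′ : ∀ {n} → HasCardinality n → ∀ x → x ^ n ≈ x
      fermat′ {zero}  I x with () ← Inverse.to I x
      fermat′ {suc n} I x with x ≟ 0#
      ... | yes e = trans (*-congʳ e) (trans (zeroˡ _) (sym e))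
      ... | no ≉0 = trans (*-congˡ (fermat-units I ≉0)) (*-identityʳ x)

    fermat : ∀ x → x ^ order ≈ x
    fermat = fermat′ cardinality

  fermat-iterated : ∀ m x → x ^ (order ℕ.^ m) ≈ x
  fermat-iterated zero    x = *-identityʳ x
  fermat-iterated (suc m) x = begin
    x ^ (order ℕ.* order ℕ.^ m)     ≈⟨ ^-assocʳ x order (order ℕ.^ m) ⟨
    (x ^ order) ^ (order ℕ.^ m)     ≈⟨ ^-congˡ (order ℕ.^ m) (fermat x) ⟩
    x ^ (order ℕ.^ m)               ≈⟨ fermat-iterated m x ⟩
    x                               ∎

  -- Adding 1 permutes the field, so the sum of all elements is unchanged although it grows by q
  -- times 1.
  order×1≈0 : order ℕ× 1# ≈ 0#
  order×1≈0 = begin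
    order ℕ× 1#                ≈⟨ solve 2 (λ n s → n := ((s :+ n) :- s)) refl _ (sum from) ⟩
    (sum from + order ℕ× 1#) - sum from   ≈⟨ +-congʳ shifted ⟨
    sum from - sum from        ≈⟨ -‿inverseʳ _ ⟩
    0#                         ∎
    where
    π : Permutation order order
    π = permutation (λ i → to (from i + 1#)) (λ i → to (from i - 1#))
      (λ i → ≡.trans (to-cong (trans (+-congʳ (strictlyInverseʳ _)) (solve 2 (λ a b → ((a :- b) :+ b) := a) refl _ _))) (strictlyInverseˡ i))
      (λ i → ≡.trans (to-cong (trans (+-congʳ (strictlyInverseʳ _)) (solve 2 (λ a b → ((a :+ b) :- b) := a) refl _ _))) (strictlyInverseˡ i))
    shifted : sum from ≈ sum from + order ℕ× 1#
    shifted = begin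
      sum from                          ≈⟨ sum-permute from π ⟩
      sum (from ∘ (π ⟨$⟩ʳ_))            ≈⟨ sum-cong _ _ (λ i → strictlyInverseʳ (from i + 1#)) ⟩
      sum (λ i → from i + 1#)           ≈⟨ ∑-distrib-+ from (λ _ → 1#) ⟩
      sum from + sum {order} (λ _ → 1#) ≈⟨ +-congˡ (Summation.sum-replicate semiring order) ⟩
      sum from + order ℕ× 1#            ∎

  2≤order : 2 ≤ order
  2≤order = go cardinality
    where
    go : ∀ {n} → HasCardinality n → 2 ≤ n
    go {zero}        I with () ← Inverse.to I 0#
    go {suc zero}    I = ⊥-elim (proj₁ isDomain (trans (sym (Inverse.strictlyInverseʳ I 1#)) (trans
      (Inverse.from-cong I (single (Inverse.to I 1#) (Inverse.to I 0#))) (Inverse.strictlyInverseʳ I 0#))))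
      where
      single : ∀ (i j : Fin 1) → i ≡ j
      single zero zero = ≡.refl
    go {suc (suc n)} I = s≤s (s≤s z≤n)

  -- If x^e = 1 held for every nonzero x, then x^(e+1) = x would hold on the whole field, against
  -- `exponent-bound`.
  exists-≉1 : ∀ e → 1 ≤ e → suc e < order → ∃[ x ] x ≉ 0# × x ^ e ≉ 1#
  exists-≉1 e 1≤e small with finite-search cardinality (λ x → x ≉ 0# × x ^ e ≉ 1#)
    (λ x≈y (x≉0 , xᵉ≉1) → (λ y≈0 → x≉0 (trans x≈y y≈0)) , (λ yᵉ≈1 → xᵉ≉1 (trans (^-congˡ e x≈y) yᵉ≈1)))
    (λ x → ¬? (x ≟ 0#) ×-dec ¬? (x ^ e ≟ 1#))
  ... | inj₁ found = found
  ... | inj₂ none  = ⊥-elim (ℕ.<⇒≱ small (exponent-bound (suc e) (s≤s 1≤e) identity))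
    where
    identity : ∀ x → x ^ suc e ≈ x
    identity x with x ≟ 0#
    ... | yes x≈0 = trans (*-congʳ x≈0) (trans (zeroˡ _) (sym x≈0))
    ... | no x≉0  = trans (*-congˡ (decidable-stable (x ^ e ≟ 1#) (λ xᵉ≉1 → none x (x≉0 , xᵉ≉1)))) (*-identityʳ x)

  power-≈1 : ∀ {x n} → order ≡ suc n → x ≉ 0# → x ^ n ≈ 1#
  power-≈1 {x} {n} eq x≉0 = cancel-≈ x≉0 (trans (^-congʳ x (≡.sym eq)) (trans (fermat x) (sym (*-identityʳ x))))

  -- (1 + X)^q - 1 - X^q vanishes on the field and has degree less than q, so its coefficients vanish.
  binomial-coefficient≈0 : ∀ m → order ≡ suc m → ∀ (j : Fin m) → (suc m C suc (toℕ j)) ℕ× 1# ≈ 0#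
  binomial-coefficient≈0 m eq j = trans (sym (coeff-tabulate b j)) (at p≈0 (suc (toℕ j)))
    where
    b : Fin m → Carrier
    b i = (suc m C suc (toℕ i)) ℕ× 1#
    p≈0 : (0# ∷ List.tabulate b) ≈ₚ []
    p≈0 = small-vanishing⇒≈0 _ (ℕ.≤-reflexive (≡.trans (≡.cong suc (length-tabulate b)) (≡.sym eq))) λ x →
      trans (value x) (vanishes x)
      where
      S : Carrier → Carrier
      S x = sum {m} (λ i → (suc m C suc (toℕ i)) ℕ× (x ^ suc (toℕ i) * 1# ^ (suc m ℕ.∸ suc (toℕ i))))
      value : ∀ x → eval x (0# ∷ List.tabulate b) ≈ S x
      value x = begin
        0# + x * eval x (List.tabulate b)      ≈⟨ +-identityˡ _ ⟩
        x * eval x (List.tabulate b)           ≈⟨ *-congˡ (eval-tabulate x b) ⟩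
        x * sum (λ i → b i * x ^ toℕ i)        ≈⟨ *-distribˡ-sum x (λ i → b i * x ^ toℕ i) ⟩
        sum (λ i → x * (b i * x ^ toℕ i))      ≈⟨ sum-cong _ _ (λ i → trans
          (solve 3 (λ x b p → (x :* (b :* p)) := (b :* (x :* p))) refl x (b i) (x ^ toℕ i))
          (trans (×-assoc-* (suc m C suc (toℕ i)) 1# _)
            (ℕ×-congʳ (suc m C suc (toℕ i)) (trans (*-comm _ _) (*-congˡ (sym (1^n≈1 (suc m ℕ.∸ suc (toℕ i))))))))) ⟩
        S x                                    ∎
      frobenius : ∀ y → y ^ suc m ≈ y
      frobenius y = trans (^-congʳ y (≡.sym eq)) (fermat y)
      vanishes : ∀ x → S x ≈ 0#
      vanishes x = begin
        S x                          ≈⟨ solve 3 (λ s y x → s := ((y :+ (s :+ x)) :- (x :+ y))) refl (S x) 1# x ⟩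
        (1# + (S x + x)) - (x + 1#)
          ≈⟨ +-congʳ (+-cong (frobenius 1#) (+-congˡ (frobenius x))) ⟨
        (1# ^ suc m + (S x + x ^ suc m)) - (x + 1#)  ≈⟨ +-congʳ (binomial-expansion m x 1#) ⟨
        (x + 1#) ^ suc m - (x + 1#)  ≈⟨ x≈y⇒x-y≈0 (frobenius (x + 1#)) ⟩
        0#                           ∎

  module _ {S : CommutativeRing c ℓ} {f : Carrier → CommutativeRing.Carrier S}
    (f-hom : RingMorphisms.IsRingHomomorphism rawRing (CommutativeRing.rawRing S) f) where
    private
      module S = CommutativeRingTheory S
      module f = Homomorphism {R = FiniteField.ring F} {S = S} f-hom

    -- The middle binomial coefficients vanish already in the field, hence in every algebra over it;
    -- the Kummer ring over a residue field is such an algebra.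
    frobenius-+ : ∀ x y → (x S.+ y) S.^ order S.≈ x S.^ order S.+ y S.^ order
    frobenius-+ x y = go order ≡.refl
      where
      go : ∀ n → order ≡ n → (x S.+ y) S.^ n S.≈ x S.^ n S.+ y S.^ n
      go zero    eq with () ← ℕ.≤-trans 2≤order (ℕ.≤-reflexive eq)
      go (suc m) eq = S.trans (Powers.binomial-expansion S m x y) (S.trans
        (S.+-congˡ (S.trans (S.+-congʳ (S.sum-0 _ λ j → S.trans (S.sym (kill j)) (S.zeroˡ _))) (S.+-identityˡ _)))
        (S.+-comm _ _))
        where
        kill : ∀ j → S.0# S.* _ S.≈ _
        kill j = S.trans (S.*-congʳ (S.trans (S.sym f.0#-homo) (S.trans
            (f.cong (sym (binomial-coefficient≈0 m eq j)))
            (S.trans (f.×-homo (suc m C suc (toℕ j)) 1#) (S.ℕ×-congʳ (suc m C suc (toℕ j)) f.1#-homo)))))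
          (S.trans (S.×-assoc-* (suc m C suc (toℕ j)) S.1# _) (S.ℕ×-congʳ (suc m C suc (toℕ j)) (S.*-identityˡ _)))

  -- Used for two purposes: x^e is a primitive n-th root of unity, and x is not an n-th power. Such
  -- x exists because n ≥ 2 gives e + 1 < q.
  primitive-root : ∀ n e → Prime n → order ≡ suc (e ℕ.* n) → ∃[ x ] x ≉ 0# × x ^ e ≉ 1#
  primitive-root n zero    n-prime eq = ⊥-elim (ℕ.<⇒≱ (ℕ.n<1+n 1) (ℕ.≤-trans 2≤order (ℕ.≤-reflexive eq)))
  primitive-root n (suc e) n-prime eq = exists-≉1 (suc e) (s≤s z≤n) (≡.subst (suc (suc e) <_) (≡.sym eq)
    (s≤s (ℕ.m<m*n (suc e) n (ℕ.nonTrivial⇒n>1 n {{prime⇒nonTrivial n-prime}}))))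

  private
    -- By Fermat a factor q in the exponent has no effect, so 1 + q + ... + q^(m-1) acts like m.
    geometric-power : ∀ e x m → x ^ geometric order e m ≈ (x ^ e) ^ m
    geometric-power e x zero    = refl
    geometric-power e x (suc m) = begin
      x ^ (e ℕ.+ order ℕ.* geometric order e m)            ≈⟨ ^-homo-* x e _ ⟩
      x ^ e * x ^ (order ℕ.* geometric order e m)          ≈⟨ *-congˡ (^-assocʳ x order (geometric order e m)) ⟨
      x ^ e * (x ^ order) ^ geometric order e m            ≈⟨ *-congˡ (^-congˡ (geometric order e m) (fermat x)) ⟩
      x ^ e * x ^ geometric order e m                      ≈⟨ *-congˡ (geometric-power e x m) ⟩
      x ^ e * (x ^ e) ^ m                            ∎

  -- Counting roots gives n l = m d for some m. Then x^e′ is the m-th power of the nontrivial l-th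
  -- root of unity x^e, so l divides m and d divides n.
  descend-exponent : ∀ {q n d l e e′ x} → 2 ≤ q → 1 ≤ d → order ≡ q ℕ.^ d → Prime l →
    order ≡ suc (e ℕ.* l) → q ℕ.^ (n ℕ.* l) ≡ suc (e′ ℕ.* l) →
    x ≉ 0# → x ^ e ≉ 1# → x ^ e′ ≈ 1# →
    (∀ y → y ^ (q ℕ.^ (n ℕ.* l)) ≈ y) → ∀ y → y ^ (q ℕ.^ n) ≈ y
  descend-exponent {q} {n} {d} {l} {e} {e′} {x} 2≤q 1≤d ord l-prime eq eq′ x≉0 xᵉ≉1 xᵉ′≈1 fixed y =
    conclude (prime-order m l-prime ηˡ≈1 ηᵐ≈1)
    where
    instance
      _ = ℕ.>-nonZero 1≤d
      _ = prime⇒nonZero l-prime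
    m s : ℕ
    m = (n ℕ.* l) / d
    s = (n ℕ.* l) % d
    iterated : ∀ k y → y ^ (q ℕ.^ (k ℕ.* d)) ≈ y
    iterated k y = trans (^-congʳ y (≡.trans (≡.cong (q ℕ.^_) (ℕ.*-comm k d))
      (≡.trans (≡.sym (ℕ.^-*-assoc q d k)) (≡.cong (ℕ._^ k) (≡.sym ord))))) (fermat-iterated k y)
    residual : ∀ y → y ^ (q ℕ.^ s) ≈ y
    residual y = begin
      y ^ (q ℕ.^ s)                          ≈⟨ iterated m _ ⟨
      (y ^ (q ℕ.^ s)) ^ (q ℕ.^ (m ℕ.* d))    ≈⟨ ^-assocʳ y (q ℕ.^ s) (q ℕ.^ (m ℕ.* d)) ⟩
      y ^ (q ℕ.^ s ℕ.* q ℕ.^ (m ℕ.* d))      ≈⟨ ^-congʳ y (≡.trans (≡.sym (ℕ.^-distribˡ-+-* q s (m ℕ.* d)))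
                                                   (≡.cong (q ℕ.^_) (≡.sym (m≡m%n+[m/n]*n (n ℕ.* l) d)))) ⟩
      y ^ (q ℕ.^ (n ℕ.* l))                  ≈⟨ fixed y ⟩
      y                                      ∎
    -- If s were positive, y^(q^s) = y would be an identity on the field with exponent at least 2
    -- and smaller than the order q^d, which `exponent-bound` excludes.
    s≡0 : s ≡ 0
    s≡0 = go s ≡.refl
      where
      go : ∀ k → s ≡ k → s ≡ 0
      go zero    e = e
      go (suc k) e = ⊥-elim (ℕ.<⇒≱
        (≡.subst (q ℕ.^ s <_) (≡.sym ord) (ℕ.^-monoʳ-< q 2≤q (m%n<n (n ℕ.* l) d)))
        (exponent-bound (q ℕ.^ s) (ℕ.≤-trans 2≤q (ℕ.≤-trans (ℕ.≤-reflexive (≡.sym (ℕ.*-identityʳ q)))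
          (ℕ.^-monoʳ-≤ q {{ℕ.>-nonZero (ℕ.<-trans (s≤s z≤n) 2≤q)}} (≡.subst (1 ≤_) (≡.sym e) (s≤s z≤n))))) residual))
    nl≡md : n ℕ.* l ≡ m ℕ.* d
    nl≡md = ≡.trans (m≡m%n+[m/n]*n (n ℕ.* l) d) (≡.cong (ℕ._+ m ℕ.* d) s≡0)
    -- Both numbers are (q^(n l) - 1) / l, because q^(n l) = (q^d)^m.
    e′≡ : e′ ≡ geometric order e m
    e′≡ = ℕ.*-cancelʳ-≡ e′ (geometric order e m) l (ℕ.suc-injective (≡.trans (≡.sym eq′) (≡.trans
      (≡.cong (q ℕ.^_) (≡.trans nl≡md (ℕ.*-comm m d))) (≡.trans (≡.sym (ℕ.^-*-assoc q d m))
      (≡.trans (≡.cong (ℕ._^ m) (≡.sym ord)) (geometric-spec e l eq m))))))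
    ηᵐ≈1 : (x ^ e) ^ m ≈ 1#
    ηᵐ≈1 = trans (sym (geometric-power e x m)) (trans (^-congʳ x (≡.sym e′≡)) xᵉ′≈1)
    ηˡ≈1 : (x ^ e) ^ l ≈ 1#
    ηˡ≈1 = trans (^-assocʳ x e l) (power-≈1 eq x≉0)
    conclude : l ℕ∣.∣ m ⊎ x ^ e ≈ 1# → y ^ (q ℕ.^ n) ≈ y
    conclude (inj₂ e)               = ⊥-elim (xᵉ≉1 e)
    conclude (inj₁ (divides k m≡kl)) = trans (^-congʳ y (≡.cong (q ℕ.^_) n≡kd)) (iterated k y)
      where
      n≡kd : n ≡ k ℕ.* d
      n≡kd = ℕ.*-cancelʳ-≡ n (k ℕ.* d) l (≡.trans nl≡md (≡.trans (≡.cong (ℕ._* d) m≡kl) (≡.trans (ℕ.*-assoc k l d)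
        (≡.trans (≡.cong (k ℕ.*_) (ℕ.*-comm l d)) (≡.sym (ℕ.*-assoc k d l))))))

-- Kummer rings

module RootsOfUnity (R : CommutativeRing c ℓ) (domain : RingNotions.IsDomain R) where
  open CommutativeRingTheory R
  open Roots R domain
  open Powers R
  open SetoidReasoning setoid

  root≉0 : ∀ {n z} → Prime n → z ^ n ≈ 1# → z ≉ 0#
  root≉0 {n} n-prime e z≈0 = proj₁ domain (trans (sym e) (trans (^-congˡ n z≈0)
    (0^n≈0 n (ℕ.>-nonZero⁻¹ n {{prime⇒nonZero n-prime}}))))

  private
    distinct-< : ∀ {n z} → Prime n → z ^ n ≈ 1# → z ≉ 1# → ∀ {i j} → i < j → j < n → z ^ i ≉ z ^ j
    distinct-< {n} {z} n-prime e z≉1 {i} {j} i<j j<n eq = conclude (prime-order {z} {n} (j ℕ.∸ i) n-prime e (sym ratio))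
      where
      ratio : 1# ≈ z ^ (j ℕ.∸ i)
      ratio = cancel-≈ {z ^ i} (^-≉0 i (root≉0 n-prime e)) (begin
        z ^ i * 1#               ≈⟨ *-identityʳ _ ⟩
        z ^ i                    ≈⟨ eq ⟩
        z ^ j                    ≈⟨ ^-congʳ z (ℕ.m+[n∸m]≡n (ℕ.<⇒≤ i<j)) ⟨
        z ^ (i ℕ.+ (j ℕ.∸ i))    ≈⟨ ^-homo-* z i (j ℕ.∸ i) ⟩
        z ^ i * z ^ (j ℕ.∸ i)    ∎)
      conclude : n ℕ∣.∣ (j ℕ.∸ i) ⊎ z ≈ 1# → ⊥
      conclude (inj₂ z≈1)  = z≉1 z≈1
      conclude (inj₁ n∣j-i) = ℕ.<⇒≱ (ℕ.≤-<-trans (ℕ.m∸n≤m j i) j<n)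
        (ℕ∣.∣⇒≤ {{ℕ.>-nonZero (ℕ.m<n⇒0<n∸m i<j)}} n∣j-i)

  powers-distinct : ∀ {n z} → Prime n → z ^ n ≈ 1# → z ≉ 1# →
                    ∀ (i j : Fin n) → i ≢ j → z ^ toℕ i ≉ z ^ toℕ j
  powers-distinct n-prime e z≉1 i j i≢j with ℕ.<-cmp (toℕ i) (toℕ j)
  ... | tri< i<j _ _ = distinct-< n-prime e z≉1 i<j (Fin.toℕ<n j)
  ... | tri≈ _ i≡j _ = ⊥-elim (i≢j (Fin.toℕ-injective i≡j))
  ... | tri> _ _ j<i = λ eq → distinct-< n-prime e z≉1 j<i (Fin.toℕ<n i) (sym eq)

-- The ring A[X]/(X^n - a), where n = suc m.
module KummerConstruction (A : CommutativeRing 0ℓ 0ℓ) (a : CommutativeRing.Carrier A) (m : ℕ) where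
  private
    module A = CommutativeRingTheory A
    module X = Polynomial A
    module XT = PolynomialTheory A

  n : ℕ
  n = suc m

  equation : X.Poly
  equation = (A.- a) ∷ XT.monomial m

  private
    module Coords = RemainderCoordinates A equation n A.1#
      (A.trans (A.*-identityˡ _) (XT.coeff-monomial m))
      (≡.subst (λ k → XT.DegreeBelow (suc k) equation) (XT.length-monomial m) (XT.length-below equation))
  open Coords public using (coords)

  E : CommutativeRing 0ℓ 0ℓ
  E = Quotient.quotientRing X.polynomialRing (principal X.polynomialRing equation)

  open Quotient X.polynomialRing (principal X.polynomialRing equation) public using (congruent)
  open CommutativeRingTheory E public
  open SetoidReasoning setoid

  ≈ₚ⇒≈ : ∀ {f h} → f X.≈ₚ h → f ≈ h
  ≈ₚ⇒≈ = Coords.≈⇒Q≈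

  ι : A.Carrier → Carrier
  ι = X.constant

  θ : Carrier
  θ = A.0# ∷ A.1# ∷ []

  ι-hom : RingMorphisms.IsRingHomomorphism A.rawRing rawRing ι
  ι-hom = mkHomomorphism A E ι (λ e → ≈ₚ⇒≈ (X.∷-cong e X.reflₚ)) (λ x y → refl)
    (λ x y → ≈ₚ⇒≈ (X.∷-cong (A.sym (A.+-identityʳ _)) X.reflₚ)) refl

  module ι = Homomorphism {R = A} {S = E} ι-hom

  private
    module T = Evaluation {R = A} {S = E} ι-hom θ

    -- The class of p is p evaluated at the class of X. This turns the coefficients of a remainder
    -- into coordinates with respect to the powers of θ.
    tautological : ∀ p → T.eval p ≈ p
    tautological []      = refl
    tautological (x ∷ p) = trans (+-cong {ι x} {ι x} {θ * T.eval p} {θ * p} refl (*-cong {θ} {θ} {T.eval p} {p} refl (tautological p))) (≈ₚ⇒≈ (X.coeffwise λ where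
        zero → A.trans (X.coeff-+ (ι x) (θ X.*ₚ p) 0) (A.trans
          (A.+-congˡ (A.trans (XT.coeff-*-zero A.0# (ι A.1#) p) (A.zeroˡ _))) (A.+-identityʳ x))
        (suc k) → A.trans (X.coeff-+ (ι x) (θ X.*ₚ p) (suc k)) (A.trans (A.+-identityˡ _)
          (A.trans (XT.coeff-*-suc A.0# (ι A.1#) p k) (A.trans (A.+-congʳ (A.zeroˡ _)) (A.trans (A.+-identityˡ _)
            (X.at (XT.P.*-identityˡ p) k)))))))

  combination : (Fin n → A.Carrier) → Carrier
  combination c = sum (λ i → ι (c i) * θ ^ toℕ i)

  private
    combination-tabulate : ∀ c → combination c ≈ List.tabulate c
    combination-tabulate c = trans (sym (T.eval-tabulate c)) (tautological (List.tabulate c))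

  expansion : ∀ x → x ≈ combination (coords x)
  expansion x = trans (Coords.coords-sound x) (sym (combination-tabulate (coords x)))

  coords-unique : ∀ {x} (c : Fin n → A.Carrier) → x ≈ combination c → ∀ i → coords x i A.≈ c i
  coords-unique {x} c e = Coords.coords-unique {x} c (trans {x} e (combination-tabulate c))

  θ^n≈a : θ ^ n ≈ ι a
  θ^n≈a = x-y≈0⇒x≈y (begin
    θ ^ n - ι a                              ≈⟨ +-cong {θ ^ n} {θ * T.eval (XT.monomial m)} { - ι a} { - ι a}
      (*-cong {θ} {θ} {θ ^ m} {T.eval (XT.monomial m)} refl (sym (T.eval-monomial m))) refl ⟩
   
    θ * T.eval (XT.monomial m) - ι a         ≈⟨ +-comm (θ * T.eval (XT.monomial m)) (- ι a) ⟩
    - ι a + θ * T.eval (XT.monomial m)       ≈⟨ tautological equation ⟩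
    equation                                 ≈⟨ congruent (XT.P.1# XT.P., XT.P.trans (XT.P.*-identityˡ equation)
                                                  (XT.P.sym (XT.P.+-identityʳ equation))) ⟩
    0#                                       ∎)

  module Lift {B : CommutativeRing 0ℓ 0ℓ} {f : A.Carrier → CommutativeRing.Carrier B}
    (f-hom : RingMorphisms.IsRingHomomorphism A.rawRing (CommutativeRing.rawRing B) f)
    (b : CommutativeRing.Carrier B)
    (root : CommutativeRing._≈_ B (CommutativeRingTheory._^_ B b n) (f a)) where
    private
      module B = CommutativeRingTheory B
      module f = Homomorphism {R = A} {S = B} f-hom
      module V = Evaluation {R = A} {S = B} f-hom b
      module eval = Homomorphism {R = X.polynomialRing} {S = B} V.eval-hom

    lift : Carrier → B.Carrier
    lift = V.eval

    private
      lift-equation : lift equation B.≈ B.0#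
      lift-equation = B.trans (B.+-cong (f.-‿homo a) (B.trans (B.*-congˡ (V.eval-monomial m)) root)) (B.-‿inverseˡ (f a))

      lift-cong : ∀ {x y} → x ≈ y → lift x B.≈ lift y
      lift-cong {x} {y} (congruent (s XT.P., e)) = B.x-y≈0⇒x≈y (B.trans (B.sym (eval.minus-homo x y)) (B.trans
        (V.eval-cong (XT.P.sym e)) (B.trans (V.eval-* s equation) (B.trans (B.*-congˡ lift-equation) (B.zeroʳ _)))))

    lift-hom : RingMorphisms.IsRingHomomorphism rawRing B.rawRing lift
    lift-hom = mkHomomorphism E B lift lift-cong V.eval-+ V.eval-* (B.trans (V.eval-constant A.1#) f.1#-homo)

    lift-ι : ∀ r → lift (ι r) B.≈ f r
    lift-ι = V.eval-constant

    lift-θ : lift θ B.≈ b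
    lift-θ = B.trans (B.+-cong f.0#-homo (B.trans (B.*-congˡ (V.eval-constant A.1#)) (B.*-congˡ f.1#-homo)))
      (B.trans (B.+-identityˡ _) (B.*-identityʳ b))

-- The construction is sealed: only its universal property and its basis are used from here on.
module Kummer (A : CommutativeRing 0ℓ 0ℓ) (a : CommutativeRing.Carrier A) (m : ℕ) where
  private
    module A = CommutativeRingTheory A
    module C = KummerConstruction A a m

  n : ℕ
  n = suc m

  abstract
    E : CommutativeRing 0ℓ 0ℓ
    E = C.E

  open CommutativeRingTheory E public
  open SetoidReasoning setoid

  abstract
    ι : A.Carrier → Carrier
    ι = C.ι

    θ : Carrier
    θ = C.θ

    ι-hom : RingMorphisms.IsRingHomomorphism A.rawRing rawRing ι
    ι-hom = C.ι-hom

    coords : Carrier → Fin n → A.Carrier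
    coords = C.coords

  module ι = Homomorphism {R = A} {S = E} ι-hom

  combination : (Fin n → A.Carrier) → Carrier
  combination c = sum (λ i → ι (c i) * θ ^ toℕ i)

  abstract
    expansion : ∀ x → x ≈ combination (coords x)
    expansion = C.expansion

    coords-unique : ∀ {x} (c : Fin n → A.Carrier) → x ≈ combination c → ∀ i → coords x i A.≈ c i
    coords-unique {x} = C.coords-unique {x}

    θ^n≈a : θ ^ n ≈ ι a
    θ^n≈a = C.θ^n≈a

  module Lift {B : CommutativeRing 0ℓ 0ℓ} {f : A.Carrier → CommutativeRing.Carrier B}
    (f-hom : RingMorphisms.IsRingHomomorphism A.rawRing (CommutativeRing.rawRing B) f)
    (b : CommutativeRing.Carrier B)
    (root : CommutativeRing._≈_ B (CommutativeRingTheory._^_ B b n) (f a)) where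
    private
      module B = CommutativeRingTheory B

    abstract
      lift : Carrier → B.Carrier
      lift = C.Lift.lift {B = B} f-hom b root

      lift-hom : RingMorphisms.IsRingHomomorphism rawRing B.rawRing lift
      lift-hom = C.Lift.lift-hom {B = B} f-hom b root

      lift-ι : ∀ r → lift (ι r) B.≈ f r
      lift-ι = C.Lift.lift-ι {B = B} f-hom b root

      lift-θ : lift θ B.≈ b
      lift-θ = C.Lift.lift-θ {B = B} f-hom b root

  combination-cong : ∀ {c d} → (∀ i → c i A.≈ d i) → combination c ≈ combination d
  combination-cong {c} {d} e = sum-cong (λ i → ι (c i) * θ ^ toℕ i) (λ i → ι (d i) * θ ^ toℕ i) (λ i → *-congʳ (ι.cong (e i)))

  coords-cong : ∀ {x y} → x ≈ y → ∀ i → coords x i A.≈ coords y i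
  coords-cong {x} {y} e = coords-unique (coords y) (trans e (expansion y))

  ≈⇐coords : ∀ {x y} → (∀ i → coords x i A.≈ coords y i) → x ≈ y
  ≈⇐coords {x} {y} e = trans (expansion x) (trans (combination-cong e) (sym (expansion y)))

  private
    term : Carrier → Fin n → Carrier
    term x i = ι (coords x i) * θ ^ toℕ i

  coords-+ : ∀ x y i → coords (x + y) i A.≈ coords x i A.+ coords y i
  coords-+ x y = coords-unique _ (begin
    x + y                              ≈⟨ +-cong (expansion x) (expansion y) ⟩
    sum (term x) + sum (term y)        ≈⟨ ∑-distrib-+ (term x) (term y) ⟨
    sum (λ i → term x i + term y i)    ≈⟨ sum-cong (λ i → term x i + term y i) (λ i → ι (coords x i A.+ coords y i) * θ ^ toℕ i) (λ i →
      trans (sym (distribʳ (θ ^ toℕ i) (ι (coords x i)) (ι (coords y i)))) (*-congʳ (sym (ι.+-homo (coords x i) (coords y i))))) ⟩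
    combination (λ i → coords x i A.+ coords y i)  ∎)

  coords-ι* : ∀ r x i → coords (ι r * x) i A.≈ r A.* coords x i
  coords-ι* r x = coords-unique _ (begin
    ι r * x                            ≈⟨ *-congˡ (expansion x) ⟩
    ι r * sum (term x)                 ≈⟨ *-distribˡ-sum (ι r) (term x) ⟩
    sum (λ i → ι r * term x i)         ≈⟨ sum-cong (λ i → ι r * term x i) (λ i → ι (r A.* coords x i) * θ ^ toℕ i) (λ i →
      trans (sym (*-assoc (ι r) (ι (coords x i)) (θ ^ toℕ i))) (*-congʳ (sym (ι.*-homo r (coords x i))))) ⟩
    combination (λ i → r A.* coords x i)  ∎)

  coords-0 : ∀ i → coords 0# i A.≈ A.0#
  coords-0 = coords-unique (λ _ → A.0#) (sym (sum-0 {n} (λ i → ι A.0# * θ ^ toℕ i) (λ i → trans (*-congʳ ι.0#-homo) (zeroˡ _))))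

  coords-combination : ∀ c i → coords (combination c) i A.≈ c i
  coords-combination c = coords-unique c refl

  independent : ∀ c → combination c ≈ 0# → ∀ i → c i A.≈ A.0#
  independent c e i = A.trans (A.sym (coords-combination c i)) (A.trans (coords-cong e i) (coords-0 i))

  δ : Fin n → Fin n → A.Carrier
  δ j i with i Fin.≟ j
  ... | yes _ = A.1#
  ... | no _  = A.0#

  δ-diagonal : ∀ j → δ j j A.≈ A.1#
  δ-diagonal j with j Fin.≟ j
  ... | yes _ = A.refl
  ... | no ≢ = ⊥-elim (≢ ≡.refl)

  δ-off-diagonal : ∀ {i j} → i ≢ j → δ j i A.≈ A.0#
  δ-off-diagonal {i} {j} i≢j with i Fin.≟ j
  ... | yes e = ⊥-elim (i≢j e)
  ... | no _  = A.refl

  coords-θ^ : ∀ j i → coords (θ ^ toℕ j) i A.≈ δ j i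
  coords-θ^ j = coords-unique (δ j) (sym (trans (sum-single (λ i → ι (δ j i) * θ ^ toℕ i) j (λ i i≢j →
      trans (*-congʳ (trans (ι.cong (δ-off-diagonal i≢j)) ι.0#-homo)) (zeroˡ _)))
    (trans (*-congʳ (trans (ι.cong (δ-diagonal j)) ι.1#-homo)) (*-identityˡ _))))

  coords-monomial : ∀ r j i → coords (ι r * θ ^ toℕ j) i A.≈ r A.* δ j i
  coords-monomial r j i = A.trans (coords-ι* r (θ ^ toℕ j) i) (A.*-congˡ (coords-θ^ j i))

  coords-ι : ∀ r i → coords (ι r) i A.≈ r A.* δ zero i
  coords-ι r i = A.trans (coords-cong (sym (*-identityʳ (ι r))) i) (coords-monomial r zero i)

  single-coordinate : ∀ x j → (∀ i → i ≢ j → coords x i A.≈ A.0#) → x ≈ ι (coords x j) * θ ^ toℕ j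
  single-coordinate x j e = trans (expansion x) (sum-single (term x) j
    (λ i i≢j → trans (*-congʳ (trans (ι.cong (e i i≢j)) ι.0#-homo)) (zeroˡ _)))

  ι-injective : ∀ {r s} → ι r ≈ ι s → r A.≈ s
  ι-injective {r} {s} e = (A.trans (A.sym (A.*-identityʳ r))
      (A.trans (A.sym (coords-ι r zero))
      (A.trans (coords-cong e zero)
      (A.trans (coords-ι s zero)
      (A.*-identityʳ s)))))

  module _ {B : CommutativeRing 0ℓ 0ℓ} {f h : Carrier → CommutativeRing.Carrier B}
    (f-hom : RingMorphisms.IsRingHomomorphism rawRing (CommutativeRing.rawRing B) f)
    (h-hom : RingMorphisms.IsRingHomomorphism rawRing (CommutativeRing.rawRing B) h) where
    private
      module B = CommutativeRingTheory B
      module f = Homomorphism {R = E} {S = B} f-hom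
      module h = Homomorphism {R = E} {S = B} h-hom

    hom-ext : (∀ r → f (ι r) B.≈ h (ι r)) → f θ B.≈ h θ → ∀ x → f x B.≈ h x
    hom-ext on-ι on-θ x = B.trans (f.cong (expansion x)) (B.trans (f.sum-homo (term x)) (B.trans
        (B.sum-cong (f ∘ term x) (h ∘ term x) termwise)
        (B.trans (B.sym (h.sum-homo (term x))) (h.cong (sym (expansion x))))))
      where
      termwise : ∀ i → f (term x i) B.≈ h (term x i)
      termwise i = B.trans (f.*-homo _ _) (B.trans (B.*-cong (on-ι (coords x i))
        (B.trans (f.^-homo θ (toℕ i)) (B.trans (B.^-congˡ (toℕ i) on-θ) (B.sym (h.^-homo θ (toℕ i))))))
        (B.sym (h.*-homo _ _)))

  module Rotation (z : A.Carrier) (root : z A.^ n A.≈ A.1#) where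
    private
      module L = Lift {B = E} ι-hom (ι z * θ) (begin
        (ι z * θ) ^ n        ≈⟨ ^-distrib-* (ι z) θ n ⟩
        ι z ^ n * θ ^ n      ≈⟨ *-cong (trans (sym (ι.^-homo z n)) (trans (ι.cong root) ι.1#-homo)) θ^n≈a ⟩
        1# * ι a             ≈⟨ *-identityˡ _ ⟩
        ι a                  ∎)
    open L public renaming (lift to σ; lift-hom to σ-hom; lift-ι to σ-ι; lift-θ to σ-θ)
    private module σ = Homomorphism {R = E} {S = E} σ-hom

    coords-σ : ∀ x i → coords (σ x) i A.≈ z A.^ toℕ i A.* coords x i
    coords-σ x = coords-unique _ (begin
      σ x                                           ≈⟨ σ.cong (expansion x) ⟩
      σ (combination (coords x))                    ≈⟨ σ.sum-homo (term x) ⟩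
      sum (λ i → σ (ι (coords x i) * θ ^ toℕ i))    ≈⟨ sum-cong (σ ∘ term x) (λ i → ι (z A.^ toℕ i A.* coords x i) * θ ^ toℕ i) (λ i → begin
        σ (ι (coords x i) * θ ^ toℕ i)              ≈⟨ σ.*-homo _ _ ⟩
        σ (ι (coords x i)) * σ (θ ^ toℕ i)          ≈⟨ *-cong (σ-ι _) (trans (σ.^-homo θ (toℕ i)) (^-congˡ (toℕ i) σ-θ)) ⟩
        ι (coords x i) * (ι z * θ) ^ toℕ i          ≈⟨ *-congˡ (^-distrib-* (ι z) θ (toℕ i)) ⟩
        ι (coords x i) * (ι z ^ toℕ i * θ ^ toℕ i)
          ≈⟨ solve 3 (λ c z t → (c :* (z :* t)) := ((z :* c) :* t)) refl _ _ _ ⟩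
        (ι z ^ toℕ i * ι (coords x i)) * θ ^ toℕ i
          ≈⟨ *-congʳ (trans (*-congʳ (sym (ι.^-homo z (toℕ i)))) (sym (ι.*-homo _ _))) ⟩
        ι (z A.^ toℕ i A.* coords x i) * θ ^ toℕ i  ∎) ⟩
      combination (λ i → z A.^ toℕ i A.* coords x i) ∎)

    -- σ is diagonal in the powers of θ with entries z^i, so an eigenvector for z^j satisfies (z^i -
    -- z^j) x_i = 0, and regularity of these differences leaves only the coordinate j.
    eigenvector : (∀ i j → i ≢ j → ∀ y → (z A.^ toℕ i A.- z A.^ toℕ j) A.* y A.≈ A.0# → y A.≈ A.0#) →
                  ∀ j x → σ x ≈ ι (z A.^ toℕ j) * x → x ≈ ι (coords x j) * θ ^ toℕ j
    eigenvector regular j x e = single-coordinate x j λ i i≢j → regular i j i≢j (coords x i) ((A.trans (A.solve 3 (λ a b c → ((a A.:- b) A.:* c) A.:= (a A.:* c A.:- b A.:* c)) A.refl _ _ _)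
      (A.x≈y⇒x-y≈0 (A.trans (A.sym (coords-σ x i)) (A.trans (coords-cong e i) (coords-ι* _ x i))))))

-- The Frobenius of a finite field F with q elements acts on F[X]/(X^n - a) as the rotation by a^((q-1)/n).
-- If this is not 1, the norm of x is both a power of x and an element of F, so x is zero or invertible.
module FiniteKummer (F : FiniteField) (a : CommutativeRing.Carrier (FiniteField.ring F)) (m e : ℕ)
  (n-prime : Prime (suc m)) (order-≡ : FiniteField.order F ≡ suc (e ℕ.* suc m))
  (a≉0 : CommutativeRing._≉_ (FiniteField.ring F) a (CommutativeRing.0# (FiniteField.ring F)))
  (nonresidue : CommutativeRing._≉_ (FiniteField.ring F)
    (CommutativeRingTheory._^_ (FiniteField.ring F) a e) (CommutativeRing.1# (FiniteField.ring F)))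
  where

  private
    module F = CommutativeRingTheory (FiniteField.ring F)
    module FF = FiniteField F
    module FT = FiniteFieldTheory F
    module FR = Roots (FiniteField.ring F) FF.isDomain
  open Kummer (FiniteField.ring F) a m
  open SetoidReasoning setoid

  private
    q : ℕ
    q = FF.order

    η : F.Carrier
    η = a F.^ e

    η-root : η F.^ n F.≈ F.1#
    η-root = F.trans (F.^-assocʳ a e n) (FT.power-≈1 order-≡ a≉0)

    open Rotation η η-root

    -- The q-th power map is a ring homomorphism, so it is enough to compare on scalars, where
    -- Fermat applies, and on θ, where q = 1 + n e gives θ^q = θ (θ^n)^e.
    frobenius : ∀ x → x ^ q ≈ σ x
    frobenius = hom-ext {B = E} frobenius-hom σ-hom
        (λ r → trans (sym (ι.^-homo r q)) (trans (ι.cong (FT.fermat r)) (sym (σ-ι r))))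
        (begin
          θ ^ q               ≈⟨ ^-congʳ θ (≡.trans order-≡ (≡.cong suc (ℕ.*-comm e n))) ⟩
          θ * θ ^ (n ℕ.* e)   ≈⟨ *-congˡ (^-assocʳ θ n e) ⟨
          θ * (θ ^ n) ^ e     ≈⟨ *-congˡ (^-congˡ e θ^n≈a) ⟩
          θ * ι a ^ e         ≈⟨ *-congˡ (ι.^-homo a e) ⟨
          θ * ι η             ≈⟨ *-comm _ _ ⟩
          ι η * θ             ≈⟨ σ-θ ⟨
          σ θ                 ∎)
      where
      frobenius-hom : RingMorphisms.IsRingHomomorphism rawRing rawRing (_^ q)
      frobenius-hom = mkHomomorphism E E (_^ q) (^-congˡ q) (FT.frobenius-+ {S = E} ι-hom)
        (λ x y → ^-distrib-* x y q) (1^n≈1 q)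

    coords-frobenius : ∀ k x i → coords (x ^ (q ℕ.^ k)) i F.≈ (η F.^ toℕ i) F.^ k F.* coords x i
    coords-frobenius zero    x i = F.trans (coords-cong (*-identityʳ x) i) (F.sym (F.*-identityˡ _))
    coords-frobenius (suc k) x i = (F.trans (coords-cong (^-congʳ x (ℕ.*-comm q (q ℕ.^ k))) i)
      (F.trans (coords-cong (trans (sym (^-assocʳ x (q ℕ.^ k) q)) (frobenius _)) i)
      (F.trans (coords-σ _ i)
      (F.trans (F.*-congˡ (coords-frobenius k x i))
      (F.sym (F.*-assoc _ _ _))))))

    frobenius-order : ∀ x → x ^ (q ℕ.^ n) ≈ x
    frobenius-order x = ≈⇐coords λ i → F.trans (coords-frobenius n x i) (F.trans (F.*-congʳ ((F.trans (F.^-assocʳ η (toℕ i) n)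
      (Powers.^-*-≈1 (FiniteField.ring F) n (toℕ i) η-root)))) (F.*-identityˡ _))

    -- This is 1 + q + ... + q^(k-1); for k = n the corresponding power of x is the product of its n
    -- Frobenius conjugates.
    normExponent : ℕ → ℕ
    normExponent zero    = 0
    normExponent (suc k) = suc (q ℕ.* normExponent k)

    normExponent-step : ∀ k → suc (q ℕ.* normExponent k) ≡ normExponent k ℕ.+ q ℕ.^ k
    normExponent-step zero    = ≡.cong suc (ℕ.*-zeroʳ q)
    normExponent-step (suc k) = ≡.cong suc (≡.trans (≡.cong (q ℕ.*_) (normExponent-step k)) (ℕ.*-distribˡ-+ q (normExponent k) (q ℕ.^ k)))

    -- With M for `normExponent k`: 2 M ≤ q M + 1 = M + q^k, and M cancels.
    normExponent-bound : ∀ k → normExponent k ≤ q ℕ.^ k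
    normExponent-bound k = ℕ.+-cancelˡ-≤ (normExponent k) _ _ (ℕ.≤-trans
      (ℕ.≤-trans (ℕ.≤-reflexive (≡.cong (normExponent k ℕ.+_) (≡.sym (ℕ.+-identityʳ _))))
        (ℕ.≤-trans (ℕ.*-monoˡ-≤ (normExponent k) FT.2≤order) (ℕ.n≤1+n _)))
      (ℕ.≤-reflexive (normExponent-step k)))

    -- The product of the Frobenius conjugates of x other than x itself; `norm x` unfolds to
    -- `x * cofactor x`.
    cofactor : Carrier → Carrier
    cofactor x = x ^ (q ℕ.* normExponent m)

    norm : Carrier → Carrier
    norm x = x ^ normExponent n

    norm-fixed : ∀ x → norm x ^ q ≈ norm x
    norm-fixed x = begin
      norm x ^ q                                ≈⟨ ^-assocʳ x (normExponent n) q ⟩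
      x ^ (normExponent n ℕ.* q)                ≈⟨ ^-congʳ x (≡.trans (ℕ.*-comm (normExponent n) q)
                                                     (ℕ.suc-injective (normExponent-step n))) ⟩
      x ^ (q ℕ.* normExponent m ℕ.+ q ℕ.^ n)    ≈⟨ ^-homo-* x (q ℕ.* normExponent m) (q ℕ.^ n) ⟩
      cofactor x * x ^ (q ℕ.^ n)                ≈⟨ *-congˡ (frobenius-order x) ⟩
      cofactor x * x                            ≈⟨ *-comm _ _ ⟩
      norm x                                    ∎

    norm-scalar : ∀ x → norm x ≈ ι (coords (norm x) zero)
    norm-scalar x = trans (eigenvector
      (λ i j i≢j y → FR.cancel (λ e → RootsOfUnity.powers-distinct (FiniteField.ring F) FF.isDomain n-prime η-root nonresidue i j i≢j
        (F.x-y≈0⇒x≈y e)))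
      zero (norm x) (trans (sym (frobenius (norm x))) (trans (norm-fixed x) (sym (trans (*-congʳ ι.1#-homo) (*-identityˡ _))))))
      (*-identityʳ _)

  zero-or-invertible : ZeroOrInvertible
  zero-or-invertible x = go (coords (norm x) zero FF.≟ F.0#)
    where
    go : Dec (coords (norm x) zero F.≈ F.0#) → x ≈ 0# ⊎ ∃[ y ] y * x ≈ 1#
    -- The exponent q^n is at least that of the norm, so x = x^(q^n) contains the vanishing norm as
    -- a factor.
    go (yes c≈0) = inj₁ (begin
      x                                                     ≈⟨ frobenius-order x ⟨
      x ^ (q ℕ.^ n)                                         ≈⟨ ^-congʳ x (ℕ.m+[n∸m]≡n (normExponent-bound n)) ⟨
      x ^ (normExponent n ℕ.+ (q ℕ.^ n ℕ.∸ normExponent n)) ≈⟨ ^-homo-* x (normExponent n) _ ⟩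
      norm x * _                                            ≈⟨ *-congʳ (trans (norm-scalar x) (trans (ι.cong c≈0) ι.0#-homo)) ⟩
      0# * _                                                ≈⟨ zeroˡ _ ⟩
      0#                                                    ∎)
    go (no c≉0) = let d , dc≈1 = FT.inverse c≉0 in inj₂ (ι d * cofactor x , (begin
      (ι d * cofactor x) * x              ≈⟨ *-assoc _ _ _ ⟩
      ι d * (cofactor x * x)              ≈⟨ *-congˡ (*-comm _ _) ⟩
      ι d * norm x                        ≈⟨ *-congˡ (norm-scalar x) ⟩
      ι d * ι (coords (norm x) zero)      ≈⟨ ι.*-homo d _ ⟨
      ι (d F.* coords (norm x) zero)      ≈⟨ trans (ι.cong dc≈1) ι.1#-homo ⟩
      1#                                  ∎))

-- Bezout domains

record Bezout (A : CommutativeRing c ℓ) (x y : CommutativeRing.Carrier A) : Set (c ⊔ ℓ) where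
  open CommutativeRing A
  field
    gcd s t x′ y′ : Carrier
    x≈            : x ≈ gcd * x′
    y≈            : y ≈ gcd * y′
    gcd≈          : gcd ≈ s * x + t * y

-- The properties of F[t] on which the construction rests. `multiplicity-bound` takes the place of
-- unique factorisation, and `fresh-irreducible` expresses the infinitude of primes.
record BezoutDomain (A : CommutativeRing c ℓ) : Set (c ⊔ ℓ) where
  open CommutativeRingTheory A
  field
    isDomain           : IsDomain
    _≈?_               : ∀ x y → Dec (x ≈ y)
    _∣?_               : ∀ x y → Dec (x ∣ y)
    bezout             : ∀ x y → Bezout A x y
    multiplicity-bound : ∀ {p x} → ¬ p ∣ 1# → x ≉ 0# → ∃[ n ] ¬ (p ^ n) ∣ x
    irreducible-factor : ∀ {x} → x ≉ 0# → ¬ x ∣ 1# → ∃[ p ] Irreducible p × p ∣ x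
    fresh-irreducible  : ∀ {x} → x ≉ 0# → ∃[ p ] Irreducible p × ¬ p ∣ x

module BezoutDomainTheory {A : CommutativeRing c ℓ} (bezoutDomain : BezoutDomain A) where
  open CommutativeRingTheory A
  open BezoutDomain bezoutDomain
  open Roots A isDomain
  open Irreducible
  open SetoidReasoning setoid

  Coprime : Carrier → Carrier → Set (c ⊔ ℓ)
  Coprime x y = ∃[ s ] ∃[ t ] s * x + t * y ≈ 1#

  coprime-sym : ∀ {x y} → Coprime x y → Coprime y x
  coprime-sym (s , t , e) = t , s , trans (+-comm _ _) e

  coprime-resp : ∀ {x y z} → y ≈ z → Coprime x y → Coprime x z
  coprime-resp y≈z (s , t , e) = s , t , trans (+-congˡ (*-congˡ (sym y≈z))) e

  coprime-* : ∀ {x y z} → Coprime x y → Coprime x z → Coprime x (y * z)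
  coprime-* {x} {y} {z} (s , t , e) (u , v , f) = s * u * x + s * v * z + t * y * u , t * v , (begin
    (s * u * x + s * v * z + t * y * u) * x + t * v * (y * z)
      ≈⟨ solve 7 (λ s t u v x y z → (((s :* u :* x :+ s :* v :* z) :+ t :* y :* u) :* x :+ t :* v :* (y :* z))
           := ((s :* x :+ t :* y) :* (u :* x :+ v :* z))) refl s t u v x y z ⟩
    (s * x + t * y) * (u * x + v * z)  ≈⟨ *-cong e f ⟩
    1# * 1#                            ≈⟨ *-identityˡ 1# ⟩
    1#                                 ∎)

  coprime-∣⇒∣1 : ∀ {p x y} → Coprime x y → p ∣ x → p ∣ y → p ∣ 1#
  coprime-∣⇒∣1 (s , t , e) p∣x p∣y = ∣ʳ-respʳ-≈ e (∣-+ (∣-*ˡ s p∣x) (∣-*ˡ t p∣y))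

  coprime-mod : ∀ {x y z} → x ∣ (y - z) → Coprime x z → Coprime x y
  coprime-mod {x} {y} {z} (q , f) (s , t , e) = s - t * q , t , (begin
    (s - t * q) * x + t * y
      ≈⟨ solve 5 (λ s t q x y → ((s :- t :* q) :* x :+ t :* y) := (s :* x :+ t :* (y :- q :* x))) refl s t q x y ⟩
    s * x + t * (y - q * x)    ≈⟨ +-congˡ (*-congˡ (+-congˡ (-‿cong f))) ⟩
    s * x + t * (y - (y - z))
      ≈⟨ +-congˡ (*-congˡ (solve 2 (λ y z → (y :- (y :- z)) := z) refl y z)) ⟩
    s * x + t * z              ≈⟨ e ⟩
    1#                         ∎)

  coprime-divides : ∀ {x y z} → Coprime x y → x ∣ (y * z) → x ∣ z
  coprime-divides (s , t , e) = coprime-∣ {s} {t} e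

  -- Irreducibility of p = gcd · p′ tells which factor is a unit: if it is the gcd, then p and x are
  -- coprime; if it is p′, then p is associated to the gcd, which divides x.
  irreducible-divides-or-coprime : ∀ {p} → Irreducible p → ∀ x → p ∣ x ⊎ Coprime p x
  irreducible-divides-or-coprime {p} p-irr x with bezout p x
  ... | record { gcd = d ; s = s ; t = t ; x′ = p′ ; y′ = x′ ; x≈ = p≈ ; y≈ = x≈ ; gcd≈ = d≈ } with split-∣1 p-irr p≈
  ...   | inj₁ (u , ud≈1) = inj₂ (u * s , u * t , (begin
    u * s * p + u * t * x  ≈⟨ solve 5 (λ u s t p x → (u :* s :* p :+ u :* t :* x) := (u :* (s :* p :+ t :* x))) refl u s t p x ⟩
    u * (s * p + t * x)    ≈⟨ *-congˡ (sym d≈) ⟩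
    u * d                  ≈⟨ ud≈1 ⟩
    1#                     ∎))
  ...   | inj₂ (u , up′≈1) = inj₁ (u * x′ , (begin
    u * x′ * p             ≈⟨ *-congˡ p≈ ⟩
    u * x′ * (d * p′)
      ≈⟨ solve 4 (λ u x d p → (u :* x :* (d :* p)) := ((u :* p) :* (d :* x))) refl u x′ d p′ ⟩
    (u * p′) * (d * x′)    ≈⟨ *-cong up′≈1 (sym x≈) ⟩
    1# * x                 ≈⟨ *-identityˡ x ⟩
    x                      ∎))

  irreducible-prime : ∀ {p} → Irreducible p → ∀ x y → p ∣ (x * y) → p ∣ x ⊎ p ∣ y
  irreducible-prime p-irr x y p∣xy with irreducible-divides-or-coprime p-irr x
  ... | inj₁ p∣x = inj₁ p∣x
  ... | inj₂ cop = inj₂ (coprime-divides cop p∣xy)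

  irreducible-∤^ : ∀ {p} → Irreducible p → ∀ {x} n → ¬ p ∣ x → ¬ p ∣ (x ^ n)
  irreducible-∤^ p-irr zero    p∤x p∣1 = p∤1 p-irr p∣1
  irreducible-∤^ p-irr {x} (suc n) p∤x p∣xⁿ with irreducible-prime p-irr x (x ^ n) p∣xⁿ
  ... | inj₁ p∣x  = p∤x p∣x
  ... | inj₂ p∣xⁿ⁻¹ = irreducible-∤^ p-irr n p∤x p∣xⁿ⁻¹

  irreducible-≉0 : ∀ {p} → Irreducible p → p ≉ 0#
  irreducible-≉0 p-irr p≈0 with split-∣1 p-irr (trans p≈0 (sym (zeroˡ 0#)))
  ... | inj₁ (q , e) = proj₁ isDomain (trans (sym e) (zeroʳ q))
  ... | inj₂ (q , e) = proj₁ isDomain (trans (sym e) (zeroʳ q))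

  -- Write g = d g′ with d the gcd of g and h. As g does not divide h, g′ is not a unit. An
  -- irreducible factor of g′ that divided h would divide d as well, and its square would divide g.
  squarefree-factor : ∀ {g h} → g ≉ 0# → (∀ x → (x * x) ∣ g → x ∣ 1#) → ¬ g ∣ h →
                      ∃[ p ] Irreducible p × p ∣ g × ¬ p ∣ h
  squarefree-factor {g} {h} g≉0 squarefree g∤h with bezout g h
  ... | record { gcd = d ; s = s ; t = t ; x′ = g′ ; y′ = h′ ; x≈ = g≈ ; y≈ = h≈ ; gcd≈ = d≈ }
    with irreducible-factor g′≉0 g′∤1
    where
    g′≉0 : g′ ≉ 0#
    g′≉0 e = g≉0 (trans g≈ (trans (*-congˡ e) (zeroʳ d)))
    g′∤1 : ¬ g′ ∣ 1#
    g′∤1 (u , ug′≈1) = g∤h (h′ * u , (begin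
      h′ * u * g         ≈⟨ *-congˡ g≈ ⟩
      h′ * u * (d * g′)  ≈⟨ solve 4 (λ h u d g → (h :* u :* (d :* g)) := ((u :* g) :* (d :* h))) refl h′ u d g′ ⟩
      (u * g′) * (d * h′) ≈⟨ *-cong ug′≈1 (sym h≈) ⟩
      1# * h             ≈⟨ *-identityˡ h ⟩
      h                  ∎))
  ... | p , p-irr , (u , up≈g′) = p , p-irr , p∣g , λ p∣h → p∤1 p-irr (squarefree p (p²∣g (∣ʳ-respʳ-≈ (sym d≈) (∣-+ (∣-*ˡ s p∣g) (∣-*ˡ t p∣h)))))
    where
    p∣g : p ∣ g
    p∣g = ∣ʳ-respʳ-≈ (sym g≈) (∣-*ˡ d (u , up≈g′))
    p²∣g : p ∣ d → (p * p) ∣ g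
    p²∣g (v , vp≈d) = v * u , (begin
      v * u * (p * p)    ≈⟨ solve 3 (λ v u p → (v :* u :* (p :* p)) := ((v :* p) :* (u :* p))) refl v u p ⟩
      (v * p) * (u * p)  ≈⟨ *-cong vp≈d up≈g′ ⟩
      d * g′             ≈⟨ g≈ ⟨
      g                  ∎)

  -- Infinite descent on the multiplicity of p in v.
  not-power-ratio : ∀ {p} → Irreducible p → ∀ {x y} l → 2 ≤ l → p ∣ x → ¬ (p * p) ∣ x → ¬ p ∣ y →
                    ∀ {u v} → v ≉ 0# → ¬ x * v ^ l ≈ u ^ l * y
  not-power-ratio p-irr (suc zero) (s≤s ())
  not-power-ratio {p} p-irr {x} {y} (suc (suc l)) _ p∣x@(x′ , x′p≈x) p²∤x p∤y v≉0 =
    let n , pⁿ∤v = multiplicity-bound (p∤1 p-irr) v≉0 in go n pⁿ∤v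
    where
    p≉0 : p ≉ 0#
    p≉0 = irreducible-≉0 p-irr
    p∤x′ : ¬ p ∣ x′
    p∤x′ (w , wp≈x′) = p²∤x (w , trans (sym (*-assoc w p p)) (trans (*-congʳ wp≈x′) x′p≈x))
    go : ∀ n {u v} → ¬ (p ^ n) ∣ v → ¬ x * v ^ suc (suc l) ≈ u ^ suc (suc l) * y
    go zero    {u} {v} 1∤v  e = 1∤v (v , *-identityʳ v)
    go (suc n) {u} {v} pⁿ∤v e = descend (p∣? u (λ p∤u → case-y (irreducible-prime p-irr (u ^ suc (suc l)) y
        (∣ʳ-respʳ-≈ e (∣-*ʳ (v ^ suc (suc l)) p∣x))) p∤u))
      where
      L : ℕ
      L = suc (suc l)
      p∣? : ∀ z → ¬ ¬ p ∣ z → p ∣ z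
      p∣? z ¬¬d with p ∣? z
      ... | yes d = d
      ... | no ¬d = ⊥-elim (¬¬d ¬d)
      case-y : p ∣ (u ^ L) ⊎ p ∣ y → ¬ p ∣ u → ⊥
      case-y (inj₁ d) p∤u = irreducible-∤^ p-irr L p∤u d
      case-y (inj₂ d) _   = p∤y d
      descend : p ∣ u → ⊥
      -- Since L ≥ 2, p² divides x v^L while p divides x only once, so p divides v too. Dividing u
      -- and v by p reproduces the equation with a smaller multiplicity in v.
      descend (u′ , u′p≈u) = descend-v (p∣? v λ p∤v → case-x (irreducible-prime p-irr x′ (v ^ L) (u′ ^ L * p ^ l * y , cancelled)) p∤v)
        where
        scaled : u ^ L ≈ (u′ ^ L * p ^ L)
        scaled = trans (^-congˡ L (sym u′p≈u)) (^-distrib-* u′ p L)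
        cancelled : (u′ ^ L * p ^ l * y) * p ≈ x′ * v ^ L
        cancelled = cancel-≈ p≉0 (begin
          p * ((u′ ^ L * p ^ l * y) * p)
            ≈⟨ solve 4 (λ p u q y → (p :* ((u :* q :* y) :* p)) := ((u :* (p :* (p :* q))) :* y)) refl p (u′ ^ L) (p ^ l) y ⟩
          (u′ ^ L * p ^ L) * y   ≈⟨ *-congʳ scaled ⟨
          u ^ L * y              ≈⟨ e ⟨
          x * v ^ L              ≈⟨ *-congʳ x′p≈x ⟨
          (x′ * p) * v ^ L       ≈⟨ solve 3 (λ x p v → ((x :* p) :* v) := (p :* (x :* v))) refl x′ p (v ^ L) ⟩
          p * (x′ * v ^ L)       ∎)
        case-x : p ∣ x′ ⊎ p ∣ (v ^ L) → ¬ p ∣ v → ⊥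
        case-x (inj₁ d) _   = p∤x′ d
        case-x (inj₂ d) p∤v = irreducible-∤^ p-irr L p∤v d
        descend-v : p ∣ v → ⊥
        descend-v (v′ , v′p≈v) = go n {u′} {v′} pⁿ∤v′ (cancel-≈ (^-≉0 L p≉0) (begin
          p ^ L * (x * v′ ^ L)   ≈⟨ solve 3 (λ p x v → (p :* (x :* v)) := (x :* (v :* p))) refl (p ^ L) x (v′ ^ L) ⟩
          x * (v′ ^ L * p ^ L)   ≈⟨ *-congˡ (trans (^-congˡ L (sym v′p≈v)) (^-distrib-* v′ p L)) ⟨
          x * v ^ L              ≈⟨ e ⟩
          u ^ L * y              ≈⟨ *-congʳ scaled ⟩
          (u′ ^ L * p ^ L) * y   ≈⟨ solve 3 (λ u p y → ((u :* p) :* y) := (p :* (u :* y))) refl (u′ ^ L) (p ^ L) y ⟩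
          p ^ L * (u′ ^ L * y)   ∎))
          where
          pⁿ∤v′ : ¬ (p ^ n) ∣ v′
          pⁿ∤v′ (w , e) = pⁿ∤v (w , trans (solve 3 (λ w p q → (w :* (p :* q)) := ((w :* q) :* p)) refl w p (p ^ n))
            (trans (*-congʳ e) v′p≈v))

-- Polynomials over a finite field as a Bezout domain

module PolynomialArithmetic (F : FiniteField) where
  open FiniteField F using (_≟_; isDomain; order; cardinality)
  private
    module F = CommutativeRingTheory (FiniteField.ring F)
    module FT = FiniteFieldTheory F
    module FR = Roots (FiniteField.ring F) isDomain
  open Polynomial (FiniteField.ring F)
  open PolynomialTheory (FiniteField.ring F)
  open CommutativeRingTheory polynomialRing
  open SetoidReasoning setoid

  infixr 4 _,_
  record HasDegree (f : Poly) (n : ℕ) : Set where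
    constructor _,_
    field
      leading≉0 : coeff f n F.≉ F.0#
      below     : DegreeBelow (suc n) f

  open HasDegree

  below-weaken : ∀ {m n f} → m ≤ n → DegreeBelow m f → DegreeBelow n f
  below-weaken m≤n b k n≤k = b k (ℕ.≤-trans m≤n n≤k)

  degree? : ∀ f → f ≈ 0# ⊎ ∃ (HasDegree f)
  degree? [] = inj₁ refl
  degree? (x ∷ f) with degree? f | x ≟ F.0#
  ... | inj₂ (n , f≉0 , b) | _       = inj₂ (suc n , f≉0 , λ where (suc k) (s≤s n≤k) → b k n≤k)
  ... | inj₁ f≈0           | yes x≈0 = inj₁ (∷-zero x≈0 f≈0)
  ... | inj₁ f≈0           | no x≉0  = inj₂ (0 , x≉0 , λ where (suc k) _ → at f≈0 k)

  degree : ∀ {f} → f ≉ 0# → ∃ (HasDegree f)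
  degree {f} f≉0 with degree? f
  ... | inj₁ f≈0 = ⊥-elim (f≉0 f≈0)
  ... | inj₂ d   = d

  degree⇒≉0 : ∀ {f n} → HasDegree f n → f ≉ 0#
  degree⇒≉0 {n = n} (lead , _) f≈0 = lead (at f≈0 n)

  degree-resp : ∀ {f h n} → f ≈ h → HasDegree f n → HasDegree h n
  degree-resp {n = n} e (lead , b) = (λ z → lead (F.trans (at e n) z)) , below-resp e b

  degree-unique : ∀ {f m n} → HasDegree f m → HasDegree f n → m ≡ n
  degree-unique (l , b) (l′ , b′) = ℕ.≤-antisym (ℕ.≮⇒≥ λ n<m → l (b′ _ n<m)) (ℕ.≮⇒≥ λ m<n → l′ (b _ m<n))

  degree-* : ∀ {f h m n} → HasDegree f m → HasDegree h n → HasDegree (f * h) (m ℕ.+ n)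
  degree-* {[]}    {h} {m}     (lead , _) _ = ⊥-elim (lead F.refl)
  degree-* {x ∷ f} {h} {zero}  (lead , b) h-deg = degree-resp
    (trans (sym (constant-* x h)) (*-congʳ {h} {constant x} {x ∷ f} (∷-cong F.refl f≈0)))
    (scaled h-deg)
    where
    f≈0 : [] ≈ₚ f
    f≈0 = coeffwise λ k → F.sym (b (suc k) (s≤s z≤n))
    scaled : ∀ {n} → HasDegree h n → HasDegree (x ·ₚ h) n
    scaled {n} (lead′ , b′) = (λ e → FR.*-≉0 lead lead′ (F.trans (F.sym (coeff-· x h n)) e))
      , λ k n≤k → F.trans (coeff-· x h k) (F.trans (F.*-congˡ (b′ k n≤k)) (F.zeroʳ x))
  degree-* {x ∷ f} {h} {suc m} {n} (lead , b) h-deg@(_ , b′)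
    with degree-* {f} {h} {m} {n} (lead , λ k l → b (suc k) (s≤s l)) h-deg
  ... | lead″ , b″ = (λ e → lead″ (F.trans (F.sym (shifted (m ℕ.+ n) (ℕ.m≤n+m n m))) e)) , above
    where
    shifted : ∀ k → n ≤ k → coeff ((x ∷ f) * h) (suc k) F.≈ coeff (f * h) k
    shifted k n≤k = F.trans (coeff-*-suc x f h k) (F.trans
      (F.+-congʳ (F.trans (F.*-congˡ (b′ (suc k) (s≤s n≤k))) (F.zeroʳ x))) (F.+-identityˡ _))
    above : DegreeBelow (suc (suc m ℕ.+ n)) ((x ∷ f) * h)
    above (suc k) (s≤s l) = F.trans (shifted k (ℕ.≤-trans (ℕ.m≤n+m n m) (ℕ.≤-trans (ℕ.n≤1+n _) l))) (b″ k l)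

  degree-0⇒unit : ∀ {f} → HasDegree f 0 → f ∣ 1#
  degree-0⇒unit {f} (lead , b) = constant (proj₁ (FT.inverse lead)) , trans (constant-* _ f) (coeffwise λ where
    zero    → F.trans (coeff-· _ f 0) (proj₂ (FT.inverse lead))
    (suc k) → F.trans (coeff-· _ f (suc k)) (F.trans (F.*-congˡ (b (suc k) (s≤s z≤n))) (F.zeroʳ _)))

  1-degree : HasDegree 1# 0
  1-degree = proj₁ isDomain , λ where (suc k) _ → F.refl

  divisor-degree : ∀ {f h n} → HasDegree h n → f ∣ h → ∃[ m ] ∃[ k ] HasDegree f m × HasDegree h (k ℕ.+ m)
  divisor-degree {f} {h} {n} h-deg (s , sf≈h) with degree? s | degree? f
  ... | inj₁ s≈0       | _              = ⊥-elim (degree⇒≉0 h-deg (trans (sym sf≈h) (trans (*-congʳ {f} s≈0) (zeroˡ f))))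
  ... | inj₂ _         | inj₁ f≈0       = ⊥-elim (degree⇒≉0 h-deg (trans (sym sf≈h) (trans (*-congˡ {s} f≈0) (zeroʳ s))))
  ... | inj₂ (k , s-deg) | inj₂ (m , f-deg) = m , k , f-deg , degree-resp sf≈h (degree-* {s} {f} s-deg f-deg)

  nonunit-degree : ∀ {f n} → ¬ f ∣ 1# → HasDegree f n → 1 ≤ n
  nonunit-degree {n = zero}  f∤1 f-deg = ⊥-elim (f∤1 (degree-0⇒unit f-deg))
  nonunit-degree {n = suc n} f∤1 f-deg = s≤s z≤n

  degree⇒nonunit : ∀ {f n} → HasDegree f (suc n) → ¬ f ∣ 1#
  degree⇒nonunit {f} f-deg f∣1 with divisor-degree {f} 1-degree f∣1
  ... | m , k , f-deg′ , 1-deg with degree-unique {f} f-deg f-deg′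
  ...   | ≡.refl with () ← ≡.trans (≡.sym (ℕ.+-suc k _)) (degree-unique {1#} 1-deg 1-degree)

  lead-inverse : ∀ {g n} → HasDegree g n → F.Carrier
  lead-inverse (lead , _) = proj₁ (FT.inverse lead)

  lead-inverse-≈ : ∀ {g n} (d : HasDegree g n) → lead-inverse d F.* coeff g n F.≈ F.1#
  lead-inverse-≈ (lead , _) = proj₂ (FT.inverse lead)

  module Modulo {g n} (g-deg : HasDegree g n) where
    open RemainderCoordinates (FiniteField.ring F) g n (lead-inverse g-deg) (lead-inverse-≈ g-deg) (below g-deg) public
    open Quotient polynomialRing (principal polynomialRing g) using (congruent; quotientRing)
    private module Q = CommutativeRing quotientRing

    quotient-cardinality : RingNotions.HasCardinality quotientRing (order ℕ.^ n)
    quotient-cardinality = Compose.inverse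
      (mkInverse {S = Q.setoid} {T = functionSetoid {S = F.setoid} n} coords List.tabulate
        (λ {f} {h} → coords-cong {f} {h}) (λ {c} {d} e → ≈⇒Q≈ {List.tabulate c} {List.tabulate d} (tabulate-cong e))
        (λ c → coords-unique {List.tabulate c} c (Q.refl {List.tabulate c})) (λ f → Q.sym {f} {List.tabulate (coords f)} (coords-sound f)))
      (function-cardinality {S = F.setoid} n cardinality)

    zeros : 0# ≈ List.tabulate {n = n} (λ _ → F.0#)
    zeros = below⇒tabulate {n} [] (λ _ _ → F.refl)

    ∣-dec : ∀ f → Dec (g ∣ f)
    ∣-dec f with Fin.all? (λ i → coords f i ≟ F.0#)
    ... | yes e = yes (∣ʳ-respʳ-≈ {g} {f - 0#} {f} (+-identityʳ f) (difference (Q.trans {f} {List.tabulate (coords f)} {0#}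
      (coords-sound f) (≈⇒Q≈ {List.tabulate (coords f)} {0#} (trans (tabulate-cong e) (sym zeros))))))
      where open Quotient._≡ᴵ_
    ... | no ¬e = no λ g∣f → ¬e λ i → F.trans
      (coords-cong {f} {0#} (congruent (∣ʳ-respʳ-≈ {g} {f} {f - 0#} (sym (+-identityʳ f)) g∣f)) i)
      (coords-unique {0#} (λ _ → F.0#) (≈⇒Q≈ {0#} {List.tabulate {n = n} (λ _ → F.0#)} zeros) i)

  _≈0? : ∀ f → Dec (f ≈ 0#)
  f ≈0? with degree? f
  ... | inj₁ f≈0       = yes f≈0
  ... | inj₂ (n , deg) = no (degree⇒≉0 deg)

  _∣?_ : ∀ g f → Dec (g ∣ f)
  g ∣? f with degree? g
  ... | inj₂ (n , deg) = Modulo.∣-dec deg f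
  ... | inj₁ g≈0       = map′ (λ f≈0 → ∣-≈0 f≈0) (λ g∣f → 0∣x⇒x≈0 (∣ʳ-respˡ-≈ g≈0 g∣f)) (f ≈0?)

  -- Euclid's algorithm; n bounds the degree of y and decreases with each division.
  bezout : ∀ n x y → DegreeBelow n y → Bezout polynomialRing x y
  bezout n x y b with degree? y
  ... | inj₁ y≈0 = record
    { gcd = x ; s = 1# ; t = 0# ; x′ = 1# ; y′ = 0#
    ; x≈ = sym (*-identityʳ x) ; y≈ = trans y≈0 (sym (zeroʳ x))
    ; gcd≈ = sym (trans (+-cong (*-identityˡ x) (zeroˡ y)) (+-identityʳ x)) }
  bezout zero    x y b | inj₂ (k , lead , _) = ⊥-elim (lead (b k z≤n))
  bezout (suc n) x y b | inj₂ (k , y-deg@(lead , y-below))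
    with divide {u = lead-inverse y-deg} y (lead-inverse-≈ y-deg) y-below x
  ... | q , r , x≈qy+r , r-below with bezout n y r (below-weaken {f = r} (ℕ.≮⇒≥ λ n<k → lead (b k n<k)) r-below)
  ...   | record { gcd = d ; s = s ; t = t ; x′ = y′ ; y′ = r′ ; x≈ = y≈ ; y≈ = r≈ ; gcd≈ = d≈ } = record
    { gcd = d ; s = t ; t = s - t * q ; x′ = q * y′ + r′ ; y′ = y′
    ; x≈ = begin
        x                       ≈⟨ x≈qy+r ⟩
        q * y + r               ≈⟨ +-cong (*-congˡ {q} y≈) r≈ ⟩
        q * (d * y′) + d * r′
          ≈⟨ solve 4 (λ q d y r → (q :* (d :* y) :+ d :* r) := (d :* (q :* y :+ r))) refl q d y′ r′ ⟩
        d * (q * y′ + r′)       ∎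
    ; y≈ = y≈
    ; gcd≈ = begin
        d                       ≈⟨ d≈ ⟩
        s * y + t * r
          ≈⟨ solve 5 (λ s t q y r → (s :* y :+ t :* r) := (t :* (q :* y :+ r) :+ (s :- t :* q) :* y)) refl s t q y r ⟩
        t * (q * y + r) + (s - t * q) * y  ≈⟨ +-congʳ (*-congˡ {t} (sym x≈qy+r)) ⟩
        t * x + (s - t * q) * y            ∎
    }

  power-degree : ∀ {p x} → ¬ p ∣ 1# → ∀ j {k} → HasDegree x k → (p ^ j) ∣ x → j ≤ k
  power-degree         p∤1 zero    x-deg d = z≤n
  power-degree {p} {x} p∤1 (suc j) {k} x-deg (s , e) = conclude
      (divisor-degree {y} {x} x-deg (p , trans (*-comm p y) yp≈x)) (divisor-degree {p} {x} x-deg (y , yp≈x))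
    where
    y : Poly
    y = s * p ^ j
    yp≈x : y * p ≈ x
    yp≈x = trans (trans (*-assoc s (p ^ j) p) (*-congˡ {s} (*-comm (p ^ j) p))) e
    conclude : ∃[ m ] ∃[ i ] HasDegree y m × HasDegree x (i ℕ.+ m) →
               ∃[ m ] ∃[ i ] HasDegree p m × HasDegree x (i ℕ.+ m) → suc j ≤ k
    conclude (m , _ , y-deg , _) (m′ , _ , p-deg , _) =
      ≡.subst (suc j ≤_) (degree-unique {x} (degree-resp yp≈x (degree-* {y} {p} y-deg p-deg)) x-deg)
        (ℕ.≤-trans (ℕ.≤-reflexive (ℕ.+-comm 1 j))
          (ℕ.+-mono-≤ (power-degree {p} {y} p∤1 j y-deg (s , refl)) (nonunit-degree {p} p∤1 p-deg)))

  -- There are finitely many polynomials of degree below n, so a nonunit divisor of f can be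
  -- searched for among them. If one is found, recursion on the degree bound b applies to it; if
  -- none exists, f is irreducible itself.
  irreducible-factor′ : ∀ b {f n} → n ≤ b → HasDegree f n → ¬ f ∣ 1# → ∃[ p ] Irreducible p × p ∣ f
  irreducible-factor′ zero    {f} z≤n f-deg f∤1 = ⊥-elim (f∤1 (degree-0⇒unit f-deg))
  irreducible-factor′ (suc b) {f} {n} n≤b f-deg f∤1 = cases (finite-search (function-cardinality {S = F.setoid} n cardinality)
      Factor
      (λ e (d , ¬d) → ∣ʳ-respˡ-≈ (tabulate-cong e) d , λ d′ → ¬d (∣ʳ-respˡ-≈ (sym (tabulate-cong e)) d′))
      (λ c → (List.tabulate c ∣? f) ×-dec ¬? (List.tabulate c ∣? 1#)))
    where
    Factor : (Fin n → F.Carrier) → Set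
    Factor c = List.tabulate c ∣ f × ¬ List.tabulate c ∣ 1#
    smaller : ∀ c → Factor c → ∃[ m ] ∃[ k ] HasDegree (List.tabulate c) m × HasDegree f (k ℕ.+ m) →
              ∃[ p ] Irreducible p × p ∣ f
    smaller c (c∣f , c∤1) (m , _ , c-deg@(lead , _) , _) =
      let p , p-irr , p∣c = irreducible-factor′ b (ℕ.≤-pred (ℕ.≤-trans (ℕ.≰⇒> λ n≤m → lead (tabulate-below c m n≤m)) n≤b)) c-deg c∤1
      in p , p-irr , ∣ʳ-trans p∣c c∣f
    module _ (none : ∀ c → ¬ Factor c) where
      -- A nonunit y has positive degree, so x has degree below n and belongs to the candidates of
      -- the search.
      low-degree⇒unit : ∀ {x y} → f ≈ x * y → ¬ y ∣ 1# →
        ∃[ m ] ∃[ k ] HasDegree x m × HasDegree f (k ℕ.+ m) → ∃[ m ] ∃[ k ] HasDegree y m × HasDegree f (k ℕ.+ m) →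
        ¬ ¬ x ∣ 1#
      low-degree⇒unit {x} {y} f≈xy y∤1 (m , _ , x-deg , _) (m′ , _ , y-deg , _) x∤1 =
        none (coeff x ∘ toℕ) (∣ʳ-respˡ-≈ x≈ (y , trans (*-comm y x) (sym f≈xy)) , λ d → x∤1 (∣ʳ-respˡ-≈ (sym x≈) d))
        where
        n≡ : m ℕ.+ m′ ≡ n
        n≡ = degree-unique {f} (degree-resp (sym f≈xy) (degree-* {x} {y} x-deg y-deg)) f-deg
        m<n : suc m ≤ n
        m<n = ≡.subst (suc m ≤_) n≡ (ℕ.≤-trans (ℕ.≤-reflexive (ℕ.+-comm 1 m)) (ℕ.+-monoʳ-≤ m (nonunit-degree {y} y∤1 y-deg)))
        x≈ : x ≈ List.tabulate {n = n} (coeff x ∘ toℕ)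
        x≈ = below⇒tabulate x (below-weaken {f = x} m<n (below x-deg))
      split : ∀ {x y} → f ≈ x * y → Dec (x ∣ 1#) → Dec (y ∣ 1#) → x ∣ 1# ⊎ y ∣ 1#
      split f≈xy (yes x∣1) _         = inj₁ x∣1
      split f≈xy (no _)    (yes y∣1) = inj₂ y∣1
      split {x} {y} f≈xy (no x∤1) (no y∤1) = ⊥-elim (low-degree⇒unit {x} {y} f≈xy y∤1
        (divisor-degree {x} {f} f-deg (y , trans (*-comm y x) (sym f≈xy))) (divisor-degree {y} {f} f-deg (x , sym f≈xy)) x∤1)
    cases : ∃ Factor ⊎ (∀ c → ¬ Factor c) → ∃[ p ] Irreducible p × p ∣ f
    cases (inj₁ (c , factor)) = smaller c factor (divisor-degree f-deg (proj₁ factor))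
    cases (inj₂ none) = f , record { p∤1 = f∤1 ; split-∣1 = λ {x} {y} e → split none {x} {y} e (x ∣? 1#) (y ∣? 1#) } , ∣ʳ-refl

  bezoutDomain : BezoutDomain polynomialRing
  bezoutDomain = record
    { isDomain           = polynomialRing-isDomain (_≟ F.0#) isDomain
    ; _≈?_               = λ x y → map′ x-y≈0⇒x≈y x≈y⇒x-y≈0 ((x - y) ≈0?)
    ; _∣?_               = _∣?_
    ; bezout             = λ x y → bezout (length y) x y (length-below y)
    ; multiplicity-bound = λ {p} {x} p∤1 x≉0 → let k , x-deg = degree x≉0 in
        suc k , λ d → ℕ.<⇒≱ (ℕ.n<1+n k) (power-degree p∤1 (suc k) x-deg d)
    ; irreducible-factor = λ x≉0 x∤1 → let n , x-deg = degree x≉0 in irreducible-factor′ n ℕ.≤-refl x-deg x∤1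
    ; fresh-irreducible  = fresh
    }
    where
    -- The list 1# ∷ x is the polynomial 1 + t x.
    fresh : ∀ {x} → x ≉ 0# → ∃[ p ] Irreducible p × ¬ p ∣ x
    fresh {x} x≉0 = conclude (irreducible-factor′ (suc n) {1+tx} ℕ.≤-refl 1+tx-deg (degree⇒nonunit {1+tx} 1+tx-deg))
      where
      t 1+tx : Poly
      t = F.0# ∷ F.1# ∷ []
      1+tx = F.1# ∷ x
      n : ℕ
      n = proj₁ (degree {x} x≉0)
      x-deg : HasDegree x n
      x-deg = proj₂ (degree {x} x≉0)
      1+tx-deg : HasDegree 1+tx (suc n)
      1+tx-deg = leading≉0 x-deg , λ where (suc k) (s≤s l) → below x-deg k l
      1+tx≈ : 1+tx ≈ 1# + t * x
      1+tx≈ = coeffwise λ where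
        zero    → F.sym (F.trans (coeff-+ 1# (t * x) 0) (F.trans (F.+-congˡ (F.trans (coeff-*-zero F.0# 1# x) (F.zeroˡ _))) (F.+-identityʳ _)))
        (suc k) → F.sym (F.trans (coeff-+ 1# (t * x) (suc k)) (F.trans (F.+-identityˡ _)
          (F.trans (coeff-*-suc F.0# 1# x k) (F.trans (F.+-congʳ (F.zeroˡ _)) (F.trans (F.+-identityˡ _) (at (*-identityˡ x) k))))))
      1≈ : 1+tx - t * x ≈ 1#
      1≈ = trans (+-cong {1+tx} {1# + t * x} { - (t * x)} { - (t * x)} 1+tx≈ refl)
        (trans (+-assoc 1# (t * x) (- (t * x))) (trans (+-cong {1#} {1#} {t * x - t * x} {0#} refl (-‿inverseʳ (t * x))) (+-identityʳ 1#)))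
      conclude : ∃[ p ] Irreducible p × p ∣ 1+tx → ∃[ p ] Irreducible p × ¬ p ∣ x
      conclude (p , p-irr , p∣1+tx) = p , p-irr , λ p∣x → Irreducible.p∤1 p-irr
        (∣ʳ-respʳ-≈ {p} {1+tx - t * x} {1#} 1≈ (∣-+ {p} {1+tx} p∣1+tx (∣-neg {p} {t * x} (∣-*ˡ t p∣x))))

-- Kummer extensions of fields

-- Functoriality of the Kummer ring in its coefficients, needed for the embedding of A into its
-- fraction field and for the reduction of A modulo P.
module KummerMap {A A′ : CommutativeRing 0ℓ 0ℓ}
  {f : CommutativeRing.Carrier A → CommutativeRing.Carrier A′}
  (f-hom : RingMorphisms.IsRingHomomorphism (CommutativeRing.rawRing A) (CommutativeRing.rawRing A′) f)
  (a : CommutativeRing.Carrier A) (m : ℕ) where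
  private
    module A = CommutativeRingTheory A
    module A′ = CommutativeRingTheory A′
    module S = Kummer A a m
    module T = Kummer A′ (f a) m

  open S.Lift {B = T.E}
    (Composition.isRingHomomorphism T.trans f-hom T.ι-hom) T.θ T.θ^n≈a public
    renaming (lift to map; lift-hom to map-hom; lift-ι to map-ι; lift-θ to map-θ)
  private module map = Homomorphism {R = S.E} {S = T.E} map-hom

  map-combination : ∀ c → map (S.combination c) T.≈ T.combination (f ∘ c)
  map-combination c = T.trans (map.sum-homo (λ i → S.ι (c i) S.* S.θ S.^ toℕ i)) (T.sum-cong (λ i → map (S.ι (c i) S.* S.θ S.^ toℕ i)) (λ i → T.ι (f (c i)) T.* T.θ T.^ toℕ i) λ i →
    T.trans (map.*-homo _ _) (T.*-cong (map-ι (c i)) (T.trans (map.^-homo S.θ (toℕ i)) (T.^-congˡ (toℕ i) map-θ))))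

  coords-map : ∀ x i → T.coords (map x) i A′.≈ f (S.coords x i)
  coords-map x = T.coords-unique (f ∘ S.coords x) (T.trans (map.cong (S.expansion x)) (map-combination (S.coords x)))

-- A Kummer extension of a field k containing the n-th roots of unity, where n = suc m.
module KummerField (k : CommutativeRing 0ℓ 0ℓ) (k-isField : RingNotions.IsField k)
  (_≟_ : ∀ x y → Dec (CommutativeRing._≈_ k x y))
  (m : ℕ) (ζ : CommutativeRing.Carrier k)
  (ζ-root : CommutativeRing._≈_ k (CommutativeRingTheory._^_ k ζ (suc m)) (CommutativeRing.1# k))
  (ζ-distinct : ∀ (i j : Fin (suc m)) → i ≢ j →
    CommutativeRing._≉_ k (CommutativeRingTheory._^_ k ζ (toℕ i)) (CommutativeRingTheory._^_ k ζ (toℕ j)))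
  (a : CommutativeRing.Carrier k)
  (E-isDomain : RingNotions.IsDomain (Kummer.E k a m))
  where

  private module k = CommutativeRingTheory k
  open Kummer k a m
  open SetoidReasoning setoid

  private
    k-inverse : ∀ {x} → x k.≉ k.0# → ∃[ y ] y k.* x k.≈ k.1#
    k-inverse x≉0 = let y , e , _ = proj₂ k-isField _ x≉0 in y , e

    k-cancel : ∀ {x y} → x k.≉ k.0# → x k.* y k.≈ k.0# → y k.≈ k.0#
    k-cancel x≉0 = let y , e = k-inverse x≉0 in k.unit-cancel (y k., e)

    ζ-regular : ∀ i j → i ≢ j → ∀ y → (ζ k.^ toℕ i k.- ζ k.^ toℕ j) k.* y k.≈ k.0# → y k.≈ k.0#
    ζ-regular i j i≢j y = k-cancel (λ e → ζ-distinct i j i≢j (k.x-y≈0⇒x≈y e))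

    open module Rot = Rotation ζ ζ-root
    open Roots E E-isDomain
    module σ = Homomorphism {R = E} {S = E} σ-hom

  _≟ᴱ_ : ∀ x y → Dec (x ≈ y)
  x ≟ᴱ y = map′ (λ e → ≈⇐coords e) (λ e → coords-cong e) (Fin.all? (λ i → coords x i ≟ coords y i))

  private
    root-power : ∀ j → (ζ k.^ j) k.^ n k.≈ k.1#
    root-power j = k.trans (k.^-assocʳ ζ j n) (Powers.^-*-≈1 k n j ζ-root)

    coords-iterate : ∀ t x i → coords (iterate σ x t) i k.≈ (ζ k.^ toℕ i) k.^ t k.* coords x i
    coords-iterate zero    x i = k.sym (k.*-identityˡ _)
    coords-iterate (suc t) x i = k.trans (coords-iterate t (σ x) i) (k.trans (k.*-congˡ (coords-σ x i))
      (k.solve 3 (λ p z c → (p k.:* (z k.:* c)) k.:= ((z k.:* p) k.:* c)) k.refl _ _ _))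

    iterate-step : ∀ t x → iterate σ (σ x) t ≡ σ (iterate σ x t)
    iterate-step zero    x = ≡.refl
    iterate-step (suc t) x = iterate-step t (σ x)

    iterate-order : ∀ x → iterate σ x n ≈ x
    iterate-order x = ≈⇐coords λ i → k.trans (coords-iterate n x i) (k.trans (k.*-congʳ (root-power (toℕ i))) (k.*-identityˡ _))

    σ-≉0 : ∀ {x} → x ≉ 0# → σ x ≉ 0#
    σ-≉0 {x} x≉0 e = x≉0 (trans (sym (iterate-order x)) (iterate-0 m e))
      where
      iterate-0 : ∀ t {y} → y ≈ 0# → iterate σ y t ≈ 0#
      iterate-0 zero    e = e
      iterate-0 (suc t) e = iterate-0 t (trans (σ.cong e) σ.0#-homo)

    -- x σ(x) ⋯ σᵗ⁻¹(x)
    orbit-product : ℕ → Carrier → Carrier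
    orbit-product zero    x = 1#
    orbit-product (suc t) x = x * σ (orbit-product t x)

    -- The orbit product can be extended at either end. Comparing the two ways at t = n gives x σ(N)
    -- = N x for the norm N, so N is fixed by σ.
    orbit-product-last : ∀ t x → orbit-product (suc t) x ≈ orbit-product t x * iterate σ x t
    orbit-product-last zero    x = trans (*-congˡ σ.1#-homo) (*-comm x 1#)
    orbit-product-last (suc t) x = begin
      x * σ (orbit-product (suc t) x)                     ≈⟨ *-congˡ (σ.cong (orbit-product-last t x)) ⟩
      x * σ (orbit-product t x * iterate σ x t)           ≈⟨ *-congˡ (σ.*-homo _ _) ⟩
      x * (σ (orbit-product t x) * σ (iterate σ x t))     ≈⟨ *-assoc _ _ _ ⟨
      orbit-product (suc t) x * σ (iterate σ x t)         ≈⟨ *-congˡ (reflexive (≡.sym (iterate-step t x))) ⟩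
      orbit-product (suc t) x * iterate σ (σ x) t         ∎

    orbit-product-≉0 : ∀ t {x} → x ≉ 0# → orbit-product t x ≉ 0#
    orbit-product-≉0 zero    x≉0 = proj₁ E-isDomain
    orbit-product-≉0 (suc t) x≉0 = *-≉0 x≉0 (σ-≉0 (orbit-product-≉0 t x≉0))

  fixed⇒scalar : ∀ x → σ x ≈ x → x ≈ ι (coords x zero)
  fixed⇒scalar x e = trans (eigenvector ζ-regular zero x (trans e (sym (trans (*-congʳ ι.1#-homo) (*-identityˡ x)))))
    (*-identityʳ _)

  -- The norm of x is fixed by σ, hence a scalar, and it is nonzero because E is a domain. The
  -- product of the other conjugates divided by this scalar inverts x.
  E-isField : RingNotions.IsField E
  E-isField = proj₁ E-isDomain , λ x x≉0 → invert x x≉0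
    where
    invert : ∀ x → x ≉ 0# → ∃[ y ] y * x ≈ 1# × x * y ≈ 1#
    invert x x≉0 = y , inverseˡ , trans (*-comm x y) inverseˡ
      where
      N : Carrier
      N = orbit-product n x
      N-fixed : σ N ≈ N
      N-fixed = cancel-≈ x≉0 (trans (orbit-product-last n x) (trans (*-congˡ (iterate-order x)) (*-comm N x)))
      N≈ : N ≈ ι (coords N zero)
      N≈ = fixed⇒scalar N N-fixed
      d : ∃[ d ] d k.* coords N zero k.≈ k.1#
      d = k-inverse λ c≈0 → orbit-product-≉0 n x≉0 (trans N≈ (trans (ι.cong c≈0) ι.0#-homo))
      y : Carrier
      y = ι (proj₁ d) * σ (orbit-product m x)
      inverseˡ : y * x ≈ 1#
      inverseˡ = begin
        ι (proj₁ d) * σ (orbit-product m x) * x     ≈⟨ trans (*-assoc _ _ _) (*-congˡ (*-comm _ x)) ⟩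
        ι (proj₁ d) * N                             ≈⟨ *-congˡ N≈ ⟩
        ι (proj₁ d) * ι (coords N zero)             ≈⟨ ι.*-homo _ _ ⟨
        ι (proj₁ d k.* coords N zero)               ≈⟨ ι.cong (proj₂ d) ⟩
        ι k.1#                                      ≈⟨ ι.1#-homo ⟩
        1#                                          ∎

  extension : FiniteExtension k
  extension = record
    { ring    = E
    ; isField = E-isField
    ; ι       = ι
    ; ι-hom   = ι-hom
    ; degree  = n
    ; basis   = λ i → θ ^ toℕ i
    ; isBasis = (λ x → coords x , sym (expansion x)) , independent
    }

  -- If y were not one of the n distinct elements ζ^j x, then X^n - x^n would have n + 1 roots in a
  -- domain. Decidable equality turns this into a search for j.
  root-of-power : ∀ {x y} → x ≉ 0# → y ^ n ≈ x ^ n → ∃[ j ] y ≈ ι (ζ k.^ toℕ j) * x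
  root-of-power {x} {y} x≉0 e = go (Fin.any? (λ j → y ≟ᴱ (ι (ζ k.^ toℕ j) * x)))
    where
    go : Dec (∃[ j ] y ≈ ι (ζ k.^ toℕ j) * x) → ∃[ j ] y ≈ ι (ζ k.^ toℕ j) * x
    go (yes found) = found
    go (no none)   = ⊥-elim (power-roots n (s≤s z≤n) (x ^ n) roots distinct powers)
      where
      roots : Fin (suc n) → Carrier
      roots zero    = y
      roots (suc j) = ι (ζ k.^ toℕ j) * x
      distinct : ∀ i j → i ≢ j → roots i ≉ roots j
      distinct zero    zero    i≢j e = i≢j ≡.refl
      distinct zero    (suc j) i≢j e = none (j , e)
      distinct (suc i) zero    i≢j e = none (i , sym e)
      distinct (suc i) (suc j) i≢j e = ζ-distinct i j (i≢j ∘ ≡.cong suc)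
        (ι-injective (cancel-≈ x≉0 (trans (*-comm x _) (trans e (*-comm _ x)))))
      powers : ∀ i → roots i ^ n ≈ x ^ n
      powers zero    = e
      powers (suc j) = begin
        (ι (ζ k.^ toℕ j) * x) ^ n         ≈⟨ ^-distrib-* (ι (ζ k.^ toℕ j)) x n ⟩
        ι (ζ k.^ toℕ j) ^ n * x ^ n       ≈⟨ *-congʳ (trans (sym (ι.^-homo (ζ k.^ toℕ j) n)) (trans (ι.cong (root-power (toℕ j))) ι.1#-homo)) ⟩
        1# * x ^ n                        ≈⟨ *-identityˡ _ ⟩
        x ^ n                             ∎

  -- Kummer theory: an n-th root of b is an eigenvector of σ.
  root⇒ratio : ∀ {b y} → b k.≉ k.0# → y ^ n ≈ ι b → ∃[ c ] ∃[ j ] b k.≈ c k.^ n k.* a k.^ j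
  root⇒ratio {b} {y} b≉0 yⁿ≈b =
    go (root-of-power {y} {σ y} y≉0 (trans (sym (σ.^-homo y n)) (trans (σ.cong yⁿ≈b) (trans (σ-ι b) (sym yⁿ≈b)))))
    where
    y≉0 : y ≉ 0#
    y≉0 y≈0 = b≉0 (ι-injective (trans (sym yⁿ≈b) (trans (^-congˡ n y≈0) (trans (zeroˡ _) (sym ι.0#-homo)))))
    go : ∃[ j ] σ y ≈ ι (ζ k.^ toℕ j) * y → ∃[ c ] ∃[ j ] b k.≈ c k.^ n k.* a k.^ j
    go (j , eigen) = r , toℕ j , ι-injective (begin
      ι b                                   ≈⟨ yⁿ≈b ⟨
      y ^ n                                 ≈⟨ ^-congˡ n (eigenvector ζ-regular j y eigen) ⟩
      (ι r * θ ^ toℕ j) ^ n                 ≈⟨ ^-distrib-* (ι r) (θ ^ toℕ j) n ⟩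
      ι r ^ n * (θ ^ toℕ j) ^ n             ≈⟨ *-cong (sym (ι.^-homo r n)) (trans (^-assocʳ θ (toℕ j) n)
                                                 (trans (^-congʳ θ (ℕ.*-comm (toℕ j) n)) (sym (^-assocʳ θ n (toℕ j))))) ⟩
      ι (r k.^ n) * (θ ^ n) ^ toℕ j         ≈⟨ *-congˡ (trans (^-congˡ (toℕ j) θ^n≈a) (sym (ι.^-homo a (toℕ j)))) ⟩
      ι (r k.^ n) * ι (a k.^ toℕ j)         ≈⟨ ι.*-homo _ _ ⟨
      ι (r k.^ n k.* a k.^ toℕ j)           ∎)
      where
      r : k.Carrier
      r = coords y j

  private
    iterate-cong : ∀ t {x y} → x ≈ y → iterate σ x t ≈ iterate σ y t
    iterate-cong zero    e = e
    iterate-cong (suc t) e = iterate-cong t (σ.cong e)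

    σ-iso : RingMorphisms.IsRingIsomorphism rawRing rawRing σ
    σ-iso = record
      { isRingMonomorphism = record
        { isRingHomomorphism = σ-hom
        ; injective = λ {x} {y} e → trans (sym (iterate-order x)) (trans (iterate-cong m e) (iterate-order y))
        }
      ; surjective = λ y → iterate σ y m , λ e → trans (σ.cong e)
          (trans (reflexive (≡.sym (iterate-step m y))) (iterate-order y))
      }

    rotation : extension ≅ extension
    rotation = record { to = σ ; to-iso = σ-iso ; to-ι = σ-ι }

  -- An element fixed by σ alone is already a scalar. An automorphism over k sends θ to an n-th root
  -- of a, hence to some ζ^j θ, and therefore agrees with the j-th iterate of σ.
  isCyclicExtension : a k.≉ k.0# → IsCyclicExtension extension
  isCyclicExtension a≉0 = (λ x fixed → coords x zero , sym (fixed⇒scalar x (fixed rotation))) , rotation , generated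
    where
    θ≉0 : θ ≉ 0#
    θ≉0 e = a≉0 (ι-injective (trans (sym θ^n≈a) (trans (^-congˡ n e) (trans (zeroˡ _) (sym ι.0#-homo)))))
    module Automorphism (to : Carrier → Carrier) (to-hom : RingMorphisms.IsRingHomomorphism rawRing rawRing to)
      (to-ι : ∀ r → to (ι r) ≈ ι r) where
      module to = Homomorphism {R = E} {S = E} to-hom
      power : ∃[ j ] to θ ≈ ι (ζ k.^ toℕ j) * θ
      power = root-of-power {θ} {to θ} θ≉0 (trans (sym (to.^-homo θ n)) (trans (to.cong θ^n≈a) (trans (to-ι a) (sym θ^n≈a))))
      j : Fin n
      j = proj₁ power
      module Rʲ = Rotation (ζ k.^ toℕ j) (root-power (toℕ j))
      iterated : ∀ x → to x ≈ iterate σ x (toℕ j)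
      iterated x = trans
        (hom-ext {B = E} to-hom Rʲ.σ-hom (λ r → trans (to-ι r) (sym (Rʲ.σ-ι r))) (trans (proj₂ power) (sym Rʲ.σ-θ)) x)
        (≈⇐coords λ i → k.trans (Rʲ.coords-σ x i) (k.trans
          (k.*-congʳ (k.trans (k.^-assocʳ ζ (toℕ j) (toℕ i)) (k.trans (k.^-congʳ ζ (ℕ.*-comm (toℕ j) (toℕ i)))
            (k.sym (k.^-assocʳ ζ (toℕ i) (toℕ j)))))) (k.sym (coords-iterate (toℕ j) x i))))
    generated : ∀ (τ : extension ≅ extension) → ∃[ t ] ∀ x → _≅_.to τ x ≈ iterate σ x t
    generated τ = toℕ A.j , A.iterated
      where module A = Automorphism (_≅_.to τ) (RingMorphisms.IsRingIsomorphism.isRingHomomorphism (_≅_.to-iso τ)) (_≅_.to-ι τ)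

  open Rotation ζ ζ-root public using (σ; σ-hom; σ-ι; σ-θ; coords-σ)

-- Fields of fractions, determinants

record IsFractionField (A k : CommutativeRing 0ℓ 0ℓ)
  (fraction : CommutativeRing.Carrier A → CommutativeRing.Carrier k) : Set where
  private module A = CommutativeRingTheory A
  open CommutativeRingTheory k
  field
    fraction-hom       : RingMorphisms.IsRingHomomorphism A.rawRing rawRing fraction
    fraction-injective : ∀ {x y} → fraction x ≈ fraction y → x A.≈ y
    isField            : IsField
    _≟ᶠ_               : ∀ x y → Dec (x ≈ y)
    clear-denominator  : ∀ x → ∃[ d ] ∃[ y ] d A.≉ A.0# × fraction d * x ≈ fraction y

fractions-isFractionField : {A : CommutativeRing 0ℓ 0ℓ} (domain : RingNotions.IsDomain A) →
  (∀ x y → Dec (CommutativeRing._≈_ A x y)) →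
  IsFractionField A (Fractions.fractionField A domain) (Fractions.fraction A domain)
fractions-isFractionField {A} isDomain _≈?_ = record
  { fraction-hom       = fraction-isRingHomomorphism
  ; fraction-injective = injective
  ; isField            = (λ e → proj₁ isDomain (injective {A.1#} {A.0#} e)) , λ x x≉0 → (den x / num x [ num≉0 x x≉0 ])
      , cross (A.trans (A.*-identityʳ _) (A.trans (A.*-comm _ _) (A.sym (A.*-identityˡ _))))
      , cross (A.trans (A.*-identityʳ _) (A.trans (A.*-comm _ _) (A.sym (A.*-identityˡ _))))
  ; _≟ᶠ_               = λ x y → map′ cross crossed ((num x A.* den y) ≈? (num y A.* den x))
  ; clear-denominator  = λ x → den x , num x , den≉0 x
      , cross (A.trans (A.*-identityʳ _) (A.trans (A.*-comm _ _) (A.*-congˡ (A.sym (A.*-identityˡ _)))))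
  }
  where
  module A = CommutativeRingTheory A
  open Fractions A isDomain
  injective : ∀ {x y} → fraction x ≈ᶠ fraction y → x A.≈ y
  injective (cross e) = A.trans (A.sym (A.*-identityʳ _)) (A.trans e (A.*-identityʳ _))
  num≉0 : ∀ x → ¬ x ≈ᶠ fraction A.0# → num x A.≉ A.0#
  num≉0 x x≉0 e = x≉0 (cross (A.trans (A.*-identityʳ _) (A.trans e (A.sym (A.zeroˡ _)))))

module FractionTheory {A k : CommutativeRing 0ℓ 0ℓ} (bezoutDomain : BezoutDomain A)
  {fraction : CommutativeRing.Carrier A → CommutativeRing.Carrier k} (isFractionField : IsFractionField A k fraction) where
  private module A = CommutativeRingTheory A
  open BezoutDomain bezoutDomain
  open BezoutDomainTheory bezoutDomain
  open Roots A isDomain using (*-≉0; cancel-≈)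
  open IsFractionField isFractionField public renaming (isField to fractionField-isField)
  open CommutativeRingTheory k
  open SetoidReasoning setoid
  module fraction = Homomorphism {R = A} {S = k} fraction-hom

  fraction-≈0 : ∀ {x} → fraction x ≈ 0# → x A.≈ A.0#
  fraction-≈0 e = fraction-injective (trans e (sym fraction.0#-homo))

  fractionField-isDomain : IsDomain
  fractionField-isDomain = proj₁ fractionField-isField , zero-product
    where
    zero-product : ∀ x y → x * y ≈ 0# → x ≈ 0# ⊎ y ≈ 0#
    zero-product x y xy≈0 with x ≟ᶠ 0#
    ... | yes x≈0 = inj₁ x≈0
    ... | no x≉0 = let z , zx≈1 , _ = proj₂ fractionField-isField x x≉0 in inj₂ (unit-cancel (z , zx≈1) xy≈0)

  common-denominator : ∀ {n} (x : Fin n → Carrier) →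
    ∃[ d ] d A.≉ A.0# × Σ (Fin n → A.Carrier) λ y → ∀ i → fraction d * x i ≈ fraction (y i)
  common-denominator {zero}  x = A.1# , proj₁ isDomain , (λ ()) , λ ()
  common-denominator {suc n} x with common-denominator (x ∘ suc) | clear-denominator (x zero)
  ... | d , d≉0 , y , e | b , a , b≉0 , bx≈a = d A.* b , *-≉0 d≉0 b≉0 , y′ , e′
    where
    y′ : Fin (suc n) → A.Carrier
    y′ zero    = d A.* a
    y′ (suc i) = b A.* y i
    e′ : ∀ i → fraction (d A.* b) * x i ≈ fraction (y′ i)
    e′ zero    = trans (*-congʳ (fraction.*-homo d b)) (trans (*-assoc _ _ _)
      (trans (*-congˡ bx≈a) (sym (fraction.*-homo d a))))
    e′ (suc i) = trans (*-congʳ (trans (fraction.*-homo d b) (*-comm _ _))) (trans (*-assoc _ _ _)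
      (trans (*-congˡ (e i)) (sym (fraction.*-homo b (y i)))))

  lowest-terms : ∀ x → ∃[ u ] ∃[ v ] Coprime v u × x * fraction v ≈ fraction u
  lowest-terms x with clear-denominator x
  ... | b , a , b≉0 , bx≈a with bezout a b
  ...   | record { gcd = d ; s = s ; t = t ; x′ = u ; y′ = v ; x≈ = a≈ ; y≈ = b≈ ; gcd≈ = d≈ } =
    u , v , (t , s , coprime) , Roots.cancel-≈ k fractionField-isDomain (λ e → d≉0 (fraction-≈0 e)) (begin
      fraction d * (x * fraction v)   ≈⟨ solve 3 (λ d x v → (d :* (x :* v)) := ((d :* v) :* x)) refl _ _ _ ⟩
      (fraction d * fraction v) * x   ≈⟨ *-congʳ (trans (sym (fraction.*-homo d v)) (fraction.cong (A.sym b≈))) ⟩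
      fraction b * x                  ≈⟨ bx≈a ⟩
      fraction a                      ≈⟨ fraction.cong a≈ ⟩
      fraction (d A.* u)              ≈⟨ fraction.*-homo d u ⟩
      fraction d * fraction u         ∎)
    where
    d≉0 : d A.≉ A.0#
    d≉0 e = b≉0 (A.trans b≈ (A.trans (A.*-congʳ e) (A.zeroˡ v)))
    coprime : t A.* v A.+ s A.* u A.≈ A.1#
    coprime = cancel-≈ d≉0 (A.trans
      (A.solve 5 (λ d s t u v → (d A.:* (t A.:* v A.:+ s A.:* u)) A.:= (s A.:* (d A.:* u) A.:+ t A.:* (d A.:* v))) A.refl d s t u v)
      (A.trans (A.+-cong (A.*-congˡ (A.sym a≈)) (A.*-congˡ (A.sym b≈))) (A.trans (A.sym d≈) (A.sym (A.*-identityʳ d)))))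

  private
    module Integral {x : Carrier} {u v : A.Carrier} (cop : Coprime v u) (xV≈U : x * fraction v ≈ fraction u) where
      V U : Carrier
      V = fraction v
      U = fraction u

      power-coprime : ∀ n → Coprime v (u A.^ n)
      power-coprime zero    = A.0# , A.1# , A.trans (A.+-cong (A.zeroˡ _) (A.*-identityˡ _)) (A.+-identityˡ _)
      power-coprime (suc n) = coprime-* cop (power-coprime n)

      lower-terms : ∀ {n} → (Fin n → A.Carrier) → Carrier
      lower-terms c = sum (λ i → fraction (c i) * x ^ toℕ i)

      -- The sum of c_i u^i v^(n-1-i) over i < n. Multiplying the lower terms at x = u/v by v^n
      -- gives v times this sum.
      cofactor : ∀ n → (Fin n → A.Carrier) → A.Carrier
      cofactor zero    c = A.0#
      cofactor (suc n) c = v A.^ n A.* c zero A.+ u A.* cofactor n (c ∘ suc)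

      cofactor-≈ : ∀ n (c : Fin n → A.Carrier) → V ^ n * lower-terms c ≈ fraction (cofactor n c) * V
      cofactor-≈ zero    c = trans (zeroʳ _) (sym (trans (*-congʳ fraction.0#-homo) (zeroˡ V)))
      cofactor-≈ (suc n) c = begin
        V ^ suc n * (fraction (c zero) * 1# + sum (λ i → fraction (c (suc i)) * x ^ suc (toℕ i)))
          ≈⟨ *-congˡ (+-cong (*-identityʳ (fraction (c zero))) shifted) ⟩
        V ^ suc n * (fraction (c zero) + x * S)
          ≈⟨ solve 5 (λ v p c x s → ((v :* p) :* (c :+ x :* s)) := ((p :* c) :* v :+ (x :* v) :* (p :* s))) refl V (V ^ n) (fraction (c zero)) x S ⟩
        (V ^ n * fraction (c zero)) * V + (x * V) * (V ^ n * S)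
          ≈⟨ +-cong (*-congʳ (trans (*-congʳ (sym (fraction.^-homo v n))) (sym (fraction.*-homo (v A.^ n) (c zero))))) (*-cong xV≈U (cofactor-≈ n (c ∘ suc))) ⟩
        fraction (v A.^ n A.* c zero) * V + U * (fraction w * V)
          ≈⟨ +-congˡ (trans (sym (*-assoc U (fraction w) V)) (*-congʳ (sym (fraction.*-homo u w)))) ⟩
        fraction (v A.^ n A.* c zero) * V + fraction (u A.* w) * V   ≈⟨ distribʳ V _ _ ⟨
        (fraction (v A.^ n A.* c zero) + fraction (u A.* w)) * V     ≈⟨ *-congʳ (fraction.+-homo (v A.^ n A.* c zero) (u A.* w)) ⟨
        fraction (v A.^ n A.* c zero A.+ u A.* w) * V                ∎
        where
        S : Carrier
        S = lower-terms (c ∘ suc)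
        w : A.Carrier
        w = cofactor n (c ∘ suc)
        shifted : sum (λ i → fraction (c (suc i)) * x ^ suc (toℕ i)) ≈ x * S
        shifted = trans (sum-cong (λ i → fraction (c (suc i)) * x ^ suc (toℕ i)) (λ i → x * (fraction (c (suc i)) * x ^ toℕ i))
            (λ i → solve 3 (λ c x p → (c :* (x :* p)) := (x :* (c :* p))) refl (fraction (c (suc i))) x (x ^ toℕ i)))
          (sym (*-distribˡ-sum x (λ i → fraction (c (suc i)) * x ^ toℕ i)))

      v∣uⁿ : ∀ n c → x ^ n + lower-terms c ≈ 0# → v A.∣ (u A.^ n)
      v∣uⁿ n c equation = (A.- w) A., fraction-injective (begin
        fraction (A.- w A.* v)                ≈⟨ fraction.*-homo (A.- w) v ⟩
        fraction (A.- w) * V                  ≈⟨ *-congʳ (fraction.-‿homo w) ⟩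
        - fraction w * V                      ≈⟨ -‿distribˡ-* (fraction w) V ⟨
        - (fraction w * V)                    ≈⟨ -‿cong (cofactor-≈ n c) ⟨
        - (V ^ n * lower-terms c)             ≈⟨ -‿distribʳ-* (V ^ n) (lower-terms c) ⟩
        V ^ n * - lower-terms c               ≈⟨ *-congˡ (x+y≈0⇒x≈-y equation) ⟨
        V ^ n * x ^ n                         ≈⟨ trans (*-comm (V ^ n) (x ^ n)) (sym (^-distrib-* x V n)) ⟩
        (x * V) ^ n                           ≈⟨ ^-congˡ n xV≈U ⟩
        U ^ n                                 ≈⟨ fraction.^-homo u n ⟨
        fraction (u A.^ n)                    ∎)
        where
        w : A.Carrier
        w = cofactor n c

      conclude : v A.∣ A.1# → ∃[ r ] fraction r ≈ x
      conclude (r A., rv≈1) = u A.* r , (begin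
        fraction (u A.* r)       ≈⟨ fraction.*-homo u r ⟩
        U * fraction r           ≈⟨ *-congʳ xV≈U ⟨
        x * V * fraction r       ≈⟨ trans (*-assoc x V (fraction r)) (*-congˡ (trans (*-comm V (fraction r)) (sym (fraction.*-homo r v)))) ⟩
        x * fraction (r A.* v)   ≈⟨ *-congˡ (trans (fraction.cong rv≈1) fraction.1#-homo) ⟩
        x * 1#                   ≈⟨ *-identityʳ x ⟩
        x                        ∎)

  -- The rational root theorem: with x = u/v in lowest terms, the monic equation shows that v
  -- divides u^n, to which it is coprime, so v is a unit.
  integral⇒fraction : ∀ {x} n (c : Fin n → A.Carrier) → x ^ n + sum (λ i → fraction (c i) * x ^ toℕ i) ≈ 0# →
                      ∃[ r ] fraction r ≈ x
  integral⇒fraction {x} n c equation = go (lowest-terms x)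
    where
    go : ∃[ u ] ∃[ v ] Coprime v u × x * fraction v ≈ fraction u → ∃[ r ] fraction r ≈ x
    go (u , v , cop , e) = I.conclude (coprime-∣⇒∣1 (I.power-coprime n) A.∣ʳ-refl (I.v∣uⁿ n c equation))
      where module I = Integral {x} {u} {v} cop e

module Determinant (R : CommutativeRing c ℓ) where
  open CommutativeRingTheory R
  open SetoidReasoning setoid

  det-single : ∀ {n} (M : Fin (suc n) → Fin (suc n) → Carrier) j → (∀ k → k ≢ j → M zero k ≈ 0#) →
               det M ≈ (- 1#) ^ toℕ j * (M zero j * det (λ i k → M (suc i) (punchIn j k)))
  det-single M j e = sum-single (λ k → (- 1#) ^ toℕ k * (M zero k * det (λ i l → M (suc i) (punchIn k l)))) j λ k k≢j → trans (*-congˡ (trans (*-congʳ (e k k≢j)) (zeroˡ _))) (zeroʳ _)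

  private
    toℕ-punchIn-last : ∀ n (k : Fin n) → toℕ (punchIn (fromℕ n) k) ≡ toℕ k
    toℕ-punchIn-last (suc n) zero    = ≡.refl
    toℕ-punchIn-last (suc n) (suc k) = ≡.cong suc (toℕ-punchIn-last n k)

  -- Each expansion along the first row leaves an antidiagonal minor. The exponent of the sign stays
  -- unspecified, since a power of -1 is a unit and the discriminant is used only for divisibility.
  det-antidiagonal : ∀ n (M : Fin n → Fin n → Carrier) v →
    (∀ i j → suc (toℕ i ℕ.+ toℕ j) ≡ n → M i j ≈ v) →
    (∀ i j → suc (toℕ i ℕ.+ toℕ j) ≢ n → M i j ≈ 0#) →
    ∃[ e ] det M ≈ (- 1#) ^ e * v ^ n
  det-antidiagonal zero    M v on off = 0 , sym (*-identityʳ 1#)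
  det-antidiagonal (suc n) M v on off with det-antidiagonal n (λ i k → M (suc i) (punchIn (fromℕ n) k)) v
      (λ i k e → on (suc i) (punchIn (fromℕ n) k) (≡.cong suc (≡.trans (≡.cong (λ j → suc (toℕ i ℕ.+ j)) (toℕ-punchIn-last n k)) e)))
      (λ i k e → off (suc i) (punchIn (fromℕ n) k) λ e′ → e (≡.trans (≡.cong (λ j → suc (toℕ i ℕ.+ j)) (≡.sym (toℕ-punchIn-last n k))) (ℕ.suc-injective e′)))
  ... | e , minor = toℕ (fromℕ n) ℕ.+ e , (begin
    det M
      ≈⟨ det-single M (fromℕ n) (λ k k≢n → off zero k λ e → k≢n (Fin.toℕ-injective (≡.trans (ℕ.suc-injective e) (≡.sym (Fin.toℕ-fromℕ n))))) ⟩
    (- 1#) ^ t * (M zero (fromℕ n) * _)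
      ≈⟨ *-congˡ (*-cong (on zero (fromℕ n) (≡.cong suc (Fin.toℕ-fromℕ n))) minor) ⟩
    (- 1#) ^ t * (v * ((- 1#) ^ e * v ^ n))
      ≈⟨ solve 4 (λ a b v w → (a :* (v :* (b :* w))) := ((a :* b) :* (v :* w))) refl _ _ v (v ^ n) ⟩
    ((- 1#) ^ t * (- 1#) ^ e) * v ^ suc n   ≈⟨ *-congʳ (sym (^-homo-* (- 1#) t e)) ⟩
    (- 1#) ^ (t ℕ.+ e) * v ^ suc n          ∎)
    where
    t : ℕ
    t = toℕ (fromℕ n)

-- Integral closures in Kummer extensions

module QuotientTheory (A : CommutativeRing c ℓ) (p : CommutativeRing.Carrier A) where
  open CommutativeRingTheory A
  open Quotient A (principal A p) public using (congruent; quotientRing)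
  open Quotient._≡ᴵ_ public
  private module Q = CommutativeRingTheory quotientRing

  ≈⇒Q≈ : ∀ {x y} → x ≈ y → x Q.≈ y
  ≈⇒Q≈ e = congruent (∣-≈0 (x≈y⇒x-y≈0 e))

  ∣⇒Q≈0 : ∀ {x} → p ∣ x → x Q.≈ 0#
  ∣⇒Q≈0 {x} d = congruent (∣ʳ-respʳ-≈ (sym (trans (+-congˡ -0#≈0#) (+-identityʳ x))) d)

  Q≈0⇒∣ : ∀ {x} → x Q.≈ 0# → p ∣ x
  Q≈0⇒∣ {x} e = ∣ʳ-respʳ-≈ (trans (+-congˡ -0#≈0#) (+-identityʳ x)) (difference e)

  reduction-hom : RingMorphisms.IsRingHomomorphism rawRing (CommutativeRing.rawRing quotientRing) id
  reduction-hom = mkHomomorphism A quotientRing id ≈⇒Q≈ (λ x y → Q.refl) (λ x y → Q.refl) Q.refl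

  private
    quotient-^ : ∀ x n → (x Q.^ n) ≡ (x ^ n)
    quotient-^ x zero    = ≡.refl
    quotient-^ x (suc n) = ≡.cong (x *_) (quotient-^ x n)

    power-fixed : ∀ {m n} x → m ≡ n → (x Q.^ m) Q.≈ x → p ∣ (x ^ n - x)
    power-fixed {m} x ≡.refl e = ≡.subst (λ y → p ∣ (y - x)) (quotient-^ x m) (difference e)

  ∣⇒fixed : ∀ x n → p ∣ (x ^ n - x) → (x Q.^ n) Q.≈ x
  ∣⇒fixed x n d = ≡.subst (Q._≈ x) (≡.sym (quotient-^ x n)) (congruent d)

  fixed⇒∣ : ∀ x n → (x Q.^ n) Q.≈ x → p ∣ (x ^ n - x)
  fixed⇒∣ x n = power-fixed {n} {n} x ≡.refl

  ∣-power-resp : ∀ n {x y} → x Q.≈ y → p ∣ (x ^ n - x) → p ∣ (y ^ n - y)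
  ∣-power-resp n {x} {y} x≈y d = power-fixed {n} {n} y ≡.refl (Q.trans (Q.^-congˡ n (Q.sym x≈y)) (Q.trans (∣⇒fixed x n d) x≈y))

  ≉⇒power-≉ : ∀ {x y} n → x Q.≈ y → (y Q.^ n) Q.≉ 1# → (x Q.^ n) Q.≉ 1#
  ≉⇒power-≉ n x≈y y≉ e = y≉ (Q.trans (Q.^-congˡ n (Q.sym x≈y)) e)

  ∣⇒power-≈1 : ∀ {x} n → p ∣ (x ^ n - 1#) → (x Q.^ n) Q.≈ 1#
  ∣⇒power-≈1 {x} n d = ≡.subst (Q._≈ 1#) (≡.sym (quotient-^ x n)) (congruent d)

  carmichael⇒∣ : ∀ {n} → RingNotions.HasCardinality quotientRing n → IsCarmichaelIdeal A (principal A p) →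
                 ∀ x → p ∣ (x ^ n - x)
  carmichael⇒∣ card (_ , N , N-card , fixed) x = power-fixed x (cardinality-unique {S = Q.setoid} N-card card) (fixed x)

-- A record rather than a synonym, so that it is compared by its parameters and never unfolded.
record IsCarmichaelAt (R : CommutativeRing 0ℓ 0ℓ) (x : CommutativeRing.Carrier R) : Set where
  constructor carmichaelAt
  field isCarmichaelIdeal : IsCarmichaelIdeal R (principal R x)

module IntegralKummer (A k : CommutativeRing 0ℓ 0ℓ) (bezoutDomain : BezoutDomain A)
  (fraction : CommutativeRing.Carrier A → CommutativeRing.Carrier k) (isFractionField : IsFractionField A k fraction) (m : ℕ)
  (ζ : CommutativeRing.Carrier A)
  (ζ-root : CommutativeRing._≈_ A (CommutativeRingTheory._^_ A ζ (suc m)) (CommutativeRing.1# A))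
  (ζ-unit : ∀ (i j : Fin (suc m)) → i ≢ j → CommutativeRingTheory._∣_ A
    (CommutativeRing._-_ A (CommutativeRingTheory._^_ A ζ (toℕ i)) (CommutativeRingTheory._^_ A ζ (toℕ j))) (CommutativeRing.1# A))
  (D P : CommutativeRing.Carrier A)
  (P∤1 : ¬ CommutativeRingTheory._∣_ A P (CommutativeRing.1# A))
  (D≉0 : CommutativeRing._≉_ A D (CommutativeRing.0# A))
  (inert : CommutativeRingTheory.ZeroOrInvertible (Kummer.E (Quotient.quotientRing A (principal A P)) D m))
  where

  private
    module A = CommutativeRingTheory A
    -- Three Kummer rings share the radicand D: B is A[θ], L is its reduction modulo P, and K is the
    -- extension of the fraction field. Elements of K are scaled into B and tested in L.
    module B = Kummer A D m
    module FT = FractionTheory bezoutDomain isFractionField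
    module AQ = QuotientTheory A P
    module L = Kummer (Quotient.quotientRing A (principal A P)) D m
    κ = Quotient.quotientRing A (principal A P)
    module κ = CommutativeRingTheory κ
  open BezoutDomain bezoutDomain
  open BezoutDomainTheory bezoutDomain
  open A using (Irreducible)
  open FT using (fraction-injective; _≟ᶠ_; fractionField-isField)

  private
    module k = CommutativeRingTheory k
    module fraction = FT.fraction
    module K = Kummer k (fraction D) m
    module K-Reasoning = SetoidReasoning K.setoid
    module k-Reasoning = SetoidReasoning k.setoid
    module A-Reasoning = SetoidReasoning A.setoid
    module e = KummerMap {A = A} {A′ = k} {f = fraction} FT.fraction-hom D m
    module r = KummerMap {A = A} {A′ = κ} {f = id} AQ.reduction-hom D m
    module eʰ = Homomorphism {R = B.E} {S = K.E} e.map-hom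
    module rʰ = Homomorphism {R = B.E} {S = L.E} r.map-hom

    embed : B.Carrier → K.Carrier
    embed = e.map

    reduce : B.Carrier → L.Carrier
    reduce = r.map

    reduce-≈0 : ∀ b → reduce b L.≈ L.0# → ∀ i → P A.∣ B.coords b i
    reduce-≈0 b z i = AQ.Q≈0⇒∣ (κ.trans (κ.sym (r.coords-map b i)) (κ.trans (L.coords-cong z i) (L.coords-0 i)))

    reduce-surjective : ∀ y → ∃[ b ] reduce b L.≈ y
    reduce-surjective y = B.combination (L.coords y) , L.trans (r.map-combination (L.coords y)) (L.sym (L.expansion y))

    embed-≈0 : ∀ b → embed b K.≈ K.0# → b B.≈ B.0#
    embed-≈0 b z = B.≈⇐coords λ i → A.trans
      (FT.fraction-≈0 (k.trans (k.sym (e.coords-map b i)) (k.trans (K.coords-cong z i) (K.coords-0 i)))) (A.sym (B.coords-0 i))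

    divide-by : ∀ g b → (∀ i → g A.∣ B.coords b i) → ∃[ b′ ] b B.≈ B.ι g B.* b′
    divide-by g b d = B.combination q , B.≈⇐coords λ i → A.sym (A.trans (B.coords-ι* g (B.combination q) i)
      (A.trans (A.*-congˡ (B.coords-combination q i)) (A.trans (A.*-comm g (q i)) (equality i))))
      where
      q : Fin B.n → A.Carrier
      q i = let s A., _ = d i in s
      equality : ∀ i → q i A.* g A.≈ B.coords b i
      equality i = let _ A., e = d i in e

    zero-or-not : ∀ x → x K.≈ K.0# ⊎ ∃[ i ] K.coords x i k.≉ k.0#
    zero-or-not x = go (Fin.all? (λ i → K.coords x i ≟ᶠ k.0#))
      where
      go : Dec (∀ i → K.coords x i k.≈ k.0#) → x K.≈ K.0# ⊎ ∃[ i ] K.coords x i k.≉ k.0#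
      go (yes z) = inj₁ (K.≈⇐coords λ i → k.trans (z i) (k.sym (K.coords-0 i)))
      go (no ¬z) = inj₂ (Fin.¬∀⟶∃¬ (suc m) _ (λ i → K.coords x i ≟ᶠ k.0#) ¬z)

    divide-by-P : ∀ {x} α b → (∀ i → P A.∣ B.coords b i) → P A.≉ A.0# → α K.* x K.≈ embed b →
                  ∃[ β ] ∃[ b′ ] β K.* x K.≈ embed b′ × b B.≈ B.ι P B.* b′
    divide-by-P {x} α b d P≉0 eq = go (divide-by P b d) (proj₂ fractionField-isField (fraction P) (λ z → P≉0 (FT.fraction-≈0 z)))
      where
      open K-Reasoning
      go : ∃[ b′ ] b B.≈ B.ι P B.* b′ → ∃[ w ] w k.* fraction P k.≈ k.1# × fraction P k.* w k.≈ k.1# →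
           ∃[ β ] ∃[ b′ ] β K.* x K.≈ embed b′ × b B.≈ B.ι P B.* b′
      go (b′ , b≈Pb′) (w , wP≈1 , _) = K.ι w K.* α , b′ , (begin
        (K.ι w K.* α) K.* x                            ≈⟨ K.*-assoc _ _ _ ⟩
        K.ι w K.* (α K.* x)                            ≈⟨ K.*-congˡ (K.trans eq (eʰ.cong b≈Pb′)) ⟩
        K.ι w K.* embed (B.ι P B.* b′)                 ≈⟨ K.*-congˡ (K.trans (eʰ.*-homo _ _) (K.*-congʳ (e.map-ι P))) ⟩
        K.ι w K.* (K.ι (fraction P) K.* embed b′)      ≈⟨ K.*-assoc _ _ _ ⟨
        (K.ι w K.* K.ι (fraction P)) K.* embed b′
          ≈⟨ K.*-congʳ (K.trans (K.sym (K.ι.*-homo _ _)) (K.trans (K.ι.cong wP≈1) K.ι.1#-homo)) ⟩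
        K.1# K.* embed b′                              ≈⟨ K.*-identityˡ _ ⟩
        embed b′                                       ∎) , b≈Pb′

    -- N bounds the multiplicity of P in one fixed coordinate and drops with each division by P, so
    -- the process ends at an element whose reduction is not zero.
    remove-powers : ∀ {x} N b j → ¬ (P A.^ N) A.∣ B.coords b j → ∀ α → α K.* x K.≈ embed b →
                    ∃[ α ] ∃[ b ] α K.* x K.≈ embed b × reduce b L.≉ L.0#
    remove-powers     zero    b j 1∤  α eq = ⊥-elim (1∤ (B.coords b j A., A.*-identityʳ _))
    remove-powers {x} (suc N) b j Pᴺ∤ α eq = go (Fin.all? (λ i → P ∣? B.coords b i))
      where
      go : Dec (∀ i → P A.∣ B.coords b i) → ∃[ α ] ∃[ b ] α K.* x K.≈ embed b × reduce b L.≉ L.0#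
      go (no ¬d) = α , b , eq , λ z → ¬d (reduce-≈0 b z)
      go (yes d) = continue (divide-by-P α b d P≉0 eq)
        where
        P≉0 : P A.≉ A.0#
        P≉0 z = Pᴺ∤ (A.∣ʳ-respʳ-≈ (A.sym (A.0∣x⇒x≈0 (A.∣ʳ-respˡ-≈ z (d j)))) (_ A.∣0))
        continue : ∃[ β ] ∃[ b′ ] β K.* x K.≈ embed b′ × b B.≈ B.ι P B.* b′ →
                   ∃[ α ] ∃[ b ] α K.* x K.≈ embed b × reduce b L.≉ L.0#
        continue (β , b′ , eq′ , b≈Pb′) = remove-powers N b′ j (λ dv → Pᴺ∤ (times dv)) β eq′
          where
          times : (P A.^ N) A.∣ B.coords b′ j → (P A.^ suc N) A.∣ B.coords b j
          times (s A., eq) = s A., A.trans (A.solve 3 (λ s p q → (s A.:* (p A.:* q)) A.:= (p A.:* (s A.:* q))) A.refl s P (P A.^ N))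
            (A.trans (A.*-congˡ eq) (A.sym (A.trans (B.coords-cong b≈Pb′ j) (B.coords-ι* P b′ j))))

    -- Clearing denominators and powers of P makes the image in the residue ring nonzero.
    primitive-multiple : ∀ {x} i → K.coords x i k.≉ k.0# → ∃[ α ] ∃[ b ] α K.* x K.≈ embed b × reduce b L.≉ L.0#
    primitive-multiple {x} i xᵢ≉0 = go (FT.common-denominator (K.coords x))
      where
      go : ∃[ d ] d A.≉ A.0# × Σ (Fin (suc m) → A.Carrier) (λ y → ∀ i → fraction d k.* K.coords x i k.≈ fraction (y i)) →
           ∃[ α ] ∃[ b ] α K.* x K.≈ embed b × reduce b L.≉ L.0#
      go (d , d≉0 , y , cleared) = bounded (multiplicity-bound P∤1 yᵢ≉0)
        where
        yᵢ≉0 : y i A.≉ A.0#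
        yᵢ≉0 z = xᵢ≉0 (Roots.cancel k FT.fractionField-isDomain (λ z′ → d≉0 (FT.fraction-≈0 z′))
          (k.trans (cleared i) (k.trans (fraction.cong z) fraction.0#-homo)))
        start : K.ι (fraction d) K.* x K.≈ embed (B.combination y)
        start = K.≈⇐coords λ j → k.trans (K.coords-ι* _ x j) (k.trans (cleared j)
          (k.sym (k.trans (e.coords-map (B.combination y) j) (fraction.cong (B.coords-combination y j)))))
        bounded : ∃[ N ] ¬ (P A.^ N) A.∣ y i → ∃[ α ] ∃[ b ] α K.* x K.≈ embed b × reduce b L.≉ L.0#
        bounded (N , Pᴺ∤) = remove-powers N (B.combination y) i (λ dv → Pᴺ∤ (A.∣ʳ-respʳ-≈ (B.coords-combination y i) dv))
          (K.ι (fraction d)) start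

    -- Nonzero x and y are scaled to b and b′ in A[θ] with nonzero reductions. If x y = 0, then b b′
    -- = 0 because A[θ] embeds into K, although the reduction of b is invertible by inertness. This
    -- takes the place of an irreducibility criterion for X^n - D.
    K-isDomain : RingNotions.IsDomain K.E
    K-isDomain = (λ z → proj₁ fractionField-isField (K.ι-injective (K.trans K.ι.1#-homo (K.trans z (K.sym K.ι.0#-homo))))) , zero-product
      where
      both-nonzero : ∀ {x y} → ∃[ α ] ∃[ b ] α K.* x K.≈ embed b × reduce b L.≉ L.0# →
                     ∃[ α ] ∃[ b ] α K.* y K.≈ embed b × reduce b L.≉ L.0# → ¬ x K.* y K.≈ K.0#
      both-nonzero {x} {y} (α , b , αx≈b , b≉0) (β , b′ , βy≈b′ , b′≉0) xy≈0 = cases (inert (reduce b))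
        where
        bb′≈0 : embed (b B.* b′) K.≈ K.0#
        bb′≈0 = begin
          embed (b B.* b′)              ≈⟨ eʰ.*-homo b b′ ⟩
          embed b K.* embed b′          ≈⟨ K.*-cong αx≈b βy≈b′ ⟨
          (α K.* x) K.* (β K.* y)
            ≈⟨ K.solve 4 (λ α x β y → ((α K.:* x) K.:* (β K.:* y)) K.:= ((α K.:* β) K.:* (x K.:* y))) K.refl α x β y ⟩
          (α K.* β) K.* (x K.* y)       ≈⟨ K.trans (K.*-congˡ xy≈0) (K.zeroʳ _) ⟩
          K.0#                          ∎
          where open K-Reasoning
        cases : reduce b L.≈ L.0# ⊎ ∃[ z ] z L.* reduce b L.≈ L.1# → ⊥
        cases (inj₁ z)         = b≉0 z
        cases (inj₂ (z , inv)) = b′≉0 (L.unit-cancel (z L., inv) (L.trans (L.sym (rʰ.*-homo b b′))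
          (L.trans (rʰ.cong (embed-≈0 (b B.* b′) bb′≈0)) rʰ.0#-homo)))
      zero-product : ∀ x y → x K.* y K.≈ K.0# → x K.≈ K.0# ⊎ y K.≈ K.0#
      zero-product x y xy≈0 = go (zero-or-not x) (zero-or-not y)
        where
        go : x K.≈ K.0# ⊎ ∃[ i ] K.coords x i k.≉ k.0# → y K.≈ K.0# ⊎ ∃[ i ] K.coords y i k.≉ k.0# → x K.≈ K.0# ⊎ y K.≈ K.0#
        go (inj₁ x≈0) _          = inj₁ x≈0
        go (inj₂ _)   (inj₁ y≈0) = inj₂ y≈0
        go (inj₂ (i , xᵢ≉0)) (inj₂ (j , yⱼ≉0)) = ⊥-elim (both-nonzero (primitive-multiple i xᵢ≉0) (primitive-multiple j yⱼ≉0) xy≈0)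

    ζₖ : k.Carrier
    ζₖ = fraction ζ

    ζₖ-root : ζₖ k.^ suc m k.≈ k.1#
    ζₖ-root = k.trans (k.sym (fraction.^-homo ζ (suc m))) (k.trans (fraction.cong ζ-root) fraction.1#-homo)

    fraction-unit : ∀ {x} → x A.∣ A.1# → fraction x k.≉ k.0#
    fraction-unit (u A., ux≈1) z = proj₁ isDomain (A.trans (A.sym ux≈1) (A.trans (A.*-congˡ (FT.fraction-≈0 z)) (A.zeroʳ u)))

    ζₖ-distinct : ∀ (i j : Fin (suc m)) → i ≢ j → ζₖ k.^ toℕ i k.≉ ζₖ k.^ toℕ j
    ζₖ-distinct i j i≢j z = fraction-unit (ζ-unit i j i≢j) (k.trans (fraction.minus-homo _ _) (k.x≈y⇒x-y≈0
      (k.trans (fraction.^-homo ζ (toℕ i)) (k.trans z (k.sym (fraction.^-homo ζ (toℕ j)))))))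

  private
    module KF = KummerField k fractionField-isField _≟ᶠ_ m ζₖ ζₖ-root ζₖ-distinct (fraction D) K-isDomain
    module σ = Homomorphism {R = K.E} {S = K.E} KF.σ-hom

  open KF public using (extension; isCyclicExtension)
  open KF using (root⇒ratio)

  φ : A.Carrier → K.Carrier
  φ = K.ι ∘ fraction

  φ-hom : RingMorphisms.IsRingHomomorphism A.rawRing K.rawRing φ
  φ-hom = Composition.isRingHomomorphism K.trans FT.fraction-hom K.ι-hom

  module φ = Homomorphism {R = A} {S = K.E} φ-hom

  private module IC = IntegralClosure A K.E φ φ-hom
  open IC using (IsIntegral; Integer; value; _∣integral_)

  private
    abstract
      +-integral : ∀ {x y} → IsIntegral x → IsIntegral y → IsIntegral (x K.+ y)
      +-integral = IC.+-integral

      *-integral : ∀ {x y} → IsIntegral x → IsIntegral y → IsIntegral (x K.* y)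
      *-integral = IC.*-integral

      φ-integral : ∀ r → IsIntegral (φ r)
      φ-integral = IC.φ-integral

      integral-resp : ∀ {x y} → x K.≈ y → IsIntegral x → IsIntegral y
      integral-resp = IC.integral-resp

  private
    scalar-integral : ∀ {x} → IsIntegral (K.ι x) → ∃[ r ] fraction r k.≈ x
    scalar-integral {x} (N , c , eq) = FT.integral⇒fraction N c (K.ι-injective (begin
      K.ι (x k.^ N k.+ k.sum (λ i → fraction (c i) k.* x k.^ toℕ i))        ≈⟨ K.ι.+-homo _ _ ⟩
      K.ι (x k.^ N) K.+ K.ι (k.sum (λ i → fraction (c i) k.* x k.^ toℕ i))
        ≈⟨ K.+-cong (K.ι.^-homo x N) (K.trans (K.ι.sum-homo (λ i → fraction (c i) k.* x k.^ toℕ i))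
             (K.sum-cong (λ i → K.ι (fraction (c i) k.* x k.^ toℕ i)) (λ i → φ (c i) K.* K.ι x K.^ toℕ i) λ i →
               K.trans (K.ι.*-homo (fraction (c i)) (x k.^ toℕ i)) (K.*-congˡ (K.ι.^-homo x (toℕ i))))) ⟩
      K.ι x K.^ N K.+ K.sum (λ i → φ (c i) K.* K.ι x K.^ toℕ i)             ≈⟨ eq ⟩
      K.0#                                                                 ≈⟨ K.ι.0#-homo ⟨
      K.ι k.0#                                                             ∎))
      where open K-Reasoning

    σ-integral : ∀ {x} → IsIntegral x → IsIntegral (KF.σ x)
    σ-integral {x} (N , c , eq) = N , c , (begin
      KF.σ x K.^ N K.+ K.sum (λ i → φ (c i) K.* KF.σ x K.^ toℕ i)
        ≈⟨ K.+-cong (σ.^-homo x N) (K.trans (σ.sum-homo (λ i → φ (c i) K.* x K.^ toℕ i))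
             (K.sum-cong (λ i → KF.σ (φ (c i) K.* x K.^ toℕ i)) (λ i → φ (c i) K.* KF.σ x K.^ toℕ i) λ i →
               K.trans (σ.*-homo (φ (c i)) (x K.^ toℕ i)) (K.*-cong (KF.σ-ι (fraction (c i))) (σ.^-homo x (toℕ i))))) ⟨
      KF.σ (x K.^ N) K.+ KF.σ (K.sum (λ i → φ (c i) K.* x K.^ toℕ i))      ≈⟨ σ.+-homo _ _ ⟨
      KF.σ (x K.^ N K.+ K.sum (λ i → φ (c i) K.* x K.^ toℕ i))             ≈⟨ σ.cong eq ⟩
      KF.σ K.0#                                                            ≈⟨ σ.0#-homo ⟩
      K.0#                                                                 ∎)
      where open K-Reasoning

    0-integral : IsIntegral K.0#
    0-integral = integral-resp φ.0#-homo (φ-integral A.0#)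

    1-integral : IsIntegral K.1#
    1-integral = integral-resp φ.1#-homo (φ-integral A.1#)

    sum-integral : ∀ {N} (f : Fin N → K.Carrier) → (∀ i → IsIntegral (f i)) → IsIntegral (K.sum f)
    sum-integral {zero}  f int = 0-integral
    sum-integral {suc N} f int = +-integral (int zero) (sum-integral (f ∘ suc) (int ∘ suc))

    ^-integral : ∀ {x} N → IsIntegral x → IsIntegral (x K.^ N)
    ^-integral zero    int = 1-integral
    ^-integral (suc N) int = *-integral int (^-integral N int)

    θ-integral : IsIntegral K.θ
    θ-integral = suc m , equation , (begin
      K.θ K.^ suc m K.+ K.sum (λ i → φ (equation i) K.* K.θ K.^ toℕ i)
        ≈⟨ K.+-cong K.θ^n≈a (sum-first (λ i → φ (equation i) K.* K.θ K.^ toℕ i) λ i → K.trans (K.*-congʳ φ.0#-homo) (K.zeroˡ _)) ⟩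
      φ D K.+ φ (A.- D) K.* K.1#      ≈⟨ K.+-congˡ (K.trans (K.*-identityʳ _) (φ.-‿homo D)) ⟩
      φ D K.- φ D                     ≈⟨ K.-‿inverseʳ _ ⟩
      K.0#                            ∎)
      where
      open K-Reasoning
      equation : Fin (suc m) → A.Carrier
      equation zero    = A.- D
      equation (suc i) = A.0#
      sum-first : ∀ {N} (f : Fin (suc N) → K.Carrier) → (∀ i → f (suc i) K.≈ K.0#) → K.sum f K.≈ f zero
      sum-first {N} f z = K.trans (K.+-congˡ (K.sum-0 {N} (f ∘ suc) z)) (K.+-identityʳ _)

    embed-integral : ∀ b → IsIntegral (embed b)
    embed-integral b = integral-resp (K.sym (K.trans (eʰ.cong (B.expansion b)) (e.map-combination (B.coords b))))
      (sum-integral (λ i → φ (B.coords b i) K.* K.θ K.^ toℕ i) λ i → *-integral (φ-integral (B.coords b i)) (^-integral (toℕ i) θ-integral))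

    weight : ∀ {t} → (Fin t → Fin (suc m)) → Fin (suc m) → A.Carrier
    weight {zero}  js i = A.1#
    weight {suc t} js i = (ζ A.^ toℕ i A.- ζ A.^ toℕ (js zero)) A.* weight (js ∘ suc) i

    -- Applying the operators σ - ζʲ to x scales its i-th coordinate by ζⁱ - ζʲ.
    filtered : ∀ {t} (js : Fin t → Fin (suc m)) {x} → IsIntegral x →
               ∃[ y ] IsIntegral y × (∀ i → K.coords y i k.≈ fraction (weight js i) k.* K.coords x i)
    filtered {zero}  js {x} int = x , int , λ i → k.sym (k.trans (k.*-congʳ fraction.1#-homo) (k.*-identityˡ _))
    filtered {suc t} js {x} int = go (filtered (js ∘ suc) int)
      where
      open k-Reasoning
      ζʲ : A.Carrier
      ζʲ = ζ A.^ toℕ (js zero)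
      go : ∃[ y ] IsIntegral y × (∀ i → K.coords y i k.≈ fraction (weight (js ∘ suc) i) k.* K.coords x i) →
           ∃[ y ] IsIntegral y × (∀ i → K.coords y i k.≈ fraction (weight js i) k.* K.coords x i)
      go (y , y-int , eq) = KF.σ y K.+ φ (A.- ζʲ) K.* y
        , +-integral (σ-integral y-int) (*-integral (φ-integral (A.- ζʲ)) y-int)
        , λ i → begin
          K.coords (KF.σ y K.+ φ (A.- ζʲ) K.* y) i
            ≈⟨ k.trans (K.coords-+ _ _ i) (k.+-cong (KF.coords-σ y i) (K.coords-ι* _ y i)) ⟩
          ζₖ k.^ toℕ i k.* K.coords y i k.+ fraction (A.- ζʲ) k.* K.coords y i
            ≈⟨ k.trans (k.+-congʳ (k.*-congʳ (k.sym (fraction.^-homo ζ (toℕ i))))) (k.sym (k.distribʳ _ _ _)) ⟩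
          (fraction (ζ A.^ toℕ i) k.+ fraction (A.- ζʲ)) k.* K.coords y i
            ≈⟨ k.*-cong (k.sym (fraction.+-homo _ _)) (eq i) ⟩
          fraction (ζ A.^ toℕ i A.- ζʲ) k.* (fraction (weight (js ∘ suc) i) k.* K.coords x i)
            ≈⟨ k.trans (k.sym (k.*-assoc _ _ _)) (k.*-congʳ (k.sym (fraction.*-homo (ζ A.^ toℕ i A.- ζʲ) (weight (js ∘ suc) i)))) ⟩
          fraction (weight js i) k.* K.coords x i ∎

    weight-unit : ∀ {t} (js : Fin t → Fin (suc m)) i → (∀ s → i ≢ js s) → weight js i A.∣ A.1#
    weight-unit {zero}  js i ≢ = A.∣ʳ-refl
    weight-unit {suc t} js i ≢ = A.unit-* (ζ-unit i (js zero) (≢ zero)) (weight-unit (js ∘ suc) i (≢ ∘ suc))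

    weight-≈0 : ∀ {t} (js : Fin t → Fin (suc m)) s → weight js (js s) A.≈ A.0#
    weight-≈0 js zero    = A.trans (A.*-congʳ (A.-‿inverseʳ _)) (A.zeroˡ _)
    weight-≈0 js (suc s) = A.trans (A.*-congˡ (weight-≈0 (js ∘ suc) s)) (A.zeroʳ _)

    -- `punchIn i` runs through all exponents except i, so only the term c θ^i of y survives.
    -- Multiplication by θ^(n-i) turns it into the integral scalar c D, which lies in A because A is
    -- integrally closed.
    filtered-coordinate : ∀ {x y} i → IsIntegral y → (∀ j → K.coords y j k.≈ fraction (weight (punchIn i) j) k.* K.coords x j) →
                          ∃[ s ] fraction s k.≈ K.coords y i k.* fraction D
    filtered-coordinate {x} {y} i y-int eq =
      scalar-integral (integral-resp y-scaled (*-integral y-int (^-integral (suc m ℕ.∸ toℕ i) θ-integral)))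
      where
      open K-Reasoning
      vanishes : ∀ j → j ≢ i → K.coords y j k.≈ k.0#
      vanishes j j≢i = k.trans (eq j) (k.trans (k.*-congʳ (k.trans (fraction.cong
        (≡.subst (λ j → weight (punchIn i) j A.≈ A.0#) (Fin.punchIn-punchOut (j≢i ∘ ≡.sym)) (weight-≈0 (punchIn i) (punchOut (j≢i ∘ ≡.sym)))))
        fraction.0#-homo)) (k.zeroˡ _))
      y-scaled : y K.* K.θ K.^ (suc m ℕ.∸ toℕ i) K.≈ K.ι (K.coords y i k.* fraction D)
      y-scaled = begin
        y K.* K.θ K.^ (suc m ℕ.∸ toℕ i)
          ≈⟨ K.*-congʳ (K.single-coordinate y i vanishes) ⟩
        (K.ι (K.coords y i) K.* K.θ K.^ toℕ i) K.* K.θ K.^ (suc m ℕ.∸ toℕ i)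
          ≈⟨ K.trans (K.*-assoc _ _ _) (K.*-congˡ (K.sym (K.^-homo-* K.θ (toℕ i) (suc m ℕ.∸ toℕ i)))) ⟩
        K.ι (K.coords y i) K.* K.θ K.^ (toℕ i ℕ.+ (suc m ℕ.∸ toℕ i))
          ≈⟨ K.*-congˡ (K.trans (K.^-congʳ K.θ (ℕ.m+[n∸m]≡n (ℕ.<⇒≤ (Fin.toℕ<n i)))) K.θ^n≈a) ⟩
        K.ι (K.coords y i) K.* K.ι (fraction D)    ≈⟨ K.ι.*-homo _ _ ⟨
        K.ι (K.coords y i k.* fraction D)          ∎

  abstract
    -- D times the ring of integers is contained in A[θ].
    integral-coordinate : ∀ {x} → IsIntegral x → ∀ i → ∃[ r ] fraction r k.≈ fraction D k.* K.coords x i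
    integral-coordinate {x} int i = go (filtered (punchIn i) int)
      where
      w : A.Carrier
      w = weight (punchIn i) i
      conclude : ∀ {y} → K.coords y i k.≈ fraction w k.* K.coords x i → ∃[ s ] fraction s k.≈ K.coords y i k.* fraction D →
                 w A.∣ A.1# → ∃[ r ] fraction r k.≈ fraction D k.* K.coords x i
      conclude {y} eq (s , s≈) (u A., uw≈1) = u A.* s , (begin
        fraction (u A.* s)                                       ≈⟨ fraction.*-homo u s ⟩
        fraction u k.* fraction s                                ≈⟨ k.*-congˡ (k.trans s≈ (k.*-congʳ eq)) ⟩
        fraction u k.* ((fraction w k.* K.coords x i) k.* fraction D)
          ≈⟨ k.solve 4 (λ u w x d → (u k.:* ((w k.:* x) k.:* d)) k.:= ((u k.:* w) k.:* (d k.:* x))) k.refl _ _ _ _ ⟩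
        (fraction u k.* fraction w) k.* (fraction D k.* K.coords x i)
          ≈⟨ k.*-congʳ (k.trans (k.sym (fraction.*-homo u w)) (k.trans (fraction.cong uw≈1) fraction.1#-homo)) ⟩
        k.1# k.* (fraction D k.* K.coords x i)                   ≈⟨ k.*-identityˡ _ ⟩
        fraction D k.* K.coords x i                              ∎)
        where open k-Reasoning
      go : ∃[ y ] IsIntegral y × (∀ j → K.coords y j k.≈ fraction (weight (punchIn i) j) k.* K.coords x j) →
           ∃[ r ] fraction r k.≈ fraction D k.* K.coords x i
      go (y , y-int , eq) = conclude (eq i) (filtered-coordinate i y-int eq)
        (weight-unit (punchIn i) i (λ s e → Fin.punchInᵢ≢i i s (≡.sym e)))

  -- The ring of integers enters only through an injective homomorphism onto the integral elements,
  -- so all computations take place with values in K.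
  module Integers (𝒪 : CommutativeRing 0ℓ 0ℓ) (value : CommutativeRing.Carrier 𝒪 → K.Carrier)
    (value-hom : RingMorphisms.IsRingHomomorphism (CommutativeRing.rawRing 𝒪) K.rawRing value)
    (value-injective : ∀ {x y} → value x K.≈ value y → CommutativeRing._≈_ 𝒪 x y)
    (integral : ∀ x → IsIntegral (value x))
    (integer : ∀ {x} → IsIntegral x → ∃[ y ] value y K.≈ x)
    (base : A.Carrier → CommutativeRing.Carrier 𝒪)
    (value-base : ∀ r → value (base r) K.≈ φ r)
    where

    private
      module 𝒪 = CommutativeRingTheory 𝒪
      module value = Homomorphism {R = 𝒪} {S = K.E} value-hom

      numerators : 𝒪.Carrier → Fin (suc m) → A.Carrier
      numerators x i = proj₁ (integral-coordinate (integral x) i)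

      numerators-≈ : ∀ x i → fraction (numerators x i) k.≈ fraction D k.* K.coords (value x) i
      numerators-≈ x i = proj₂ (integral-coordinate (integral x) i)

      D-multiple : ∀ x → φ D K.* value x K.≈ embed (B.combination (numerators x))
      D-multiple x = K.≈⇐coords λ i → k.trans (K.coords-ι* _ (value x) i) (k.trans (k.sym (numerators-≈ x i))
        (k.sym (k.trans (e.coords-map (B.combination (numerators x)) i) (fraction.cong (B.coords-combination (numerators x) i)))))

      embedding : B.Carrier → 𝒪.Carrier
      embedding b = proj₁ (integer (embed-integral b))

      value-embedding : ∀ b → value (embedding b) K.≈ embed b
      value-embedding b = proj₂ (integer (embed-integral b))

      value-base-* : ∀ r x → value (base r 𝒪.* x) K.≈ φ r K.* value x
      value-base-* r x = K.trans (value.*-homo (base r) x) (K.*-congʳ (value-base r))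

      value-*-base : ∀ r x → value (x 𝒪.* base r) K.≈ value x K.* φ r
      value-*-base r x = K.trans (value.*-homo x (base r)) (K.*-congˡ (value-base r))

      coords-minus : ∀ x y i → K.coords (x K.- y) i k.≈ K.coords x i k.- K.coords y i
      coords-minus x y i = k.trans (K.coords-cong (K.+-congˡ (K.trans (K.sym (K.-1*x≈-x y))
          (K.*-congʳ (K.sym (K.trans (K.ι.-‿homo k.1#) (K.-‿cong K.ι.1#-homo)))))) i)
        (k.trans (K.coords-+ _ _ i) (k.+-congˡ (k.trans (K.coords-ι* _ y i) (k.-1*x≈-x _))))

    module _ {g} (coprime : Coprime D g) where
      private
        u v : A.Carrier
        u = proj₁ coprime
        v = proj₁ (proj₂ coprime)
        bezout-≈ : u A.* D A.+ v A.* g A.≈ A.1#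
        bezout-≈ = proj₂ (proj₂ coprime)
        module Q = QuotientTheory 𝒪 (base g)
        module Q′ = CommutativeRingTheory Q.quotientRing
        module R = QuotientTheory A g
        module R′ = CommutativeRing R.quotientRing

        cancel-D : ∀ {x} → g A.∣ (D A.* x) → g A.∣ x
        cancel-D = coprime-divides (coprime-sym coprime)

        -- This is u D + v g = 1 applied to x: modulo g, an integer x agrees with u (D x), and D x
        -- lies in A[θ]. So 𝒪/g can be compared with A[θ]/g without determining 𝒪.
        split-unit : ∀ x → x K.≈ φ u K.* (φ D K.* x) K.+ φ v K.* (φ g K.* x)
        split-unit x = begin
          x                                                    ≈⟨ K.*-identityˡ x ⟨
          K.1# K.* x
            ≈⟨ K.*-congʳ (K.trans (K.sym φ.1#-homo) (K.trans (φ.cong (A.sym bezout-≈)) (K.trans (φ.+-homo _ _) (K.+-cong (φ.*-homo u D) (φ.*-homo v g))))) ⟩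
          (φ u K.* φ D K.+ φ v K.* φ g) K.* x
            ≈⟨ K.solve 5 (λ u d v g x → ((u K.:* d K.:+ v K.:* g) K.:* x) K.:= (u K.:* (d K.:* x) K.:+ v K.:* (g K.:* x))) K.refl _ _ _ _ x ⟩
          φ u K.* (φ D K.* x) K.+ φ v K.* (φ g K.* x)          ∎
          where open K-Reasoning

        numerator-multiple : ∀ y {x} → value y K.* φ g K.≈ x → ∀ i → fraction (numerators y i A.* g) k.≈ fraction D k.* K.coords x i
        numerator-multiple y {x} e i = begin
          fraction (numerators y i A.* g)                            ≈⟨ fraction.*-homo (numerators y i) g ⟩
          fraction (numerators y i) k.* fraction g                   ≈⟨ k.*-congʳ (numerators-≈ y i) ⟩
          fraction D k.* K.coords (value y) i k.* fraction g
            ≈⟨ k.trans (k.*-assoc _ _ _) (k.*-congˡ (k.trans (k.*-comm _ _) (k.sym (K.coords-ι* (fraction g) (value y) i)))) ⟩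
          fraction D k.* K.coords (φ g K.* value y) i
            ≈⟨ k.*-congˡ (K.coords-cong (K.trans (K.*-comm _ _) e) i) ⟩
          fraction D k.* K.coords x i                                ∎
          where open k-Reasoning

      -- If x = y g in 𝒪, the coordinate j shows that D r is g times a numerator of y, and D is
      -- prime to g. The case j = 0 serves elements of A, the case j = 1 multiples of θ.
      monomial-divisible : ∀ r j x → base g 𝒪.∣ x → value x K.≈ φ r K.* K.θ K.^ toℕ j → g A.∣ r
      monomial-divisible r j x (y 𝒪., yg≈x) x≈ = cancel-D (numerators y j A., fraction-injective (k.trans
        (numerator-multiple y (K.trans (K.sym (value-*-base g y)) (K.trans (value.cong yg≈x) x≈)) j)
        (k.trans (k.*-congˡ (k.trans (K.coords-monomial (fraction r) j j) (k.trans (k.*-congˡ (K.δ-diagonal j)) (k.*-identityʳ _))))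
          (k.sym (fraction.*-homo D r)))))

      base-divisible : ∀ r x → base g 𝒪.∣ x → value x K.≈ φ r → g A.∣ r
      base-divisible r x d x≈ = monomial-divisible r zero x d (K.trans x≈ (K.sym (K.*-identityʳ _)))

      -- The reduction of D x is zero or invertible. If it is zero, then g divides D x and hence x.
      -- Otherwise its inverse lifts to some z′ in A[θ], and z′ D inverts x modulo g.
      quotient-isField : P A.∣ g → g A.∣ P → RingNotions.IsField Q.quotientRing
      quotient-isField P∣g g∣P = 1≉0 , invert
        where
        1≉0 : 𝒪.1# Q′.≉ 𝒪.0#
        1≉0 z = P∤1 (A.∣ʳ-trans P∣g (base-divisible A.1# 𝒪.1# (Q.Q≈0⇒∣ z) (K.trans value.1#-homo (K.sym φ.1#-homo))))
        associated : ∀ b → reduce b L.≈ L.0# → ∃[ b′ ] embed b K.≈ φ g K.* embed b′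
        associated b z = go (divide-by g b (λ i → A.∣ʳ-trans g∣P (reduce-≈0 b z i)))
          where
          go : ∃[ b′ ] b B.≈ B.ι g B.* b′ → ∃[ b′ ] embed b K.≈ φ g K.* embed b′
          go (b′ , b≈gb′) = b′ , K.trans (eʰ.cong b≈gb′) (K.trans (eʰ.*-homo _ _) (K.*-congʳ (e.map-ι g)))
        invert : ∀ x → x Q′.≉ 𝒪.0# → ∃[ y ] y Q′.* x Q′.≈ 𝒪.1# × x Q′.* y Q′.≈ 𝒪.1#
        invert x x≉0 = cases (inert (reduce b))
          where
          open K-Reasoning
          b : B.Carrier
          b = B.combination (numerators x)
          vanishing : ∃[ b′ ] embed b K.≈ φ g K.* embed b′ → x Q′.≈ 𝒪.0#
          vanishing (b′ , b≈gb′) = Q.∣⇒Q≈0 (w 𝒪., value-injective (begin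
            value (w 𝒪.* base g)                                      ≈⟨ value-*-base g w ⟩
            value w K.* φ g
              ≈⟨ K.*-congʳ (K.trans (value.+-homo _ _) (K.+-cong (K.trans (value-base-* u _) (K.*-congˡ (value-embedding b′))) (value-base-* v x))) ⟩
            (φ u K.* embed b′ K.+ φ v K.* value x) K.* φ g
              ≈⟨ K.solve 5 (λ u g b v x → ((u K.:* b K.:+ v K.:* x) K.:* g) K.:= (u K.:* (g K.:* b) K.:+ v K.:* (g K.:* x))) K.refl _ _ _ _ _ ⟩
            φ u K.* (φ g K.* embed b′) K.+ φ v K.* (φ g K.* value x)
              ≈⟨ K.+-congʳ (K.*-congˡ (K.trans (D-multiple x) b≈gb′)) ⟨
            φ u K.* (φ D K.* value x) K.+ φ v K.* (φ g K.* value x)   ≈⟨ split-unit (value x) ⟨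
            value x                                                   ∎))
            where
            w : 𝒪.Carrier
            w = base u 𝒪.* embedding b′ 𝒪.+ base v 𝒪.* x
          inverse-from : ∀ z′ → ∃[ w ] embed (z′ B.* b B.- B.1#) K.≈ φ g K.* embed w →
                         ∃[ y ] y Q′.* x Q′.≈ 𝒪.1# × x Q′.* y Q′.≈ 𝒪.1#
          inverse-from z′ (w , eq) = y , inverseˡ , Q′.trans (Q′.*-comm x y) inverseˡ
            where
            y : 𝒪.Carrier
            y = embedding z′ 𝒪.* base D
            inverseˡ : y Q′.* x Q′.≈ 𝒪.1#
            inverseˡ = Q.congruent (embedding w 𝒪., value-injective (begin
              value (embedding w 𝒪.* base g)              ≈⟨ K.trans (value-*-base g (embedding w)) (K.*-congʳ (value-embedding w)) ⟩
              embed w K.* φ g                             ≈⟨ K.*-comm _ _ ⟩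
              φ g K.* embed w                             ≈⟨ eq ⟨
              embed (z′ B.* b B.- B.1#)                   ≈⟨ eʰ.minus-homo _ _ ⟩
              embed (z′ B.* b) K.- embed B.1#             ≈⟨ K.+-cong (eʰ.*-homo z′ b) (K.-‿cong eʰ.1#-homo) ⟩
              embed z′ K.* embed b K.- K.1#               ≈⟨ K.+-cong (K.*-cong (value-embedding z′) (D-multiple x)) (K.-‿cong value.1#-homo) ⟨
              value (embedding z′) K.* (φ D K.* value x) K.- value 𝒪.1#
                ≈⟨ K.+-congʳ (K.trans (value.*-homo y x) (K.trans (K.*-congʳ (value-*-base D _)) (K.*-assoc _ _ _))) ⟨
              value (y 𝒪.* x) K.- value 𝒪.1#              ≈⟨ value.minus-homo _ _ ⟨
              value (y 𝒪.* x 𝒪.- 𝒪.1#)                    ∎))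
          lifted : ∀ z → z L.* reduce b L.≈ L.1# → ∃[ z′ ] reduce z′ L.≈ z → ∃[ y ] y Q′.* x Q′.≈ 𝒪.1# × x Q′.* y Q′.≈ 𝒪.1#
          lifted z zb≈1 (z′ , z′≈z) = inverse-from z′ (associated (z′ B.* b B.- B.1#) (L.trans (rʰ.minus-homo _ _) (L.x≈y⇒x-y≈0
              (L.trans (rʰ.*-homo z′ b) (L.trans (L.*-congʳ z′≈z) (L.trans zb≈1 (L.sym rʰ.1#-homo)))))))
          cases : reduce b L.≈ L.0# ⊎ ∃[ z ] z L.* reduce b L.≈ L.1# → ∃[ y ] y Q′.* x Q′.≈ 𝒪.1# × x Q′.* y Q′.≈ 𝒪.1#
          cases (inj₁ z)          = ⊥-elim (x≉0 (vanishing (associated b z)))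
          cases (inj₂ (z , zb≈1)) = lifted z zb≈1 (reduce-surjective z)

      -- The numerators of x modulo g serve as coordinates on 𝒪/g. They carry a factor D, so the
      -- inverse map multiplies each coefficient by u, the inverse of D modulo g.
      quotient-cardinality : ∀ {M} → RingNotions.HasCardinality R.quotientRing M →
                             RingNotions.HasCardinality Q.quotientRing (M ℕ.^ suc m)
      quotient-cardinality card = Compose.inverse
        (mkInverse {S = Q′.setoid} {T = functionSetoid {S = R′.setoid} (suc m)} numerators from
          (λ {x} {y} → to-cong {x} {y}) (λ {c} {d} → from-cong {c} {d}) to-from from-to)
        (function-cardinality {S = R′.setoid} (suc m) card)
        where
        scaled : (Fin (suc m) → A.Carrier) → B.Carrier
        scaled c = B.combination (λ i → u A.* c i)
        from : (Fin (suc m) → A.Carrier) → 𝒪.Carrier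
        from c = embedding (scaled c)
        to-cong : ∀ {x y} → x Q′.≈ y → ∀ i → numerators x i R′.≈ numerators y i
        to-cong {x} {y} x≈y i = go (Q.difference x≈y)
          where
          open k-Reasoning
          go : base g 𝒪.∣ (x 𝒪.- y) → numerators x i R′.≈ numerators y i
          go (s 𝒪., sg≈) = R.congruent (numerators s i A., fraction-injective (begin
            fraction (numerators s i A.* g)
              ≈⟨ numerator-multiple s (K.trans (K.sym (value-*-base g s)) (K.trans (value.cong sg≈) (value.minus-homo x y))) i ⟩
            fraction D k.* K.coords (value x K.- value y) i
              ≈⟨ k.*-congˡ (coords-minus (value x) (value y) i) ⟩
            fraction D k.* (K.coords (value x) i k.- K.coords (value y) i)
              ≈⟨ k.solve 3 (λ d x y → (d k.:* (x k.:- y)) k.:= (d k.:* x k.:- d k.:* y)) k.refl _ _ _ ⟩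
            fraction D k.* K.coords (value x) i k.- fraction D k.* K.coords (value y) i
              ≈⟨ k.+-cong (numerators-≈ x i) (k.-‿cong (numerators-≈ y i)) ⟨
            fraction (numerators x i) k.- fraction (numerators y i)   ≈⟨ fraction.minus-homo _ _ ⟨
            fraction (numerators x i A.- numerators y i)              ∎))
        from-cong : ∀ {c d} → (∀ i → c i R′.≈ d i) → from c Q′.≈ from d
        from-cong {c} {d} c≈d = go (divide-by g (scaled c B.- scaled d) λ i →
            A.∣ʳ-respʳ-≈ (A.sym (A.trans (coords-minus′ (scaled c) (scaled d) i)
              (A.trans (A.+-cong (B.coords-combination (λ i → u A.* c i) i) (A.-‿cong (B.coords-combination (λ i → u A.* d i) i)))
                (A.solve 3 (λ u c d → (u A.:* c A.:- u A.:* d) A.:= (u A.:* (c A.:- d))) A.refl u (c i) (d i)))))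
              (A.∣-*ˡ u (R.difference (c≈d i))))
          where
          open K-Reasoning
          coords-minus′ : ∀ x y i → B.coords (x B.- y) i A.≈ B.coords x i A.- B.coords y i
          coords-minus′ x y i = A.trans (B.coords-cong (B.+-congˡ (B.trans (B.sym (B.-1*x≈-x y))
              (B.*-congʳ (B.sym (B.trans (B.ι.-‿homo A.1#) (B.-‿cong B.ι.1#-homo)))))) i)
            (A.trans (B.coords-+ _ _ i) (A.+-congˡ (A.trans (B.coords-ι* _ y i) (A.-1*x≈-x _))))
          go : ∃[ b′ ] scaled c B.- scaled d B.≈ B.ι g B.* b′ → from c Q′.≈ from d
          go (b′ , eq) = Q.congruent (embedding b′ 𝒪., value-injective (begin
            value (embedding b′ 𝒪.* base g)           ≈⟨ K.trans (value-*-base g _) (K.*-congʳ (value-embedding b′)) ⟩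
            embed b′ K.* φ g                          ≈⟨ K.trans (K.*-comm _ _) (K.*-congʳ (K.sym (e.map-ι g))) ⟩
            embed (B.ι g) K.* embed b′                ≈⟨ eʰ.*-homo _ _ ⟨
            embed (B.ι g B.* b′)                      ≈⟨ eʰ.cong eq ⟨
            embed (scaled c B.- scaled d)             ≈⟨ eʰ.minus-homo _ _ ⟩
            embed (scaled c) K.- embed (scaled d)     ≈⟨ K.+-cong (value-embedding _) (K.-‿cong (value-embedding _)) ⟨
            value (from c) K.- value (from d)         ≈⟨ value.minus-homo _ _ ⟨
            value (from c 𝒪.- from d)                 ∎))
        to-from : ∀ c i → numerators (from c) i R′.≈ c i
        to-from c i = R.congruent ((A.- (v A.* c i)) A., A.sym (begin
          numerators (from c) i A.- c i      ≈⟨ A.+-congʳ (fraction-injective value-≈) ⟩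
          D A.* (u A.* c i) A.- c i
            ≈⟨ A.+-congˡ (A.-‿cong (A.trans (A.sym (A.*-identityˡ (c i))) (A.*-congʳ (A.sym bezout-≈)))) ⟩
          D A.* (u A.* c i) A.- (u A.* D A.+ v A.* g) A.* c i
            ≈⟨ A.solve 5 (λ d u c v g → (d A.:* (u A.:* c) A.:- (u A.:* d A.:+ v A.:* g) A.:* c) A.:= (A.:- (v A.:* c) A.:* g)) A.refl D u (c i) v g ⟩
          A.- (v A.* c i) A.* g              ∎))
          where
          open A-Reasoning
          value-≈ : fraction (numerators (from c) i) k.≈ fraction (D A.* (u A.* c i))
          value-≈ = k.trans (numerators-≈ (from c) i) (k.trans (k.*-congˡ (k.trans (K.coords-cong (value-embedding (scaled c)) i)
            (k.trans (e.coords-map (scaled c) i) (fraction.cong (B.coords-combination (λ i → u A.* c i) i))))) (k.sym (fraction.*-homo D (u A.* c i))))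
        from-to : ∀ x → from (numerators x) Q′.≈ x
        from-to x = Q.congruent ((𝒪.- (base v 𝒪.* x)) 𝒪., value-injective (begin
          value ((𝒪.- (base v 𝒪.* x)) 𝒪.* base g)
            ≈⟨ K.trans (value-*-base g _) (K.*-congʳ (K.trans (value.-‿homo _) (K.-‿cong (value-base-* v x)))) ⟩
          K.- (φ v K.* value x) K.* φ g
            ≈⟨ K.solve 4 (λ s v g x → (s K.:- (s K.:+ v K.:* (g K.:* x))) K.:= (K.:- (v K.:* x) K.:* g)) K.refl (φ u K.* (φ D K.* value x)) _ _ _ ⟨
          φ u K.* (φ D K.* value x) K.- (φ u K.* (φ D K.* value x) K.+ φ v K.* (φ g K.* value x))
            ≈⟨ K.+-cong value-scaled (K.-‿cong (split-unit (value x))) ⟨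
          value (from (numerators x)) K.- value x   ≈⟨ value.minus-homo _ _ ⟨
          value (from (numerators x) 𝒪.- x)         ∎))
          where
          open K-Reasoning
          value-scaled : value (from (numerators x)) K.≈ φ u K.* (φ D K.* value x)
          value-scaled = K.trans (value-embedding (scaled (numerators x))) (K.trans (eʰ.cong (B.≈⇐coords λ i →
              A.trans (B.coords-combination (λ i → u A.* numerators x i) i)
                (A.sym (A.trans (B.coords-ι* u (B.combination (numerators x)) i) (A.*-congˡ (B.coords-combination (numerators x) i))))))
            (K.trans (eʰ.*-homo _ _) (K.*-cong (e.map-ι u) (K.sym (D-multiple x)))))

      associated⇒¬carmichael : P A.∣ g → g A.∣ P → ¬ IsCarmichaelAt 𝒪 (base g)
      associated⇒¬carmichael P∣g g∣P (carmichaelAt (¬field , _)) = ¬field (quotient-isField P∣g g∣P)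

      carmichael⇒power-fixed : ∀ {M} → RingNotions.HasCardinality R.quotientRing M → IsCarmichaelAt 𝒪 (base g) →
        ∀ r → g A.∣ (r A.^ (M ℕ.^ suc m) A.- r)
      carmichael⇒power-fixed {M} card (carmichaelAt carmichael) r =
        base-divisible (r A.^ N A.- r) (base r 𝒪.^ N 𝒪.- base r)
          (Q.carmichael⇒∣ (quotient-cardinality card) carmichael (base r))
          (K.trans (value.minus-homo _ _) (K.trans
            (K.+-cong (K.trans (value.^-homo (base r) N) (K.trans (K.^-congˡ N (value-base r)) (K.sym (φ.^-homo r N)))) (K.-‿cong (value-base r)))
            (K.sym (φ.minus-homo (r A.^ N) r))))
        where
        N : ℕ
        N = M ℕ.^ suc m

      -- With N = 1 + e n one has θ^N - θ = (D^e - 1) θ, and its coordinate at θ is tested for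
      -- divisibility by g. The condition `1 ≤ m` makes θ itself a member of the power basis.
      carmichael⇒residue : 1 ≤ m → ∀ {M e} → RingNotions.HasCardinality R.quotientRing M → M ℕ.^ suc m ≡ suc (e ℕ.* suc m) →
        IsCarmichaelAt 𝒪 (base g) → g A.∣ (D A.^ e A.- A.1#)
      carmichael⇒residue 1≤m {M} {e} card exponent (carmichaelAt carmichael) =
        monomial-divisible (D A.^ e A.- A.1#) one (x 𝒪.^ N 𝒪.- x)
          (Q.carmichael⇒∣ (≡.subst (RingNotions.HasCardinality Q.quotientRing) exponent (quotient-cardinality card)) carmichael x) (begin
            value (x 𝒪.^ N 𝒪.- x)                            ≈⟨ value.minus-homo _ _ ⟩
            value (x 𝒪.^ N) K.- value x
              ≈⟨ K.+-cong (K.trans (value.^-homo x N) (K.^-congˡ N (proj₂ θ-integer))) (K.-‿cong (proj₂ θ-integer)) ⟩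
            K.θ K.^ N K.- K.θ
              ≈⟨ K.+-congʳ (K.*-congˡ (K.trans (K.^-congʳ K.θ (ℕ.*-comm e (suc m))) (K.trans (K.sym (K.^-assocʳ K.θ (suc m) e))
                   (K.trans (K.^-congˡ e K.θ^n≈a) (K.sym (φ.^-homo D e)))))) ⟩
            K.θ K.* φ (D A.^ e) K.- K.θ
              ≈⟨ K.trans (K.+-congˡ (K.-‿cong (K.sym (K.*-identityʳ K.θ))))
                   (K.solve 3 (λ t d o → ((t K.:* d) K.:- (t K.:* o)) K.:= ((d K.:- o) K.:* t)) K.refl K.θ (φ (D A.^ e)) K.1#) ⟩
            (φ (D A.^ e) K.- K.1#) K.* K.θ
              ≈⟨ K.*-cong (K.trans (K.+-congˡ (K.-‿cong (K.sym φ.1#-homo))) (K.sym (φ.minus-homo (D A.^ e) A.1#)))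
                   (K.trans (K.sym (K.*-identityʳ K.θ)) (K.^-congʳ K.θ (≡.sym (Fin.toℕ-fromℕ< 1<n)))) ⟩
            φ (D A.^ e A.- A.1#) K.* K.θ K.^ toℕ one        ∎)
        where
        open K-Reasoning
        N : ℕ
        N = suc (e ℕ.* suc m)
        1<n : 1 < suc m
        1<n = s≤s 1≤m
        one : Fin (suc m)
        one = fromℕ< 1<n
        θ-integer : ∃[ y ] value y K.≈ K.θ
        θ-integer = integer θ-integral
        x : 𝒪.Carrier
        x = proj₁ θ-integer

  generator : ∃[ x ] x K.^ suc m K.≈ φ D
  generator = K.θ , K.θ^n≈a

  -- A root would give b = c^n D^j by Kummer theory. Since p divides b exactly once and does not
  -- divide D, clearing the denominator of c contradicts `not-power-ratio`.
  no-root : ∀ {p b} → Irreducible p → 2 ≤ suc m → p A.∣ b → ¬ (p A.* p) A.∣ b → ¬ p A.∣ D →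
            ∀ x → ¬ x K.^ suc m K.≈ φ b
  no-root {p} {b} p-irr 2≤n p∣b p²∤b p∤D x eq = ratio (root⇒ratio b≉0 eq)
    where
    open k-Reasoning
    b≉0 : fraction b k.≉ k.0#
    b≉0 z = p²∤b (A.∣-≈0 (FT.fraction-≈0 z))
    ratio : ∃[ q ] ∃[ j ] fraction b k.≈ q k.^ suc m k.* fraction D k.^ j → ⊥
    ratio (q , j , b≈) = cleared (FT.clear-denominator q)
      where
      cleared : ∃[ v ] ∃[ u ] v A.≉ A.0# × fraction v k.* q k.≈ fraction u → ⊥
      cleared (v , u , v≉0 , vq≈u) = not-power-ratio p-irr (suc m) 2≤n p∣b p²∤b (irreducible-∤^ p-irr j p∤D) v≉0
        (fraction-injective (begin
          fraction (b A.* v A.^ suc m)                       ≈⟨ k.trans (fraction.*-homo b (v A.^ suc m)) (k.*-congˡ (fraction.^-homo v (suc m))) ⟩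
          fraction b k.* fraction v k.^ suc m                ≈⟨ k.*-congʳ b≈ ⟩
          (q k.^ suc m k.* fraction D k.^ j) k.* fraction v k.^ suc m
            ≈⟨ k.solve 3 (λ q d v → ((q k.:* d) k.:* v) k.:= ((v k.:* q) k.:* d)) k.refl (q k.^ suc m) (fraction D k.^ j) (fraction v k.^ suc m) ⟩
          (fraction v k.^ suc m k.* q k.^ suc m) k.* fraction D k.^ j
            ≈⟨ k.*-congʳ (k.trans (k.sym (k.^-distrib-* (fraction v) q (suc m))) (k.^-congˡ (suc m) vq≈u)) ⟩
          fraction u k.^ suc m k.* fraction D k.^ j          ≈⟨ k.*-cong (fraction.^-homo u (suc m)) (fraction.^-homo D j) ⟨
          fraction (u A.^ suc m) k.* fraction (D A.^ j)      ≈⟨ fraction.*-homo (u A.^ suc m) (D A.^ j) ⟨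
          fraction (u A.^ suc m A.* D A.^ j)                 ∎))

  -- The discriminant of the power basis

  power-basis : Fin (suc m) → Integer
  power-basis i = (K.θ K.^ toℕ i) ∣integral ^-integral (toℕ i) θ-integral

  private
    trace : K.Carrier → k.Carrier
    trace = FiniteExtension.trace extension

    n×1 : k.Carrier
    n×1 = suc m k.ℕ× k.1#

    trace-cong : ∀ {x y} → x K.≈ y → trace x k.≈ trace y
    trace-cong {x} {y} e = k.sum-cong (λ i → K.coords (x K.* K.θ K.^ toℕ i) i) (λ i → K.coords (y K.* K.θ K.^ toℕ i) i)
      (λ i → K.coords-cong (K.*-congʳ e) i)

    trace-1 : trace K.1# k.≈ n×1
    trace-1 = k.trans (k.sum-cong (λ i → K.coords (K.1# K.* K.θ K.^ toℕ i) i) (λ _ → k.1#)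
        (λ i → k.trans (K.coords-cong (K.*-identityˡ _) i) (k.trans (K.coords-θ^ i i) (K.δ-diagonal i))))
      (Summation.sum-replicate k.semiring (suc m))

    trace-ι : ∀ r x → trace (K.ι r K.* x) k.≈ r k.* trace x
    trace-ι r x = k.trans (k.sum-cong (λ i → K.coords ((K.ι r K.* x) K.* K.θ K.^ toℕ i) i) (λ i → r k.* K.coords (x K.* K.θ K.^ toℕ i) i)
        (λ i → k.trans (K.coords-cong (K.*-assoc _ _ _) i) (K.coords-ι* r _ i)))
      (k.sym (k.*-distribˡ-sum r (λ i → K.coords (x K.* K.θ K.^ toℕ i) i)))

    -- Multiplication by θ^(r+1) shifts the powers of θ cyclically, up to factors D. As 0 < r + 1 <
    -- n, no basis element returns to a multiple of itself, so the diagonal of the matrix is zero.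
    trace-θ^ : ∀ r → suc r < suc m → trace (K.θ K.^ suc r) k.≈ k.0#
    trace-θ^ r r<n = k.sum-0 {suc m} (λ i → K.coords (K.θ K.^ suc r K.* K.θ K.^ toℕ i) i) λ i → go i (suc r ℕ.+ toℕ i ℕ.<? suc m)
      where
      go : ∀ i → Dec (suc r ℕ.+ toℕ i < suc m) → K.coords (K.θ K.^ suc r K.* K.θ K.^ toℕ i) i k.≈ k.0#
      go i (yes small) = k.trans (K.coords-cong (K.trans (K.sym (K.^-homo-* K.θ (suc r) (toℕ i)))
          (K.^-congʳ K.θ (≡.sym (Fin.toℕ-fromℕ< small)))) i)
        (k.trans (K.coords-θ^ (fromℕ< small) i) (K.δ-off-diagonal λ i≡ → ℕ.m≢1+n+m (toℕ i) (≡.trans (≡.cong toℕ i≡) (Fin.toℕ-fromℕ< small))))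
      go i (no ¬small) = k.trans (K.coords-cong (begin
          K.θ K.^ suc r K.* K.θ K.^ toℕ i                ≈⟨ K.^-homo-* K.θ (suc r) (toℕ i) ⟨
          K.θ K.^ (suc r ℕ.+ toℕ i)                      ≈⟨ K.^-congʳ K.θ t≡ ⟩
          K.θ K.^ (suc m ℕ.+ toℕ j)                      ≈⟨ K.^-homo-* K.θ (suc m) (toℕ j) ⟩
          K.θ K.^ suc m K.* K.θ K.^ toℕ j                ≈⟨ K.*-congʳ K.θ^n≈a ⟩
          φ D K.* K.θ K.^ toℕ j                          ∎) i)
        (k.trans (K.coords-monomial _ j i) (k.trans (k.*-congˡ (K.δ-off-diagonal i≢j)) (k.zeroʳ _)))
        where
        open K-Reasoning
        n≤t : suc m ≤ suc r ℕ.+ toℕ i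
        n≤t = ℕ.≮⇒≥ ¬small
        t-n<n : suc r ℕ.+ toℕ i ℕ.∸ suc m < suc m
        t-n<n = ℕ.+-cancelˡ-< (suc m) _ _ (≡.subst (_< suc m ℕ.+ suc m) (≡.sym (ℕ.m+[n∸m]≡n n≤t)) (ℕ.+-mono-< r<n (Fin.toℕ<n i)))
        j : Fin (suc m)
        j = fromℕ< t-n<n
        t≡ : suc r ℕ.+ toℕ i ≡ suc m ℕ.+ toℕ j
        t≡ = ≡.trans (≡.sym (ℕ.m+[n∸m]≡n n≤t)) (≡.cong (suc m ℕ.+_) (≡.sym (Fin.toℕ-fromℕ< t-n<n)))
        i≢j : i ≢ j
        i≢j i≡j = ℕ.<⇒≢ r<n (ℕ.+-cancelʳ-≡ (toℕ i) (suc r) (suc m) (≡.trans t≡ (≡.cong (λ j → suc m ℕ.+ toℕ j) (≡.sym i≡j))))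

    gram : Fin (suc m) → Fin (suc m) → k.Carrier
    gram i j = trace (K.θ K.^ toℕ i K.* K.θ K.^ toℕ j)

    gram-n : ∀ i j → toℕ i ℕ.+ toℕ j ≡ suc m → gram i j k.≈ fraction D k.* n×1
    gram-n i j t≡n = k.trans (trace-cong (K.trans (K.sym (K.^-homo-* K.θ (toℕ i) (toℕ j))) (K.trans (K.^-congʳ K.θ t≡n)
      (K.trans K.θ^n≈a (K.sym (K.*-identityʳ _)))))) (k.trans (trace-ι (fraction D) K.1#) (k.*-congˡ trace-1))

    gram-0 : ∀ i j → 0 < toℕ i ℕ.+ toℕ j → toℕ i ℕ.+ toℕ j ≢ suc m → gram i j k.≈ k.0#
    gram-0 i j t>0 t≢n = k.trans (trace-cong (K.sym (K.^-homo-* K.θ (toℕ i) (toℕ j)))) (go (toℕ i ℕ.+ toℕ j) ≡.refl (_ ℕ.<? _))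
      where
      go : ∀ t → toℕ i ℕ.+ toℕ j ≡ t → Dec (t < suc m) → trace (K.θ K.^ t) k.≈ k.0#
      go zero    t≡ _         = ⊥-elim (ℕ.<⇒≢ t>0 (≡.sym t≡))
      go (suc t) t≡ (yes t<n) = trace-θ^ t t<n
      go (suc t) t≡ (no t≮n)  = k.trans (trace-cong (K.trans (K.^-congʳ K.θ split) (K.trans (K.^-homo-* K.θ (suc m) (suc r)) (K.*-congʳ K.θ^n≈a))))
        (k.trans (trace-ι (fraction D) (K.θ K.^ suc r)) (k.trans (k.*-congˡ (trace-θ^ r r<n)) (k.zeroʳ _)))
        where
        n<t : suc m < suc t
        n<t = ℕ.≤∧≢⇒< (ℕ.≮⇒≥ t≮n) (λ e → t≢n (≡.trans t≡ (≡.sym e)))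
        r : ℕ
        r = t ℕ.∸ suc m
        split : suc t ≡ suc m ℕ.+ suc r
        split = ≡.trans (≡.cong suc (≡.sym (ℕ.m+[n∸m]≡n (ℕ.≤-pred n<t)))) (≡.sym (ℕ.+-suc (suc m) r))
        r<n : suc r < suc m
        r<n = ℕ.+-cancelˡ-< (suc m) _ _ (≡.subst (_< suc m ℕ.+ suc m) (≡.trans t≡ split) (ℕ.+-mono-< (Fin.toℕ<n i) (Fin.toℕ<n j)))

    -- A product θ^i θ^j with i + j different from 0 and n has trace zero, so deleting the row and
    -- column of 1 leaves an antidiagonal matrix with entries n D. The corner entry is the trace n
    -- of 1.
    minor : ∃[ e ] k.det (λ i j → gram (suc i) (suc j)) k.≈ (k.- k.1#) k.^ e k.* (fraction D k.* n×1) k.^ m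
    minor = Determinant.det-antidiagonal k m (λ i j → gram (suc i) (suc j)) (fraction D k.* n×1)
      (λ i j e → gram-n (suc i) (suc j) (≡.cong suc (≡.trans (ℕ.+-suc (toℕ i) (toℕ j)) e)))
      (λ i j ≢ → gram-0 (suc i) (suc j) (s≤s z≤n) λ e → ≢ (≡.trans (≡.sym (ℕ.+-suc (toℕ i) (toℕ j))) (ℕ.suc-injective e)))

  basis-discriminant : A.Carrier
  basis-discriminant = (suc m A.ℕ× A.1#) A.* ((A.- A.1#) A.^ proj₁ minor A.* (D A.* (suc m A.ℕ× A.1#)) A.^ m)

  basis-discriminant-≈ : fraction basis-discriminant k.≈ FiniteExtension.discriminant extension (value ∘ power-basis)
  basis-discriminant-≈ = begin
    fraction basis-discriminant
      ≈⟨ k.trans (fraction.*-homo N _) (k.*-cong N≈ (fraction.*-homo ((A.- A.1#) A.^ proj₁ minor) ((D A.* N) A.^ m))) ⟩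
    n×1 k.* (fraction ((A.- A.1#) A.^ proj₁ minor) k.* fraction ((D A.* N) A.^ m))
      ≈⟨ k.*-congˡ (k.*-cong
           (k.trans (fraction.^-homo (A.- A.1#) (proj₁ minor)) (k.^-congˡ (proj₁ minor) (k.trans (fraction.-‿homo A.1#) (k.-‿cong fraction.1#-homo))))
           (k.trans (fraction.^-homo (D A.* N) m) (k.^-congˡ m (k.trans (fraction.*-homo D N) (k.*-congˡ N≈))))) ⟩
    n×1 k.* ((k.- k.1#) k.^ proj₁ minor k.* (fraction D k.* n×1) k.^ m)
      ≈⟨ k.*-cong (k.trans (trace-cong (K.*-identityˡ K.1#)) trace-1) (proj₂ minor) ⟨
    gram zero zero k.* k.det (λ i j → gram (suc i) (suc j))
      ≈⟨ k.*-identityˡ _ ⟨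
    k.1# k.* (gram zero zero k.* k.det (λ i j → gram (suc i) (suc j)))
      ≈⟨ Determinant.det-single k gram zero first-row ⟨
    k.det gram ∎
    where
    open k-Reasoning
    N : A.Carrier
    N = suc m A.ℕ× A.1#
    N≈ : fraction N k.≈ n×1
    N≈ = k.trans (fraction.×-homo (suc m) A.1#) (k.ℕ×-congʳ (suc m) fraction.1#-homo)
    first-row : ∀ j → j ≢ zero → gram zero j k.≈ k.0#
    first-row zero    j≢0 = ⊥-elim (j≢0 ≡.refl)
    first-row (suc j) _   = gram-0 zero (suc j) (s≤s z≤n) (ℕ.<⇒≢ (Fin.toℕ<n (suc j)))

  basis-discriminant-∤ : (suc m A.ℕ× A.1#) A.∣ A.1# → ∀ {h} → Irreducible h → ¬ h A.∣ D → ¬ h A.∣ basis-discriminant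
  basis-discriminant-∤ n-unit {h} h-irr h∤D d = outer (irreducible-prime h-irr _ _ d)
    where
    N : A.Carrier
    N = suc m A.ℕ× A.1#
    h∤unit : ∀ {x} → x A.∣ A.1# → ¬ h A.∣ x
    h∤unit x∣1 h∣x = Irreducible.p∤1 h-irr (A.∣ʳ-trans h∣x x∣1)
    -1∣1 : (A.- A.1#) A.∣ A.1#
    -1∣1 = (A.- A.1#) A., A.trans (A.-1*x≈-x _) (A.-‿involutive A.1#)
    DN : h A.∣ D ⊎ h A.∣ N → ⊥
    DN (inj₁ h∣D) = h∤D h∣D
    DN (inj₂ h∣N) = h∤unit n-unit h∣N
    inner : h A.∣ ((A.- A.1#) A.^ proj₁ minor) ⊎ h A.∣ ((D A.* N) A.^ m) → ⊥
    inner (inj₁ h∣) = h∤unit (A.unit-^ (proj₁ minor) -1∣1) h∣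
    inner (inj₂ h∣) = irreducible-∤^ h-irr m (λ h∣DN → DN (irreducible-prime h-irr D N h∣DN)) h∣
    outer : h A.∣ N ⊎ h A.∣ ((A.- A.1#) A.^ proj₁ minor A.* (D A.* N) A.^ m) → ⊥
    outer (inj₁ h∣N) = h∤unit n-unit h∣N
    outer (inj₂ h∣)  = inner (irreducible-prime h-irr _ _ h∣)

-- Choice of the radicands

module ResidueTheory {A : CommutativeRing 0ℓ 0ℓ} (bezoutDomain : BezoutDomain A) where
  open CommutativeRingTheory A
  open BezoutDomain bezoutDomain
  open BezoutDomainTheory bezoutDomain
  open Irreducible
  open SetoidReasoning setoid
  private
    module R = Roots A isDomain

  irreducible⇒quotient-isField : ∀ {p} → Irreducible p → RingNotions.IsField (Quotient.quotientRing A (principal A p))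
  irreducible⇒quotient-isField {p} p-irr = (λ z → p∤1 p-irr (Q.Q≈0⇒∣ z)) , λ x x≉0 → invert x x≉0 (irreducible-divides-or-coprime p-irr x)
    where
    module Q = QuotientTheory A p
    module Q′ = CommutativeRingTheory Q.quotientRing
    invert : ∀ x → x Q′.≉ 0# → p ∣ x ⊎ Coprime p x → ∃[ y ] y Q′.* x Q′.≈ 1# × x Q′.* y Q′.≈ 1#
    invert x x≉0 (inj₁ p∣x) = ⊥-elim (x≉0 (Q.∣⇒Q≈0 p∣x))
    invert x x≉0 (inj₂ (s , t , e)) = t , inverseˡ , Q′.trans (Q′.*-comm x t) inverseˡ
      where
      inverseˡ : t Q′.* x Q′.≈ 1#
      inverseˡ = Q.congruent (- s , (begin
        - s * p                       ≈⟨ solve 3 (λ s p y → (:- s :* p) := (y :- (s :* p :+ y))) refl s p (t * x) ⟩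
        t * x - (s * p + t * x)       ≈⟨ +-congˡ (-‿cong e) ⟩
        t * x - 1#                    ∎))

  -- As g does not divide p, the class of p would have an inverse y. With g = s p and y p - 1 = w g
  -- this gives (y - w s) p = 1, so p would be a unit.
  proper-factor⇒¬quotient-isField : ∀ {p g} → g ≉ 0# → ¬ p ∣ 1# → p ∣ g → ¬ g ∣ p →
    ¬ RingNotions.IsField (Quotient.quotientRing A (principal A g))
  proper-factor⇒¬quotient-isField {p} {g} g≉0 p∤1 (s , sp≈g) g∤p (_ , inverse) =
    go (inverse p (λ z → g∤p (Q.Q≈0⇒∣ z)))
    where
    module Q = QuotientTheory A g
    module Q′ = CommutativeRingTheory Q.quotientRing
    go : ∃[ y ] y Q′.* p Q′.≈ 1# × p Q′.* y Q′.≈ 1# → ⊥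
    go (y , yp≈1 , _) = contradict (Q.difference yp≈1)
      where
      contradict : g ∣ (y * p - 1#) → ⊥
      contradict (w , wg≈) = p∤1 (y - w * s , R.cancel-≈ g≉0 (begin
        g * ((y - w * s) * p)
          ≈⟨ solve 5 (λ g y w s p → (g :* ((y :- w :* s) :* p)) := (g :* (y :* p) :- (w :* g) :* (s :* p))) refl g y w s p ⟩
        g * (y * p) - (w * g) * (s * p)     ≈⟨ +-congˡ (-‿cong (*-cong wg≈ sp≈g)) ⟩
        g * (y * p) - (y * p - 1#) * g
          ≈⟨ solve 3 (λ g z o → (g :* z :- (z :- o) :* g) := (g :* o)) refl g (y * p) 1# ⟩
        g * 1#                              ∎))

  -- Take any irreducible factor p of g. If g does not divide p, then A/g is not a field, so the
  -- failure of the Carmichael property must come from some a with a^N ≠ a modulo g; square-freeness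
  -- yields an irreducible factor of g at which the identity already fails.
  witness-prime : ∀ {g N} → g ≉ 0# → ¬ g ∣ 1# → (∀ x → (x * x) ∣ g → x ∣ 1#) →
    RingNotions.HasCardinality (Quotient.quotientRing A (principal A g)) N →
    ¬ IsCarmichaelIdeal A (principal A g) →
    ∃[ p ] Irreducible p × p ∣ g × (g ∣ p ⊎ ∃[ a ] ¬ p ∣ (a ^ N - a))
  witness-prime {g} {N} g≉0 g∤1 squarefree card ¬carmichael = go (irreducible-factor g≉0 g∤1)
    where
    module Q = QuotientTheory A g
    module Q′ = CommutativeRingTheory Q.quotientRing
    Goal : Set
    Goal = ∃[ p ] Irreducible p × p ∣ g × (g ∣ p ⊎ ∃[ a ] ¬ p ∣ (a ^ N - a))
    fails : ∃[ a ] ¬ g ∣ (a ^ N - a) → Goal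
    fails (a , g∤) = let p , p-irr , p∣g , p∤ = squarefree-factor g≉0 squarefree g∤ in p , p-irr , p∣g , inj₂ (a , p∤)
    go : ∃[ p ] Irreducible p × p ∣ g → Goal
    go (p , p-irr , p∣g) = cases (g ∣? p)
      where
      cases : Dec (g ∣ p) → Goal
      cases (yes g∣p) = p , p-irr , p∣g , inj₁ g∣p
      cases (no g∤p)  = search (finite-search {S = Q′.setoid} card (λ a → ¬ g ∣ (a ^ N - a))
          (λ x≈y ¬d d → ¬d (Q.∣-power-resp N (Q′.sym x≈y) d)) (λ a → ¬? (g ∣? (a ^ N - a))))
        where
        search : (∃[ a ] ¬ g ∣ (a ^ N - a)) ⊎ (∀ a → ¬ ¬ g ∣ (a ^ N - a)) → Goal
        search (inj₁ found) = fails found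
        search (inj₂ none)  = ⊥-elim (¬carmichael (proper-factor⇒¬quotient-isField g≉0 (p∤1 p-irr) p∣g g∤p
          , N , card , λ x → Q.∣⇒fixed x N (decidable-stable (g ∣? (x ^ N - x)) (none x))))

  -- Chinese remainders for g = h p, where square-freeness makes h and p coprime: s is r modulo p
  -- and 1 modulo h, hence prime to both factors.
  residue : ∀ {g p} → (∀ x → (x * x) ∣ g → x ∣ 1#) → Irreducible p → p ∣ g → ∀ r → ¬ p ∣ r →
            ∃[ s ] Coprime s g × p ∣ (s - r)
  residue {g} {p} squarefree p-irr (h , hp≈g) r p∤r = go (irreducible-divides-or-coprime p-irr h)
    where
    not-divides : ¬ p ∣ r → p ∣ r ⊎ Coprime p r → Coprime p r
    not-divides p∤r (inj₁ p∣r) = ⊥-elim (p∤r p∣r)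
    not-divides _   (inj₂ c)   = c
    go : p ∣ h ⊎ Coprime p h → ∃[ s ] Coprime s g × p ∣ (s - r)
    go (inj₁ (w , wp≈h)) = ⊥-elim (p∤1 p-irr (squarefree p (w , trans (sym (*-assoc w p p)) (trans (*-congʳ wp≈h) hp≈g))))
    go (inj₂ (α , β , e)) = s , coprime-resp hp≈g (coprime-* s-h s-p) , p∣s-r
      where
      s : Carrier
      s = r * (β * h) + α * p
      p∣s-r : p ∣ (s - r)
      p∣s-r = (α - r * α) , (begin
        (α - r * α) * p
          ≈⟨ solve 4 (λ r bh α p → ((α :- r :* α) :* p) := ((r :* bh :+ α :* p) :- r :* (α :* p :+ bh))) refl r (β * h) α p ⟩
        s - r * (α * p + β * h)     ≈⟨ +-congˡ (-‿cong (trans (*-congˡ e) (*-identityʳ r))) ⟩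
        s - r                       ∎)
      h∣s-1 : h ∣ (s - 1#)
      h∣s-1 = (r * β - β) , (begin
        (r * β - β) * h
          ≈⟨ solve 5 (λ r β h α p → ((r :* β :- β) :* h) := ((r :* (β :* h) :+ α :* p) :- (α :* p :+ β :* h))) refl r β h α p ⟩
        s - (α * p + β * h)         ≈⟨ +-congˡ (-‿cong e) ⟩
        s - 1#                      ∎)
      s-p : Coprime s p
      s-p = coprime-sym (coprime-mod p∣s-r (not-divides p∤r (irreducible-divides-or-coprime p-irr r)))
      s-h : Coprime s h
      s-h = coprime-sym (coprime-mod h∣s-1 (0# , 1# , trans (+-cong (zeroˡ h) (*-identityˡ 1#)) (+-identityˡ 1#)))

  record Ramified (g r Π : Carrier) : Set where
    field
      prime               : Carrier
      radicand            : Carrier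
      prime-irreducible   : Irreducible prime
      prime∤Π             : ¬ prime ∣ Π
      prime∣radicand      : prime ∣ radicand
      prime²∤radicand     : ¬ (prime * prime) ∣ radicand
      radicand≡r          : g ∣ (radicand - r)

    radicand≉0 : radicand ≉ 0#
    radicand≉0 z = prime²∤radicand (∣-≈0 z)

  -- Chinese remainders for g and p², with p an irreducible dividing neither g nor Π: D is r modulo
  -- g and p modulo p², so p divides D exactly once.
  ramified : ∀ {g} → g ≉ 0# → ∀ r Π → Π ≉ 0# → Ramified g r Π
  ramified {g} g≉0 r Π Π≉0 = go (fresh-irreducible (R.*-≉0 g≉0 Π≉0))
    where
    go : ∃[ p ] Irreducible p × ¬ p ∣ (g * Π) → Ramified g r Π
    go (p , p-irr , p∤gΠ) = build (coprime-* g-p g-p)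
      where
      g-p : Coprime g p
      g-p = coprime-sym (not-divides (irreducible-divides-or-coprime p-irr g))
        where
        not-divides : p ∣ g ⊎ Coprime p g → Coprime p g
        not-divides (inj₁ p∣g) = ⊥-elim (p∤gΠ (∣-*ʳ Π p∣g))
        not-divides (inj₂ c)   = c
      build : Coprime g (p * p) → Ramified g r Π
      build (α , β , e) = record
        { prime = p
        ; radicand = D
        ; prime-irreducible = p-irr
        ; prime∤Π = λ d → p∤gΠ (∣-*ˡ g d)
        ; prime∣radicand = r * (β * p) + α * g ,
            solve 5 (λ r β p α g → ((r :* (β :* p) :+ α :* g) :* p) := (r :* (β :* (p :* p)) :+ p :* (α :* g))) refl r β p α g
        ; prime²∤radicand = p²∤D
        ; radicand≡r = p * α - r * α , (begin
            (p * α - r * α) * g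
              ≈⟨ solve 5 (λ p α r g b → ((p :* α :- r :* α) :* g) := ((r :* b :+ p :* (α :* g)) :- r :* (α :* g :+ b))) refl p α r g (β * (p * p)) ⟩
            D - r * (α * g + β * (p * p))   ≈⟨ +-congˡ (-‿cong (trans (*-congˡ e) (*-identityʳ r))) ⟩
            D - r                           ∎)
        }
        where
        D : Carrier
        D = r * (β * (p * p)) + p * (α * g)
        p²∤D : ¬ (p * p) ∣ D
        p²∤D (w , e′) = p∤1 p-irr (w - r * β + β * p , R.cancel-≈ (irreducible-≉0 p-irr) (begin
          p * ((w - r * β + β * p) * p)
            ≈⟨ solve 4 (λ p w r β → (p :* ((w :- r :* β :+ β :* p) :* p)) := (w :* (p :* p) :- r :* (β :* (p :* p)) :+ p :* (β :* (p :* p)))) refl p w r β ⟩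
          w * (p * p) - r * (β * (p * p)) + p * (β * (p * p))
            ≈⟨ +-congʳ (+-congʳ e′) ⟩
          D - r * (β * (p * p)) + p * (β * (p * p))
            ≈⟨ solve 4 (λ b p a c → ((b :+ p :* a) :- b :+ p :* c) := (p :* (a :+ c))) refl (r * (β * (p * p))) p (α * g) (β * (p * p)) ⟩
          p * (α * g + β * (p * p))         ≈⟨ *-congˡ e ⟩
          p * 1#                            ∎))

  module Radicands {g} (g≉0 : g ≉ 0#) (r : Carrier) where
    private
      -- The product of the radicands chosen so far; an irreducible that does not divide it divides
      -- none of them.
      product : ℕ → ∃[ Π ] Π ≉ 0#
      product zero    = 1# , proj₁ isDomain
      product (suc i) = let Π , Π≉0 = product i ; module S = Ramified (ramified g≉0 r Π Π≉0)
        in S.radicand * Π , R.*-≉0 S.radicand≉0 Π≉0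

      step : ∀ i → Ramified g r (proj₁ (product i))
      step i = ramified g≉0 r (proj₁ (product i)) (proj₂ (product i))

    open module Step i = Ramified (step i) public

    private
      divides-product : ∀ {i j} → i ℕ.<′ j → radicand i ∣ proj₁ (product j)
      divides-product {i} ℕ.≤′-refl      = ∣-*ʳ (proj₁ (product i)) ∣ʳ-refl
      divides-product {i} {suc j} (ℕ.≤′-step l) = ∣-*ˡ (radicand j) (divides-product l)

    prime∤earlier : ∀ {i j} → i < j → ¬ prime j ∣ radicand i
    prime∤earlier {i} {j} i<j d = prime∤Π j (∣ʳ-trans d (divides-product (ℕ.≤⇒≤′ i<j)))

-- Infinitely many extensions

module _ {k : CommutativeRing 0ℓ 0ℓ} where
  open FiniteExtension using (Carrier; ι; rawRing)

  HasRoot : FiniteExtension k → ℕ → CommutativeRing.Carrier k → Set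
  HasRoot K n a = ∃[ x ] x ^ n ≈ ι K a
    where open CommutativeRingTheory (FiniteExtension.ring K)

  module _ {K L : FiniteExtension k} (iso : K ≅ L) where
    private
      module K = CommutativeRingTheory (FiniteExtension.ring K)
      module L = CommutativeRingTheory (FiniteExtension.ring L)
      open _≅_ iso
      open RingMorphisms.IsRingIsomorphism to-iso
      module to = Homomorphism {R = FiniteExtension.ring K} {S = FiniteExtension.ring L} isRingHomomorphism

    root-image : ∀ {n a} → HasRoot K n a → HasRoot L n a
    root-image {n} {a} (x , e) = to x , L.trans (L.sym (to.^-homo x n)) (L.trans (to.cong e) (to-ι a))

    root-preimage : ∀ {n a} → HasRoot L n a → HasRoot K n a
    root-preimage {n} {a} (y , e) = let x , to-x = surjective y in
      x , injective (L.trans (to.^-homo x n) (L.trans (L.^-congˡ n (to-x K.refl)) (L.trans e (L.sym (to-ι a)))))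

module IntegralExtension (A k : CommutativeRing 0ℓ 0ℓ) (fraction : CommutativeRing.Carrier A → CommutativeRing.Carrier k)
  (fraction-hom : RingMorphisms.IsRingHomomorphism (CommutativeRing.rawRing A) (CommutativeRing.rawRing k) fraction)
  (K : FiniteExtension k) where
  open FiniteExtension K using (ring; ι; ι-hom; degree; IsBasis; discriminant)
  private module A = CommutativeRingTheory A

  open IntegralClosure A ring (ι ∘ fraction) (Composition.isRingHomomorphism (FiniteExtension.trans K) fraction-hom ι-hom) public
    using (IsIntegral; Integer; value)

  record RingOfIntegers : Set₁ where
    field
      integers        : CommutativeRing 0ℓ 0ℓ
      embed           : CommutativeRing.Carrier integers → FiniteExtension.Carrier K
      embed-hom       : RingMorphisms.IsRingHomomorphism (CommutativeRing.rawRing integers) (FiniteExtension.rawRing K) embed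
      embed-injective : ∀ {x y} → FiniteExtension._≈_ K (embed x) (embed y) → CommutativeRing._≈_ integers x y
      integral        : ∀ x → IsIntegral (embed x)
      integer         : ∀ {x} → IsIntegral x → ∃[ y ] FiniteExtension._≈_ K (embed y) x
      base            : A.Carrier → CommutativeRing.Carrier integers
      embed-base      : ∀ r → FiniteExtension._≈_ K (embed (base r)) (ι (fraction r))

    IsCarmichaelIn : A.Carrier → Set
    IsCarmichaelIn g = IsCarmichaelAt integers (base g)

  discriminantIdeal : Ideal A 0ℓ
  discriminantIdeal = generatedIdeal A λ a →
    Σ (Fin degree → Integer) λ b → IsBasis (value ∘ b) × CommutativeRing._≈_ k (fraction a) (discriminant (value ∘ b))

  DiscriminantPrimeTo : A.Carrier → Set
  DiscriminantPrimeTo g = ∀ h → A.Irreducible h → h A.∣ g → ¬ (_dividesIdeal_ A (principal A h) discriminantIdeal)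

  record IsSolution (𝒪 : RingOfIntegers) (n : ℕ) (g : A.Carrier) : Set where
    field
      isCyclicExtension   : IsCyclicExtension K
      degree-≡            : degree ≡ n
      discriminantPrimeTo : DiscriminantPrimeTo g
      ¬isCarmichaelIn     : ¬ RingOfIntegers.IsCarmichaelIn 𝒪 g

-- The construction for any Bezout domain A over the finite field F in place of F[t].
module Construction (F : FiniteField) (A k : CommutativeRing 0ℓ 0ℓ) (bezoutDomain : BezoutDomain A)
  (fraction : CommutativeRing.Carrier A → CommutativeRing.Carrier k) (isFractionField : IsFractionField A k fraction)
  (constant : CommutativeRing.Carrier (FiniteField.ring F) → CommutativeRing.Carrier A)
  (constant-hom : RingMorphisms.IsRingHomomorphism (CommutativeRing.rawRing (FiniteField.ring F)) (CommutativeRing.rawRing A) constant)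
  (quotient-cardinality : ∀ {x} → CommutativeRing._≉_ A x (CommutativeRing.0# A) →
    ∃[ d ] RingNotions.HasCardinality (Quotient.quotientRing A (principal A x)) (FiniteField.order F ℕ.^ d))
  (integers : (K : FiniteExtension k) →
    IntegralExtension.RingOfIntegers A k fraction (IsFractionField.fraction-hom isFractionField) K)
  where

  private
    module F = CommutativeRingTheory (FiniteField.ring F)
    module FF = FiniteField F
    module FT = FiniteFieldTheory F
    module A = CommutativeRingTheory A
    module constant = Homomorphism {R = FiniteField.ring F} {S = A} constant-hom
    q : ℕ
    q = FF.order
  open BezoutDomain bezoutDomain
  open BezoutDomainTheory bezoutDomain
  open ResidueTheory bezoutDomain

  private
    constant-unit : ∀ {x} → x F.≉ F.0# → constant x A.∣ A.1#
    constant-unit {x} x≉0 = let y , yx≈1 = FT.inverse x≉0 in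
      constant y A., A.trans (A.sym (constant.*-homo y x)) (A.trans (constant.cong yx≈1) constant.1#-homo)

    residueField : ∀ {p d} → A.Irreducible p → RingNotions.HasCardinality (Quotient.quotientRing A (principal A p)) (q ℕ.^ d) → FiniteField
    residueField {p} {d} p-irr card = record
      { ring        = Quotient.quotientRing A (principal A p)
      ; isField     = irreducible⇒quotient-isField p-irr
      ; order       = q ℕ.^ d
      ; cardinality = card
      }

  module _ (m : ℕ) (n-prime : Prime (suc m)) (e₀ : ℕ) (order-≡ : q ≡ suc (e₀ ℕ.* suc m)) where
    private
      n : ℕ
      n = suc m

      2≤n : 2 ≤ n
      2≤n = ℕ.nonTrivial⇒n>1 n {{prime⇒nonTrivial n-prime}}

      nonresidueF : ∃[ x ] x F.≉ F.0# × x F.^ e₀ F.≉ F.1#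
      nonresidueF = FT.primitive-root n e₀ n-prime order-≡

      ζF : F.Carrier
      ζF = proj₁ nonresidueF F.^ e₀

      ζF-root : ζF F.^ n F.≈ F.1#
      ζF-root = F.trans (F.^-assocʳ _ e₀ n) (FT.power-≈1 order-≡ (proj₁ (proj₂ nonresidueF)))

      ζ : A.Carrier
      ζ = constant ζF

      ζ-root : ζ A.^ n A.≈ A.1#
      ζ-root = A.trans (A.sym (constant.^-homo ζF n)) (A.trans (constant.cong ζF-root) constant.1#-homo)

      ζ-unit : ∀ (i j : Fin n) → i ≢ j → (ζ A.^ toℕ i A.- ζ A.^ toℕ j) A.∣ A.1#
      ζ-unit i j i≢j = A.∣ʳ-respˡ-≈
        (A.trans (constant.minus-homo _ _) (A.+-cong (constant.^-homo ζF (toℕ i)) (A.-‿cong (constant.^-homo ζF (toℕ j)))))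
        (constant-unit λ z → RootsOfUnity.powers-distinct (FiniteField.ring F) FF.isDomain n-prime ζF-root (proj₂ (proj₂ nonresidueF)) i j i≢j
          (F.x-y≈0⇒x≈y z))

      -- From q = e₀ n + 1 and q = 0 in F, the assumption n = 0 in F would give 1 = 0. Hence the
      -- factor n^n of the discriminant is harmless.
      n-unit : (n A.ℕ× A.1#) A.∣ A.1#
      n-unit = A.∣ʳ-respˡ-≈ (A.trans (constant.×-homo n F.1#) (A.ℕ×-congʳ n constant.1#-homo)) (constant-unit n≉0)
        where
        n≉0 : n F.ℕ× F.1# F.≉ F.0#
        n≉0 z = proj₁ FF.isDomain (F.trans (F.sym (F.trans (F.+-congˡ (F.trans (F.×1-homo-* e₀ n)
          (F.trans (F.*-congˡ z) (F.zeroʳ _)))) (F.+-identityʳ F.1#)))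
          (F.trans (F.reflexive (≡.cong (F._ℕ× F.1#) (≡.sym order-≡))) FT.order×1≈0))

    module KummerExtension {g : A.Carrier} (g≉0 : g A.≉ A.0#) {p r₀ : A.Carrier} (p-irr : A.Irreducible p) (p∣g : p A.∣ g)
      {N d : ℕ} (g-card : RingNotions.HasCardinality (Quotient.quotientRing A (principal A g)) (q ℕ.^ N))
      (p-card : RingNotions.HasCardinality (Quotient.quotientRing A (principal A p)) (q ℕ.^ d))
      (p-witness : g A.∣ p ⊎ ∃[ a ] ¬ p A.∣ (a A.^ (q ℕ.^ N) A.- a))
      (r₀≉0 : CommutativeRing._≉_ (Quotient.quotientRing A (principal A p)) r₀ A.0#)
      (r₀-nonresidue : CommutativeRing._≉_ (Quotient.quotientRing A (principal A p))
        (CommutativeRingTheory._^_ (Quotient.quotientRing A (principal A p)) r₀ (geometric q e₀ d)) A.1#)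
      {D : A.Carrier} (D-coprime : Coprime D g) (D≡r₀ : p A.∣ (D A.- r₀)) where
      private
        κF : FiniteField
        κF = residueField {p} {d} p-irr p-card
        module κ = CommutativeRingTheory (FiniteField.ring κF)
        module Qp = QuotientTheory A p

        κ-order : q ℕ.^ d ≡ suc (geometric q e₀ d ℕ.* n)
        κ-order = geometric-spec e₀ n order-≡ d

        D≈r₀ : D κ.≈ r₀
        D≈r₀ = Qp.congruent D≡r₀

        D≉0-mod-p : D κ.≉ A.0#
        D≉0-mod-p z = r₀≉0 (κ.trans (κ.sym D≈r₀) z)

        D-nonresidue : (D κ.^ geometric q e₀ d) κ.≉ A.1#
        D-nonresidue = Qp.≉⇒power-≉ (geometric q e₀ d) D≈r₀ r₀-nonresidue

        D≉0 : D A.≉ A.0#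
        D≉0 z = D≉0-mod-p (Qp.≈⇒Q≈ z)

        inert : CommutativeRingTheory.ZeroOrInvertible (Kummer.E (Quotient.quotientRing A (principal A p)) D m)
        inert = FiniteKummer.zero-or-invertible κF D m (geometric q e₀ d) n-prime κ-order D≉0-mod-p D-nonresidue

        module I = IntegralKummer A k bezoutDomain fraction isFractionField m ζ ζ-root ζ-unit D p (A.Irreducible.p∤1 p-irr) D≉0 inert

      K : FiniteExtension k
      K = I.extension

      private
        module IE = IntegralExtension A k fraction (IsFractionField.fraction-hom isFractionField) K
        module O = IE.RingOfIntegers (integers K)
        module 𝒪 = I.Integers O.integers O.embed O.embed-hom O.embed-injective O.integral O.integer O.base O.embed-base

      isCyclic : IsCyclicExtension K
      isCyclic = I.isCyclicExtension (λ z → D≉0 (FractionTheory.fraction-≈0 bezoutDomain isFractionField z))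

      has-root : HasRoot K n (fraction D)
      has-root = I.generator

      no-other-root : ∀ {s b} → A.Irreducible s → s A.∣ b → ¬ (s A.* s) A.∣ b → ¬ s A.∣ D → ¬ HasRoot K n (fraction b)
      no-other-root s-irr s∣b s²∤b s∤D (x , e) = I.no-root s-irr 2≤n s∣b s²∤b s∤D x e

      -- The powers of θ are integral and form a basis of K, so their discriminant is one of the
      -- generators of the ideal; an irreducible dividing the whole ideal would divide this element.
      discriminant-prime : IE.DiscriminantPrimeTo g
      discriminant-prime h h-irr h∣g divides-ideal = I.basis-discriminant-∤ n-unit h-irr
        (λ h∣D → A.Irreducible.p∤1 h-irr (coprime-∣⇒∣1 D-coprime h∣D h∣g))
        (divides-ideal (gen (I.power-basis , FiniteExtension.isBasis K , I.basis-discriminant-≈)))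

      not-carmichael : ¬ O.IsCarmichaelIn g
      not-carmichael carmichael = cases p-witness
        where
        cases : g A.∣ p ⊎ ∃[ a ] ¬ p A.∣ (a A.^ (q ℕ.^ N) A.- a) → ⊥
        cases (inj₁ g∣p)      = 𝒪.associated⇒¬carmichael D-coprime p∣g g∣p carmichael
        -- In the residue field of p, the identity at θ says D^e′ = 1, and the identity on A says
        -- y^(q^(N n)) = y for all y. Since D is a nonresidue, the exponent descends to q^N, which
        -- fails at a.
        cases (inj₂ (a , p∤)) = p∤ (Qp.fixed⇒∣ a (q ℕ.^ N) (FiniteFieldTheory.descend-exponent κF
            {q} {N} {d} {n} {geometric q e₀ d} {e′} {D} FT.2≤order 1≤d ≡.refl n-prime κ-order power-≡ D≉0-mod-p D-nonresidue
            (Qp.∣⇒power-≈1 e′ (A.∣ʳ-trans p∣g (𝒪.carmichael⇒residue D-coprime (ℕ.≤-pred 2≤n) {q ℕ.^ N} {e′} g-card exponent carmichael)))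
            (λ y → Qp.∣⇒fixed y (q ℕ.^ (N ℕ.* n)) (≡.subst (λ M → p A.∣ (y A.^ M A.- y)) (ℕ.^-*-assoc q N n)
              (A.∣ʳ-trans p∣g (𝒪.carmichael⇒power-fixed D-coprime {q ℕ.^ N} g-card carmichael y)))) a))
          where
          e′ : ℕ
          e′ = geometric q e₀ (N ℕ.* n)
          power-≡ : q ℕ.^ (N ℕ.* n) ≡ suc (e′ ℕ.* n)
          power-≡ = geometric-spec e₀ n order-≡ (N ℕ.* n)
          exponent : (q ℕ.^ N) ℕ.^ n ≡ suc (e′ ℕ.* n)
          exponent = ≡.trans (ℕ.^-*-assoc q N n) power-≡
          1≤d : 1 ≤ d
          1≤d = go d (FiniteFieldTheory.2≤order κF)
            where
            go : ∀ d → 2 ≤ q ℕ.^ d → 1 ≤ d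
            go zero    (s≤s ())
            go (suc d) _ = s≤s z≤n

      solution : IE.IsSolution (integers K) n g
      solution = record
        { isCyclicExtension   = isCyclic
        ; degree-≡            = ≡.refl
        ; discriminantPrimeTo = discriminant-prime
        ; ¬isCarmichaelIn     = not-carmichael
        }

    module _ {g : A.Carrier} (g≉0 : g A.≉ A.0#) (g∤1 : ¬ g A.∣ A.1#) (squarefree : ∀ x → (x A.* x) A.∣ g → x A.∣ A.1#)
      (¬carmichael : ¬ IsCarmichaelIdeal A (principal A g)) where

      private
        Solution : FiniteExtension k → Set
        Solution K = IntegralExtension.IsSolution A k fraction (IsFractionField.fraction-hom isFractionField) K (integers K) n g

        module Family {p r₀ r : A.Carrier} (p-irr : A.Irreducible p) (p∣g : p A.∣ g)
          {N d : ℕ} (g-card : RingNotions.HasCardinality (Quotient.quotientRing A (principal A g)) (q ℕ.^ N))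
          (p-card : RingNotions.HasCardinality (Quotient.quotientRing A (principal A p)) (q ℕ.^ d))
          (p-witness : g A.∣ p ⊎ ∃[ a ] ¬ p A.∣ (a A.^ (q ℕ.^ N) A.- a))
          (r₀≉0 : CommutativeRing._≉_ (Quotient.quotientRing A (principal A p)) r₀ A.0#)
          (r₀-nonresidue : CommutativeRing._≉_ (Quotient.quotientRing A (principal A p))
            (CommutativeRingTheory._^_ (Quotient.quotientRing A (principal A p)) r₀ (geometric q e₀ d)) A.1#)
          (r-coprime : Coprime r g) (r≡r₀ : p A.∣ (r A.- r₀)) where

          module R = Radicands g≉0 r

          D-coprime : ∀ i → Coprime (R.radicand i) g
          D-coprime i = coprime-sym (coprime-mod (R.radicand≡r i) (coprime-sym r-coprime))

          D≡r₀ : ∀ i → p A.∣ (R.radicand i A.- r₀)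
          D≡r₀ i = A.∣ʳ-respʳ-≈ (A.solve 3 (λ x r r₀ → ((x A.:- r) A.:+ (r A.:- r₀)) A.:= (x A.:- r₀)) A.refl (R.radicand i) r r₀)
            (A.∣-+ (A.∣ʳ-trans p∣g (R.radicand≡r i)) r≡r₀)

          module E i = KummerExtension g≉0 p-irr p∣g {N} {d} g-card p-card p-witness r₀≉0 r₀-nonresidue (D-coprime i) (D≡r₀ i)

          -- Of two fields the one with the smaller index lacks an n-th root of the other's
          -- radicand, because the prime attached to the later radicand does not divide the earlier
          -- one.
          distinct : ∀ i j → i ≢ j → ¬ (E.K i ≅ E.K j)
          distinct i j i≢j iso = cases (ℕ.<-cmp i j)
            where
            cases : Tri (i < j) (i ≡ j) (j < i) → ⊥
            cases (tri< i<j _ _) = E.no-other-root i (R.prime-irreducible j) (R.prime∣radicand j) (R.prime²∤radicand j)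
              (R.prime∤earlier i<j) (root-preimage iso {n} {fraction (R.radicand j)} (E.has-root j))
            cases (tri≈ _ i≡j _) = i≢j i≡j
            cases (tri> _ _ j<i) = E.no-other-root j (R.prime-irreducible i) (R.prime∣radicand i) (R.prime²∤radicand i)
              (R.prime∤earlier j<i) (root-image iso {n} {fraction (R.radicand i)} (E.has-root i))

      infinitely-many : InfinitelyMany Solution
      infinitely-many = family , Fam.E.solution , Fam.distinct
        where
        g-card = quotient-cardinality g≉0
        prime = witness-prime g≉0 g∤1 squarefree (proj₂ g-card) ¬carmichael
        p : A.Carrier
        p = proj₁ prime
        p-irr : A.Irreducible p
        p-irr = proj₁ (proj₂ prime)
        p∣g : p A.∣ g
        p∣g = proj₁ (proj₂ (proj₂ prime))
        p-card = quotient-cardinality (irreducible-≉0 p-irr)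
        d : ℕ
        d = proj₁ p-card
        nonresidue = FiniteFieldTheory.primitive-root (residueField {p} {d} p-irr (proj₂ p-card)) n (geometric q e₀ d) n-prime
          (geometric-spec e₀ n order-≡ d)
        r = residue squarefree p-irr p∣g (proj₁ nonresidue) (λ p∣r → proj₁ (proj₂ nonresidue) (QuotientTheory.∣⇒Q≈0 A p p∣r))
        module Fam = Family {p} {proj₁ nonresidue} {proj₁ r} p-irr p∣g {proj₁ g-card} {d} (proj₂ g-card) (proj₂ p-card)
          (proj₂ (proj₂ (proj₂ prime))) (proj₁ (proj₂ nonresidue)) (proj₂ (proj₂ nonresidue)) (proj₁ (proj₂ r)) (proj₂ (proj₂ r))
        family : ℕ → FiniteExtension k
        family i = Fam.E.K i

open import Data.Nat.Divisibility using (_∣_)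

-- The case of F[t]

module _ (F : FiniteField) where
  private
    module F = CommutativeRingTheory (FiniteField.ring F)
    module A = CommutativeRingTheory (FunctionField.F[t] F)
    module X = Polynomial (FiniteField.ring F)
    module PA = PolynomialArithmetic F

  constant-hom : RingMorphisms.IsRingHomomorphism (CommutativeRing.rawRing (FiniteField.ring F)) (CommutativeRing.rawRing (FunctionField.F[t] F))
    (Polynomial.constant (FiniteField.ring F))
  constant-hom = mkHomomorphism (FiniteField.ring F) (FunctionField.F[t] F) X.constant (λ e → X.∷-cong e X.reflₚ) (λ x y → X.reflₚ)
    (λ x y → X.∷-cong (F.sym (F.+-identityʳ _)) X.reflₚ) X.reflₚ

  nonconstant⇒≉0 : ∀ {g} → ¬ FunctionField.IsConstant F g → g A.≉ A.0#
  nonconstant⇒≉0 ¬constant g≈0 = ¬constant (F.0# , A.trans g≈0 (A.sym (X.∷-zero F.refl X.reflₚ)))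

  nonconstant⇒∤1 : ∀ {g} → ¬ FunctionField.IsConstant F g → ¬ g A.∣ A.1#
  nonconstant⇒∤1 {g} ¬constant g∣1 = go g (PA.degree {g} (nonconstant⇒≉0 ¬constant)) ¬constant g∣1
    where
    go : ∀ g → ∃ (PA.HasDegree g) → ¬ FunctionField.IsConstant F g → ¬ g A.∣ A.1#
    go g       (suc n , g-deg)          _         = PA.degree⇒nonunit {g} g-deg
    go []      (zero , lead PA., _)     _         _ = lead F.refl
    go (x ∷ g) (zero , _ PA., below)    ¬constant _ = ¬constant (x , X.∷-cong F.refl (X.coeffwise λ i → below (suc i) (s≤s z≤n)))

  quotient-cardinality : ∀ {x} → CommutativeRing._≉_ (FunctionField.F[t] F) x (CommutativeRing.0# (FunctionField.F[t] F)) →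
    ∃[ d ] RingNotions.HasCardinality (Quotient.quotientRing (FunctionField.F[t] F) (principal (FunctionField.F[t] F) x)) (FiniteField.order F ℕ.^ d)
  quotient-cardinality {x} x≉0 = let d , x-deg = PA.degree {x} x≉0 in d , PA.Modulo.quotient-cardinality x-deg

  bezoutDomain : BezoutDomain (FunctionField.F[t] F)
  bezoutDomain = PA.bezoutDomain

  isFractionField : IsFractionField (FunctionField.F[t] F) (FunctionField.F⟨t⟩ F) (Fractions.fraction (FunctionField.F[t] F) (FunctionField.F[t]-isDomain F))
  isFractionField = fractions-isFractionField {FunctionField.F[t] F} (FunctionField.F[t]-isDomain F) dec
    where
    dec : ∀ x y → Dec (CommutativeRing._≈_ (FunctionField.F[t] F) x y)
    dec = BezoutDomain._≈?_ bezoutDomain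

  module _ (K : FiniteExtension (FunctionField.F⟨t⟩ F)) where
    discriminantPrimeTo : ∀ g → IntegralExtension.DiscriminantPrimeTo (FunctionField.F[t] F) (FunctionField.F⟨t⟩ F)
        (Fractions.fraction (FunctionField.F[t] F) (FunctionField.F[t]-isDomain F)) (IsFractionField.fraction-hom isFractionField) K g →
      FunctionField.DiscriminantPrimeTo F K g
    discriminantPrimeTo g prime = prime

    ringOfIntegers : IntegralExtension.RingOfIntegers (FunctionField.F[t] F) (FunctionField.F⟨t⟩ F)
        (Fractions.fraction (FunctionField.F[t] F) (FunctionField.F[t]-isDomain F)) (IsFractionField.fraction-hom isFractionField) K
    ringOfIntegers = record
      { integers        = FunctionField.𝒪 F K
      ; embed           = IC.value
      ; embed-hom       = mkHomomorphism (FunctionField.𝒪 F K) (FiniteExtension.ring K) IC.value IC.same-value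
          (λ x y → FiniteExtension.refl K) (λ x y → FiniteExtension.refl K) (FiniteExtension.refl K)
      ; embed-injective = IC.same
      ; integral        = IC.integral
      ; integer         = λ {x} x-integral → (x IC.∣integral x-integral) , FiniteExtension.refl K
      ; base            = IntegralClosure.fromBase (FunctionField.F[t] F) (FiniteExtension.ring K) (FunctionField.φ F K) (FunctionField.φ-hom F K)
      ; embed-base      = λ r → FiniteExtension.refl K
      }
      where module IC = IntegralClosure (FunctionField.F[t] F) (FiniteExtension.ring K) (FunctionField.φ F K) (FunctionField.φ-hom F K)

    isCarmichaelAt : ∀ g → FunctionField.IsCarmichaelIn F K g → IsCarmichaelAt (FunctionField.𝒪 F K)
      (IntegralClosure.fromBase (FunctionField.F[t] F) (FiniteExtension.ring K) (FunctionField.φ F K) (FunctionField.φ-hom F K) g)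
    isCarmichaelAt g c = carmichaelAt c

  Solution : FunctionField.Poly F → ℕ → FiniteExtension (FunctionField.F⟨t⟩ F) → Set
  Solution g n K = IsCyclicExtension K × FiniteExtension.degree K ≡ n × FunctionField.DiscriminantPrimeTo F K g × ¬ FunctionField.IsCarmichaelIn F K g

  infinitely-many-of-degree : ∀ m → Prime (suc m) → suc m ∣ FiniteField.order F ∸ 1 →
    ∀ g → ¬ FunctionField.IsConstant F g → FunctionField.IsSquareFree F g → ¬ FunctionField.IsCarmichaelPolynomial F g →
    InfinitelyMany (Solution g (suc m))
  infinitely-many-of-degree m n-prime (divides e eq) g ¬constant squarefree ¬carmichael =
    convert (Construction.infinitely-many F (FunctionField.F[t] F) (FunctionField.F⟨t⟩ F) bezoutDomain
      (Fractions.fraction (FunctionField.F[t] F) (FunctionField.F[t]-isDomain F)) isFractionField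
      (Polynomial.constant (FiniteField.ring F)) constant-hom quotient-cardinality ringOfIntegers m n-prime e order-≡ {g} (nonconstant⇒≉0 ¬constant) (nonconstant⇒∤1 ¬constant) squarefree ¬carmichael)
    where
    order-≡ : FiniteField.order F ≡ suc (e ℕ.* suc m)
    order-≡ = ≡.trans (≡.sym (ℕ.m+[n∸m]≡n (ℕ.≤-trans (ℕ.n≤1+n 1) (FiniteFieldTheory.2≤order F)))) (≡.cong suc eq)
    convert : InfinitelyMany (λ K → IntegralExtension.IsSolution (FunctionField.F[t] F) (FunctionField.F⟨t⟩ F)
        (Fractions.fraction (FunctionField.F[t] F) (FunctionField.F[t]-isDomain F)) (IsFractionField.fraction-hom isFractionField) K
        (ringOfIntegers K) (suc m) g) → InfinitelyMany (Solution g (suc m))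
    convert (K , solution , distinct) = K , (λ i → let module S = IntegralExtension.IsSolution (solution i) in
      S.isCyclicExtension , S.degree-≡ , discriminantPrimeTo (K i) g S.discriminantPrimeTo , λ c → S.¬isCarmichaelIn (isCarmichaelAt (K i) g c)) , distinct

theorem5p6 : (F : FiniteField) → let open FunctionField F in
    3 ≤ FiniteField.order F →
    (g : Poly) → ¬ IsConstant g → IsSquareFree g → ¬ IsCarmichaelPolynomial g →
    (ℓ : ℕ) → Prime ℓ → ℓ ∣ FiniteField.order F ∸ 1 →
    InfinitelyMany λ (K : FiniteExtension F⟨t⟩) →
    IsCyclicExtension K
    × FiniteExtension.degree K ≡ ℓ
    × DiscriminantPrimeTo K g
    × ¬ IsCarmichaelIn K g
theorem5p6 F _ g ¬constant squarefree ¬carmichael zero    ℓ-prime = ⊥-elim (¬prime[0] ℓ-prime)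
theorem5p6 F _ g ¬constant squarefree ¬carmichael (suc m) ℓ-prime ℓ∣q-1 =
  infinitely-many-of-degree F m ℓ-prime ℓ∣q-1 g ¬constant squarefree ¬carmichael
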